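{- Let $s,t,k\geq 2$ be integers and $K\geq 1$ a real number. Let $(G_n)$ be a sequence of graphs such that $G_n$ is a $K$-almost-regular graph on $n$ vertices with minimum degree $\delta_n$, where $\delta_n/n^{\frac{s-1}{sk}}\to\infty$ as $n\to\infty$. Then for all sufficiently large $n$, $G_n$ contains $K_{s,t}^k$ as a subgraph.
   Context: A graph $G$ is $K$-almost-regular if $\max_{v} d(v)\leq K\min_{v} d(v)$, where $d(v)$ is the degree of $v$. For a graph $F$, the $k$-subdivision $F^k$ is obtained by replacing each edge of $F$ by a path of length $k$, these paths being internally vertex-disjoint. $K_{s,t}$ is the complete bipartite graph with parts of sizes $s$ and $t$. -}

module Defs where

open import Data.Nat using (ℕ; zero; suc; _+_; _*_; _∸_; _^_; _≤_; _<_)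
open import Data.Nat.Properties using (_<?_)
open import Data.Fin using (Fin; toℕ; fromℕ<; inject₁) renaming (suc to fsuc)
open import Data.Bool using (Bool; true; false; if_then_else_)
open import Data.List using (List; map; allFin)
open import Data.Nat.ListAction using (sum)
open import Data.Product using (Σ; ∃; _×_; _,_)
open import Relation.Nullary using (yes; no)
open import Relation.Binary.PropositionalEquality using (_≡_)
open import Function.Definitions using (Injective)

record Graph (n : ℕ) : Set where
  field
    Adj    : Fin n → Fin n → Bool
    sym    : ∀ u v → Adj u v ≡ Adj v u
    irrefl : ∀ v → Adj v v ≡ false
open Graph public

deg : ∀ {n} → Graph n → Fin n → ℕ
deg {n} G v = sum (map (λ u → if Adj G v u then 1 else 0) (allFin n))

IsMinDegree : ∀ {n} → Graph n → ℕ → Set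
IsMinDegree {n} G d = (∀ v → d ≤ deg G v) × (0 < n → ∃ λ v → deg G v ≡ d)

-- K-almost-regular: max degree ≤ K · min degree, i.e. d(u) ≤ K d(v) for all u, v
AlmostRegular : ∀ {n} → ℕ → Graph n → Set
AlmostRegular {n} K G = ∀ (u v : Fin n) → deg G u ≤ K * deg G v

-- Vertices of the k-subdivision of K_{s,t}: the s + t branch vertices and,
-- for each edge (i , j), k - 1 internal vertices.
data SubVertex (s t k : ℕ) : Set where
  left     : Fin s → SubVertex s t k
  right    : Fin t → SubVertex s t k
  internal : Fin s → Fin t → Fin (k ∸ 1) → SubVertex s t k

pathVertex : ∀ {s t} k → Fin s → Fin t → Fin (suc k) → SubVertex s t k
pathVertex k i j r with toℕ r
... | zero = left i
... | suc q with q <? (k ∸ 1)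
...   | yes p = internal i j (fromℕ< p)
...   | no _  = right j

ContainsSubdivKst : ∀ {n} → Graph n → ℕ → ℕ → ℕ → Set
ContainsSubdivKst {n} G s t k =
  Σ (SubVertex s t k → Fin n) λ φ →
    Injective _≡_ _≡_ φ ×
    (∀ (i : Fin s) (j : Fin t) (m : Fin k) →
       Adj G (φ (pathVertex k i j (inject₁ m))) (φ (pathVertex k i j (fsuc m))) ≡ true)

{-# OPTIONS --safe #-}

-- Let T be the spider with s legs of length k; K_{s,t}^k consists of t copies of T that share the ends of
-- their legs and are otherwise disjoint. Since n δ^(sk) is much larger than n^s, some s vertices are the ends of
-- many embedded copies of T. For every subtree P of T that is a spider with shorter legs or a subpath of a leg,
-- pack the embeddings of P into disjoint blocks of copies (petals) with common ends and disjoint interiors.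
-- If for all P the packed embeddings are rare, most copies of T restrict to unpacked ones for every P. The
-- sunflower lemma then gives petals of T with some kernel, and a component of T minus the kernel is the interior
-- of a P with a block among its unpacked embeddings, a contradiction. So for some P a positive proportion of the
-- embeddings is packed, and deleting sparse classes leaves a nonempty family of copies of P in which every copy
-- has many petals and every end of a leg can be moved to a positive proportion of the admissible vertices.
--
-- If P is a spider with legs of lengths j_i, go from the end of a leg to its neighbour on a fresh petal and on to
-- a new end of that leg. Each such move lengthens the leg by two, which gives K_{s,t}^k when all k - j_i are even;
-- for k - j_i odd start from the neighbour of the end of the leg. The starting points are distinct unless k is
-- even and two legs have length one, and then the family contains paths of length two.
--
-- If P is a path of length l, Kővári–Sós–Turán gives many vertices of one end and many of the other that are
-- pairwise joined by copies of P; the moves turn these into disjoint paths of length l + 2e. For k - l odd one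
-- more edge is needed. When l ≥ 3 it joins an inner vertex of P next to an end to several choices of that end.
-- When l = 2, the petals between one vertex h and its many partners b go through neighbours x of h, so some x
-- have many neighbours b, and the edge is taken from x to b.

module Submission where

open import Defs hiding (sym; irrefl)
open import Data.Nat hiding (_≟_; parity)
open import Data.Nat.Properties hiding (_≟_)
open import Data.Nat.DivMod using (m≡m%n+[m/n]*n; m%n<n; m/n≤m; m*n/n≡m; /-monoˡ-≤; m/n*n≤m)
open import Data.Nat.ListAction using (sum)
open import Data.Nat.Solver using (module +-*-Solver)
open import Data.Fin using (Fin; zero; suc; toℕ; fromℕ<; inject₁; inject≤; cast)
open import Data.Fin.Properties using (_≟_; any?; all?; toℕ-injective; toℕ-inject₁; toℕ-fromℕ<; toℕ-cast; toℕ<n; inject≤-injective; injective⇒≤)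
open import Data.List using (List; []; _∷_; _++_; map; length; filter; concat; allFin; replicate; take; deduplicate; lookup; upTo; cartesianProduct; cartesianProductWith)
open import Data.List.Properties using (length-++; length-map; length-replicate; length-tabulate; length-filter; filter-notAll; filter-none; filter-all; filter-++; ≡-dec; ∷-injectiveˡ; ∷-injectiveʳ)
open import Data.List.Membership.Propositional using (_∈_; _∉_; find; lose)
open import Data.List.Membership.Propositional.Properties
open import Data.List.Relation.Unary.Any as Any using (Any; here; there)
open import Data.List.Relation.Unary.All as All using (All; []; _∷_)
open import Data.List.Relation.Unary.AllPairs as AP using (AllPairs; []; _∷_)
open import Data.List.Relation.Unary.Unique.Propositional using (Unique)
open import Data.Vec as Vec using (Vec; []; _∷_; tabulate; _[_]≔_)
open import Data.Vec.Properties as VecP using (lookup∘tabulate; tabulate∘lookup; tabulate-cong; lookup∘update; lookup∘update′)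
open import Data.Product using (Σ; ∃; ∃₂; _×_; _,_; proj₁; proj₂)
open import Data.Sum using (_⊎_; inj₁; inj₂; [_,_]′)
open import Data.Empty using (⊥; ⊥-elim)
open import Function using (_∘_; id; case_of_)
open import Relation.Nullary
open import Relation.Unary using (Decidable)
open import Relation.Binary.PropositionalEquality
import Data.Bool as Bool
import Data.Fin.Properties as FinP
import Data.List.Relation.Unary.All.Properties as AllP
import Data.List.Relation.Unary.AllPairs.Properties as APP
import Data.List.Relation.Unary.Unique.DecPropositional.Properties as UniqueDec
import Data.List.Relation.Unary.Unique.Propositional.Properties as UniqueP
import Data.Nat as ℕ
import Data.Product.Properties as ×P

open Bool using (true; false; if_then_else_)
open +-*-Solver using (solve; _:+_; _:*_; _:=_; con)

-- Counting in lists

-- Almost-regularity enters through counting: with d about half the minimum degree and D ≤ `K′` d, a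
-- subtree with e edges has between n d^e and n D^e embeddings, and fixing a nonempty part of it
-- leaves at most D^f choices for the f free vertices. So shares of embeddings can be compared
-- across different subtrees. The obstacle is that petals and moves have to survive together:
-- deleting objects with few moves may destroy petals, and conversely. Hence the number of a block
-- is treated as a key, on the same footing as the coordinates that a move keeps, and one potential
-- argument cleans all keys at once; blocks are packed larger by the factor that the cleaning may
-- lose. The order of the constants avoids a circle: the density 1/`C` of a packed shape depends on
-- the number of shapes and on `K′` but not on the size of the blocks. So the loss is fixed first,
-- then the size of the blocks, and the sunflower bound for that size only affects how large n must
-- be.

⊆⇒length≤ : ∀ {A : Set} {xs ys : List A} → Unique xs → (∀ {x} → x ∈ xs → x ∈ ys) → length xs ≤ length ys
⊆⇒length≤ {xs = []} _ _ = z≤n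
⊆⇒length≤ {xs = x ∷ xs} (x∉ ∷ u) sub with ∈-∃++ (sub (here refl))
... | as , bs , refl = begin
  suc (length xs)              ≤⟨ s≤s (⊆⇒length≤ u sub′) ⟩
  suc (length (as ++ bs))      ≡⟨ cong suc (length-++ as) ⟩
  suc (length as + length bs)  ≡⟨ sym (+-suc (length as) (length bs)) ⟩
  length as + suc (length bs)  ≡⟨ sym (length-++ as) ⟩
  length (as ++ x ∷ bs)        ∎
  where
  open ≤-Reasoning
  sub′ : ∀ {y} → y ∈ xs → y ∈ as ++ bs
  sub′ {y} y∈ with ∈-++⁻ as (sub (there y∈))
  ... | inj₁ p = ∈-++⁺ˡ p
  ... | inj₂ (here refl) = ⊥-elim (All.lookup x∉ y∈ refl)
  ... | inj₂ (there p) = ∈-++⁺ʳ as p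

Unique-filter : ∀ {A : Set} {P : A → Set} (P? : Decidable P) {xs} → Unique xs → Unique (filter P? xs)
Unique-filter P? {[]} [] = []
Unique-filter P? {x ∷ xs} (x∉ ∷ u) with P? x
... | yes _ = All.tabulate (λ y∈ → All.lookup x∉ (proj₁ (∈-filter⁻ P? y∈))) ∷ Unique-filter P? u
... | no _ = Unique-filter P? u

∑ : {A : Set} → List A → (A → ℕ) → ℕ
∑ xs f = sum (map f xs)

#[_]_ : {A : Set} {P : A → Set} → Decidable P → List A → ℕ
#[ P? ] xs = length (filter P? xs)

indicator : {P : Set} → Dec P → ℕ
indicator (yes _) = 1
indicator (no _) = 0

∑-mono : ∀ {A : Set} (xs : List A) {f g : A → ℕ} → (∀ {x} → x ∈ xs → f x ≤ g x) → ∑ xs f ≤ ∑ xs g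
∑-mono [] _ = z≤n
∑-mono (x ∷ xs) le = +-mono-≤ (le (here refl)) (∑-mono xs (le ∘ there))

∑-cong : ∀ {A : Set} (xs : List A) {f g : A → ℕ} → (∀ x → f x ≡ g x) → ∑ xs f ≡ ∑ xs g
∑-cong [] _ = refl
∑-cong (x ∷ xs) e = cong₂ _+_ (e x) (∑-cong xs e)

∑-const : ∀ {A : Set} (xs : List A) c → ∑ xs (λ _ → c) ≡ length xs * c
∑-const [] c = refl
∑-const (x ∷ xs) c = cong (c +_) (∑-const xs c)

∑-+ : ∀ {A : Set} (xs : List A) (f g : A → ℕ) → ∑ xs (λ x → f x + g x) ≡ ∑ xs f + ∑ xs g
∑-+ [] f g = refl
∑-+ (x ∷ xs) f g rewrite ∑-+ xs f g =
  solve 4 (λ a b c d → (a :+ b) :+ (c :+ d) := (a :+ c) :+ (b :+ d)) refl (f x) (g x) (∑ xs f) (∑ xs g)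

#-∷ : ∀ {A : Set} {P : A → Set} (P? : Decidable P) x xs → #[ P? ] (x ∷ xs) ≡ indicator (P? x) + #[ P? ] xs
#-∷ P? x xs with P? x
... | yes _ = refl
... | no _ = refl

∑-indicator : ∀ {A : Set} {P : A → Set} (P? : Decidable P) xs → ∑ xs (indicator ∘ P?) ≡ #[ P? ] xs
∑-indicator P? [] = refl
∑-indicator P? (x ∷ xs) = trans (cong (indicator (P? x) +_) (∑-indicator P? xs)) (sym (#-∷ P? x xs))

double-counting : ∀ {A B : Set} {R : A → B → Set} (R? : ∀ a b → Dec (R a b)) xs ys →
  ∑ xs (λ a → #[ R? a ] ys) ≡ ∑ ys (λ b → #[ (λ a → R? a b) ] xs)
double-counting R? [] ys = sym (trans (∑-const ys 0) (*-zeroʳ (length ys)))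
double-counting R? (x ∷ xs) ys = begin
  #[ R? x ] ys + ∑ xs (λ a → #[ R? a ] ys)
    ≡⟨ cong₂ _+_ (sym (∑-indicator (R? x) ys)) (double-counting R? xs ys) ⟩
  ∑ ys (λ b → indicator (R? x b)) + ∑ ys (λ b → #[ (λ a → R? a b) ] xs)
    ≡⟨ sym (∑-+ ys _ _) ⟩
  ∑ ys (λ b → indicator (R? x b) + #[ (λ a → R? a b) ] xs)
    ≡⟨ ∑-cong ys (λ b → sym (#-∷ (λ a → R? a b) x xs)) ⟩
  ∑ ys (λ b → #[ (λ a → R? a b) ] (x ∷ xs)) ∎
  where open ≡-Reasoning

#-some : ∀ {A : Set} {P : A → Set} (P? : Decidable P) {x xs} → x ∈ xs → P x → 1 ≤ #[ P? ] xs
#-some P? x∈ px = ∈-length (∈-filter⁺ P? x∈ px)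

cover-∑ : ∀ {A B : Set} {R : A → B → Set} (R? : ∀ a b → Dec (R a b)) xs ys →
  (∀ {x} → x ∈ xs → ∃ λ y → y ∈ ys × R x y) → length xs ≤ ∑ ys (λ b → #[ (λ a → R? a b) ] xs)
cover-∑ R? xs ys cov = begin
  length xs                    ≡⟨ sym (*-identityʳ _) ⟩
  length xs * 1                ≡⟨ sym (∑-const xs 1) ⟩
  ∑ xs (λ _ → 1)               ≤⟨ ∑-mono xs (λ x∈ → let _ , y∈ , r = cov x∈ in #-some (R? _) y∈ r) ⟩
  ∑ xs (λ a → #[ R? a ] ys)    ≡⟨ double-counting R? xs ys ⟩
  ∑ ys (λ b → #[ (λ a → R? a b) ] xs) ∎
  where open ≤-Reasoning

cover-bound : ∀ {A B : Set} {R : A → B → Set} (R? : ∀ a b → Dec (R a b)) xs ys c →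
  (∀ {x} → x ∈ xs → ∃ λ y → y ∈ ys × R x y) →
  (∀ {y} → y ∈ ys → #[ (λ a → R? a y) ] xs ≤ c) → length xs ≤ length ys * c
cover-bound R? xs ys c cov small = begin
  length xs                            ≤⟨ cover-∑ R? xs ys cov ⟩
  ∑ ys (λ b → #[ (λ a → R? a b) ] xs)  ≤⟨ ∑-mono ys small ⟩
  ∑ ys (λ _ → c)                       ≡⟨ ∑-const ys c ⟩
  length ys * c                        ∎
  where open ≤-Reasoning

pigeonhole-list : ∀ {A B : Set} {R : A → B → Set} (R? : ∀ a b → Dec (R a b)) xs ys c →
  (∀ {x} → x ∈ xs → ∃ λ y → y ∈ ys × R x y) → length ys * c < length xs →
  ∃ λ y → y ∈ ys × c < #[ (λ a → R? a y) ] xs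
pigeonhole-list R? xs ys c cov big with Any.any? (λ y → c <? #[ (λ a → R? a y) ] xs) ys
... | yes p = find p
... | no ¬p = ⊥-elim (<⇒≱ big (cover-bound R? xs ys c cov λ y∈ → ≮⇒≥ λ lt → ¬p (lose y∈ lt)))

#-split : ∀ {A : Set} {P : A → Set} (P? : Decidable P) xs → length xs ≡ #[ P? ] xs + #[ ¬? ∘ P? ] xs
#-split P? [] = refl
#-split P? (x ∷ xs) with P? x
... | yes _ = cong suc (#-split P? xs)
... | no _ = trans (cong suc (#-split P? xs)) (sym (+-suc _ _))

#-mono : ∀ {A : Set} {P Q : A → Set} (P? : Decidable P) (Q? : Decidable Q) xs →
  (∀ {x} → x ∈ xs → P x → Q x) → #[ P? ] xs ≤ #[ Q? ] xs
#-mono P? Q? [] _ = z≤n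
#-mono P? Q? (x ∷ xs) imp with P? x | Q? x
... | yes p | yes q = s≤s (#-mono P? Q? xs (imp ∘ there))
... | yes p | no ¬q = ⊥-elim (¬q (imp (here refl) p))
... | no _  | yes q = m≤n⇒m≤1+n (#-mono P? Q? xs (imp ∘ there))
... | no _  | no _ = #-mono P? Q? xs (imp ∘ there)

∑-split-bound : ∀ {A : Set} {P : A → Set} (P? : Decidable P) xs (f : A → ℕ) q cap →
  (∀ {x} → x ∈ xs → f x ≤ cap) → (∀ {x} → x ∈ xs → ¬ P x → f x ≤ q) →
  ∑ xs f ≤ #[ P? ] xs * cap + length xs * q
∑-split-bound P? [] f q cap _ _ = z≤n
∑-split-bound P? (x ∷ xs) f q cap le le′ with P? x
... | yes _ = begin
  f x + ∑ xs f            ≤⟨ +-mono-≤ (le (here refl)) (∑-split-bound P? xs f q cap (le ∘ there) (le′ ∘ there)) ⟩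
  cap + (r * cap + l * q) ≤⟨ ≤-reflexive (sym (+-assoc cap (r * cap) (l * q))) ⟩
  cap + r * cap + l * q   ≤⟨ +-monoʳ-≤ (cap + r * cap) (m≤n+m (l * q) q) ⟩
  cap + r * cap + (q + l * q) ∎
  where
  open ≤-Reasoning
  r = #[ P? ] xs
  l = length xs
... | no ¬p = begin
  f x + ∑ xs f            ≤⟨ +-mono-≤ (le′ (here refl) ¬p) (∑-split-bound P? xs f q cap (le ∘ there) (le′ ∘ there)) ⟩
  q + (r * cap + l * q)   ≡⟨ solve 3 (λ a b c → a :+ (b :+ c) := b :+ (a :+ c)) refl q (r * cap) (l * q) ⟩
  r * cap + (q + l * q)   ∎
  where
  open ≤-Reasoning
  r = #[ P? ] xs
  l = length xs

-- An averaging argument: entries with f x < q account for at most the second term, so a larger sum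
-- forces many entries with f x ≥ q. It is applied to traces, to numbers of neighbours and to
-- fibres.
∑-rich : ∀ {A : Set} (xs : List A) (f : A → ℕ) q cap → (∀ {x} → x ∈ xs → f x ≤ cap) →
  ∑ xs f ≤ #[ (λ x → q ≤? f x) ] xs * cap + length xs * q
∑-rich xs f q cap le = ∑-split-bound (λ x → q ≤? f x) xs f q cap le (λ _ ¬q → <⇒≤ (≰⇒> ¬q))

∈-take : ∀ {A : Set} n (xs : List A) {x} → x ∈ take n xs → x ∈ xs
∈-take (suc n) (y ∷ xs) (here e) = here e
∈-take (suc n) (y ∷ xs) (there p) = there (∈-take n xs p)

length-take≤ : ∀ {A : Set} n (xs : List A) → n ≤ length xs → length (take n xs) ≡ n
length-take≤ zero xs _ = refl
length-take≤ (suc n) (x ∷ xs) (s≤s le) = cong suc (length-take≤ n xs le)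

Unique-take : ∀ {A : Set} n {xs : List A} → Unique xs → Unique (take n xs)
Unique-take zero _ = []
Unique-take (suc n) [] = []
Unique-take (suc n) (x∉ ∷ u) = All.tabulate (λ p → All.lookup x∉ (∈-take n _ p)) ∷ Unique-take n u

avoid : ∀ {A : Set} (_≟_ : (x y : A) → Dec (x ≡ y)) {xs F : List A} → Unique xs → length F < length xs →
  ∃ λ x → x ∈ xs × x ∉ F
avoid _≟_ {xs} {F} u lt with Any.any? (λ x → ¬? (Any.any? (x ≟_) F)) xs
... | yes p = find p
... | no ¬p = ⊥-elim (<⇒≱ lt (⊆⇒length≤ u λ {x} x∈ → decidable-stable (Any.any? (x ≟_) F) λ x∉ → ¬p (lose x∈ x∉)))

-- Packing and cleaning

-- For an irreflexive relation `AllPairs` already makes the entries distinct, so a list can serve as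
-- a clique.
Clique : {A : Set} → (A → A → Set) → ℕ → List A → Set
Clique R m X = ∃ λ b → length b ≡ m × (∀ {x} → x ∈ b → x ∈ X) × AllPairs R b

module _ {A : Set} {R : A → A → Set} (R? : ∀ x y → Dec (R x y)) where

  clique? : ∀ m X → Dec (Clique R m X)
  clique? zero X = yes ([] , refl , (λ ()) , [])
  clique? (suc m) X with Any.any? (λ x → clique? m (filter (R? x) X)) X
  ... | yes p with find p
  ...   | x , x∈ , b , len , sub , ap =
    yes (x ∷ b , cong suc len
        , (λ { (here refl) → x∈ ; (there y∈) → proj₁ (∈-filter⁻ (R? x) {xs = X} (sub y∈)) })
        , All.tabulate (λ y∈ → proj₂ (∈-filter⁻ (R? x) {xs = X} (sub y∈))) ∷ ap)
  clique? (suc m) X | no ¬p =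
    no λ { (x ∷ b , len , sub , rx ∷ ap) → ¬p (lose (sub (here refl))
      (b , suc-injective len , (λ y∈ → ∈-filter⁺ (R? x) (sub (there y∈)) (All.lookup rx y∈)) , ap)) }

  -- Choose greedily and keep only the elements related to all choices. If the supply ends before m
  -- choices, every element was discarded because of some choice; these choices are the hitting set
  -- of the sunflower argument.
  greedy-clique : (∀ x → ¬ R x x) → ∀ m X → Clique R m X ⊎
    (∃ λ b → length b ≤ m × (∀ {x} → x ∈ X → ∃ λ y → y ∈ b × ¬ R y x))
  greedy-clique irr zero X = inj₁ ([] , refl , (λ ()) , [])
  greedy-clique irr (suc m) [] = inj₂ ([] , z≤n , λ ())
  greedy-clique irr (suc m) (x ∷ X) with greedy-clique irr m (filter (R? x) (x ∷ X))
  ... | inj₁ (b , len , sub , ap) = inj₁ (x ∷ b , cong suc len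
        , (λ { (here refl) → here refl ; (there y∈) → proj₁ (∈-filter⁻ (R? x) {xs = x ∷ X} (sub y∈)) })
        , All.tabulate (λ y∈ → proj₂ (∈-filter⁻ (R? x) {xs = x ∷ X} (sub y∈))) ∷ ap)
  ... | inj₂ (b , len , hit) = inj₂ (x ∷ b , s≤s len , hit′)
    where
    hit′ : ∀ {z} → z ∈ x ∷ X → ∃ λ y → y ∈ x ∷ b × ¬ R y z
    hit′ {z} z∈ with R? x z
    ... | no ¬r = x , here refl , ¬r
    ... | yes r with hit (∈-filter⁺ (R? x) z∈ r)
    ...   | y , y∈ , ¬r = y , there y∈ , ¬r

-- Blocks have exactly m entries because the cleaning counts the survivors of each block.
-- `exhausted` is the form of maximality that the sunflower argument contradicts.
record Packing {A : Set} (R : A → A → Set) (m : ℕ) (X : List A) : Set where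
  field
    blocks       : List (List A)
    leftover     : List A
    block-length : ∀ {b} → b ∈ blocks → length b ≡ m
    block-pairs  : ∀ {b} → b ∈ blocks → AllPairs R b
    block-sub    : ∀ {b} → b ∈ blocks → ∀ {x} → x ∈ b → x ∈ X
    disjoint     : AllPairs (λ b b′ → ∀ x → x ∈ b → x ∉ b′) blocks
    exhausted    : ¬ Clique R m leftover
    covers       : ∀ {x} → x ∈ X → x ∉ concat blocks → x ∈ leftover

  covered : List A
  covered = concat blocks

AllPairs⇒Unique : {A : Set} {R : A → A → Set} → (∀ x → ¬ R x x) → ∀ {b} → AllPairs R b → Unique b
AllPairs⇒Unique irr [] = []
AllPairs⇒Unique irr (rx ∷ ap) = All.map (λ { r refl → irr _ r }) rx ∷ AllPairs⇒Unique irr ap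

module _ {A : Set} (_≟_ : (x y : A) → Dec (x ≡ y)) where

  _∈?_ : (x : A) (xs : List A) → Dec (x ∈ xs)
  x ∈? xs = Any.any? (x ≟_) xs

  pack : {R : A → A → Set} (R? : ∀ x y → Dec (R x y)) (m fuel : ℕ) (X : List A) → length X ≤ fuel →
    Packing R (suc m) X
  pack R? m fuel X le with clique? R? (suc m) X
  ... | no ¬c = record
    { blocks = [] ; leftover = X ; block-length = λ () ; block-pairs = λ () ; block-sub = λ ()
    ; disjoint = [] ; exhausted = ¬c ; covers = λ x∈ _ → x∈ }
  pack R? m zero [] le | yes (x ∷ b , len , sub , ap) = case sub (here refl) of λ ()
  pack {R} R? m (suc fuel) X le | yes (x ∷ b₀ , len , sub , ap) = record
    { blocks = b ∷ P.blocks ; leftover = P.leftover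
    ; block-length = λ { (here refl) → len ; (there p) → P.block-length p }
    ; block-pairs = λ { (here refl) → ap ; (there p) → P.block-pairs p }
    ; block-sub = λ { (here refl) → sub ; (there p) y∈ → proj₁ (∈-filter⁻ (λ y → ¬? (y ∈? b)) {xs = X} (P.block-sub p y∈)) }
    ; disjoint = All.tabulate (λ p y y∈b y∈b′ → proj₂ (∈-filter⁻ (λ y → ¬? (y ∈? b)) {xs = X} (P.block-sub p y∈b′)) y∈b) ∷ P.disjoint
    ; exhausted = P.exhausted
    ; covers = λ y∈ y∉ → P.covers (∈-filter⁺ (λ y → ¬? (y ∈? b)) y∈ (y∉ ∘ ∈-++⁺ˡ)) (y∉ ∘ ∈-++⁺ʳ b)
    }
    where
    b = x ∷ b₀
    rest = filter (λ y → ¬? (y ∈? b)) X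
    module P = Packing (pack R? m fuel rest
      (≤-pred (≤-trans (filter-notAll (λ y → ¬? (y ∈? b)) X (lose (sub (here refl)) (λ ¬p → ¬p (here refl)))) le)))

-- A rule partitions `space` into classes of equal `key`; the cleaning compares the part of a class
-- in the current set with the whole class. Keys are lists of numbers so that block numbers and
-- tuples of vertices are treated alike.
record Rule (A : Set) : Set where
  field
    key   : A → List ℕ
    space : List A

open Rule

key≟ : (x y : List ℕ) → Dec (x ≡ y)
key≟ = ≡-dec ℕ._≟_

sameKey? : {A : Set} (k : A → List ℕ) (x y : A) → Dec (k y ≡ k x)
sameKey? k x y = key≟ (k y) (k x)

class : {A : Set} → (A → List ℕ) → A → List A → ℕ
class k x X = #[ sameKey? k x ] X

alive? : {A : Set} (k : A → List ℕ) (X : List A) (ω : A) → Dec (Any (λ x → k ω ≡ k x) X)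
alive? k X ω = Any.any? (λ x → key≟ (k ω) (k x)) X

-- A class contributes its full size in `space` until its last member in X is deleted. So deleting a
-- class at once lowers the potential by that full size, however few members were left.
pot : {A : Set} → List A → Rule A → ℕ
pot X r = #[ alive? (key r) X ] (space r)

#-disjoint : ∀ {A : Set} {P Q S : A → Set} (P? : Decidable P) (Q? : Decidable Q) (S? : Decidable S) xs →
  (∀ {x} → P x → Q x → ⊥) → (∀ {x} → P x → S x) → (∀ {x} → Q x → S x) →
  #[ P? ] xs + #[ Q? ] xs ≤ #[ S? ] xs
#-disjoint P? Q? S? [] _ _ _ = z≤n
#-disjoint P? Q? S? (x ∷ xs) d ps qs with P? x | Q? x | S? x
... | yes p | yes q | _ = ⊥-elim (d p q)
... | yes p | no _ | yes _ = s≤s (#-disjoint P? Q? S? xs d ps qs)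
... | yes p | no _ | no ¬s = ⊥-elim (¬s (ps p))
... | no _ | yes q | yes _ = ≤-trans (≤-reflexive (+-suc _ _)) (s≤s (#-disjoint P? Q? S? xs d ps qs))
... | no _ | yes q | no ¬s = ⊥-elim (¬s (qs q))
... | no _ | no _ | yes _ = m≤n⇒m≤1+n (#-disjoint P? Q? S? xs d ps qs)
... | no _ | no _ | no _ = #-disjoint P? Q? S? xs d ps qs

∑-mono-gap : ∀ {A : Set} (xs : List A) {f g : A → ℕ} {a x} → (∀ y → f y ≤ g y) → x ∈ xs → f x + a ≤ g x →
  ∑ xs f + a ≤ ∑ xs g
∑-mono-gap (x ∷ xs) {f} {g} {a} le (here refl) gap = begin
  f x + ∑ xs f + a    ≡⟨ solve 3 (λ a b c → a :+ b :+ c := a :+ c :+ b) refl (f x) (∑ xs f) a ⟩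
  f x + a + ∑ xs f    ≤⟨ +-mono-≤ gap (∑-mono xs (λ {y} _ → le y)) ⟩
  g x + ∑ xs g        ∎
  where open ≤-Reasoning
∑-mono-gap (y ∷ xs) {f} {g} {a} le (there x∈) gap = begin
  f y + ∑ xs f + a    ≡⟨ +-assoc (f y) _ a ⟩
  f y + (∑ xs f + a)  ≤⟨ +-mono-≤ (le y) (∑-mono-gap xs le x∈ gap) ⟩
  g y + ∑ xs g        ∎
  where open ≤-Reasoning

KeyRich : {A : Set} → ℕ → List (Rule A) → List A → Set
KeyRich M rs X = ∀ {r x} → r ∈ rs → x ∈ X → class (key r) x (space r) ≤ M * class (key r) x X

-- Removing a whole violating class decreases the potential by more than it decreases M times the size.
clean : ∀ {A : Set} M (rs : List (Rule A)) fuel X → length X ≤ fuel → Unique X → ∑ rs (pot X) < M * length X →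
  ∃ λ X′ → 0 < length X′ × (∀ {x} → x ∈ X′ → x ∈ X) × Unique X′ × KeyRich M rs X′
clean M rs fuel X le u surplus
  with Any.any? (λ r → Any.any? (λ x → M * class (key r) x X <? class (key r) x (space r)) X) rs
... | no ¬p = X , pos X surplus , id , u , λ r∈ x∈ → ≮⇒≥ (λ lt → ¬p (lose r∈ (lose x∈ lt)))
  where
  pos : ∀ Y → ∑ rs (pot X) < M * length Y → 0 < length Y
  pos [] lt = ⊥-elim (n≮0 (subst (∑ rs (pot X) <_) (*-zeroʳ M) lt))
  pos (_ ∷ _) _ = s≤s z≤n
... | yes p with find p
... | r , r∈ , q with find q
clean M rs zero [] le u surplus | yes p | r , r∈ , q | x , () , lt
clean M rs (suc fuel) X le u surplus | yes p | r , r∈ , q | x , x∈ , lt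
  = let X″ , pos , sub , u″ , st = clean M rs fuel X′ le′ (Unique-filter _ u) surplus′
    in X″ , pos , (λ y∈ → proj₁ (∈-filter⁻ (¬? ∘ same) {xs = X} (sub y∈))) , u″ , st
  where
  same = sameKey? (key r) x
  X′ = filter (¬? ∘ same) X
  le′ : length X′ ≤ fuel
  le′ = ≤-pred (≤-trans (filter-notAll (¬? ∘ same) X (lose x∈ (λ ¬e → ¬e refl))) le)
  alive-mono : ∀ (k : _ → List ℕ) {ω} → Any (λ x → k ω ≡ k x) X′ → Any (λ x → k ω ≡ k x) X
  alive-mono k al = let y , y∈ , e = find al in lose (proj₁ (∈-filter⁻ (¬? ∘ same) {xs = X} y∈)) e
  pot-mono : ∀ r′ → pot X′ r′ ≤ pot X r′
  pot-mono r′ = #-mono (alive? (key r′) X′) (alive? (key r′) X) (space r′) (λ _ → alive-mono (key r′))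
  pot-gap : pot X′ r + class (key r) x (space r) ≤ pot X r
  pot-gap = #-disjoint (alive? (key r) X′) same (alive? (key r) X) (space r)
    (λ al e → let y , y∈ , e′ = find al in proj₂ (∈-filter⁻ (¬? ∘ same) {xs = X} y∈) (trans (sym e′) e))
    (alive-mono (key r)) (λ e → lose x∈ e)
  surplus′ : ∑ rs (pot X′) < M * length X′
  surplus′ = +-cancelʳ-< (class (key r) x (space r)) _ _ (begin-strict
    ∑ rs (pot X′) + class (key r) x (space r)  ≤⟨ ∑-mono-gap rs pot-mono r∈ pot-gap ⟩
    ∑ rs (pot X)                               <⟨ surplus ⟩
    M * length X                               ≡⟨ cong (M *_) (#-split same X) ⟩
    M * (class (key r) x X + length X′)        ≡⟨ *-distribˡ-+ M (class (key r) x X) (length X′) ⟩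
    M * class (key r) x X + M * length X′      ≤⟨ +-monoˡ-≤ _ (<⇒≤ lt) ⟩
    class (key r) x (space r) + M * length X′  ≡⟨ +-comm (class (key r) x (space r)) _ ⟩
    M * length X′ + class (key r) x (space r)  ∎)
    where open ≤-Reasoning

module _ {A : Set} (_≟A_ : (x y : A) → Dec (x ≡ y)) where

  private
    _∈A?_ = _∈?_ _≟A_

  -- The position of the first block that contains x, which turns lying in the same block into
  -- equality of a key.
  blockId : List (List A) → A → ℕ
  blockId [] x = 0
  blockId (b ∷ bs) x with x ∈A? b
  ... | yes _ = 0
  ... | no _ = suc (blockId bs x)

  blockId-same : ∀ {bs b x y} → AllPairs (λ b b′ → ∀ x → x ∈ b → x ∉ b′) bs → b ∈ bs → x ∈ b → y ∈ b →
    blockId bs x ≡ blockId bs y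
  blockId-same {b ∷ bs} {x = x} {y} d (here refl) x∈ y∈ with x ∈A? b | y ∈A? b
  ... | yes _ | yes _ = refl
  ... | no x∉ | _ = ⊥-elim (x∉ x∈)
  ... | _ | no y∉ = ⊥-elim (y∉ y∈)
  blockId-same {b ∷ bs} {x = x} {y} (d ∷ ds) (there b∈) x∈ y∈ with x ∈A? b | y ∈A? b
  ... | yes p | _ = ⊥-elim (All.lookup d b∈ x p x∈)
  ... | _ | yes p = ⊥-elim (All.lookup d b∈ y p y∈)
  ... | no _ | no _ = cong suc (blockId-same ds b∈ x∈ y∈)

  blockId-injective : ∀ {bs b x y} → AllPairs (λ b b′ → ∀ x → x ∈ b → x ∉ b′) bs → b ∈ bs → x ∈ b →
    y ∈ concat bs → blockId bs y ≡ blockId bs x → y ∈ b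
  blockId-injective {b ∷ bs} {x = x} {y} d (here refl) x∈ y∈ e with x ∈A? b | y ∈A? b
  ... | no x∉ | _ = ⊥-elim (x∉ x∈)
  ... | yes _ | yes p = p
  blockId-injective {b ∷ bs} {x = x} {y} d (here refl) x∈ y∈ () | yes _ | no _
  blockId-injective {b ∷ bs} {x = x} {y} (d ∷ ds) (there b∈) x∈ y∈ e with x ∈A? b | y ∈A? b
  ... | yes p | _ = ⊥-elim (All.lookup d b∈ x p x∈)
  blockId-injective {b ∷ bs} {x = x} {y} (d ∷ ds) (there b∈) x∈ y∈ () | no _ | yes p
  ... | no _ | no y∉ with ∈-++⁻ b y∈
  ...   | inj₁ p = ⊥-elim (y∉ p)
  ...   | inj₂ p = blockId-injective ds b∈ x∈ p (suc-injective e)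

  -- `rich` compares with the classes in all of Ω and not only in the packed part, since the lower
  -- bounds on classes come from counting all embeddings.
  record Stabilised (R : A → A → Set) (M L : ℕ) (keys : List (A → List ℕ)) (Ω : List A) : Set where
    field
      core     : List A
      nonempty : 0 < length core
      core-sub : ∀ {x} → x ∈ core → x ∈ Ω
      unique   : Unique core
      petals   : ∀ {x} → x ∈ core → ∃ λ b → L ≤ length b × x ∈ b × (∀ {y} → y ∈ b → y ∈ core) × AllPairs R b
      rich     : ∀ {k x} → k ∈ keys → x ∈ core → class k x Ω ≤ M * class k x core

  concat-unique : ∀ {bs : List (List A)} → (∀ {b} → b ∈ bs → Unique b) →
    AllPairs (λ b b′ → ∀ x → x ∈ b → x ∉ b′) bs → Unique (concat bs)
  concat-unique {[]} _ _ = []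
  concat-unique {b ∷ bs} u (d ∷ ds) = APP.++⁺ (u (here refl)) (concat-unique (u ∘ there) ds)
    (All.tabulate λ x∈ → All.tabulate λ { y∈ refl → let b′ , y∈′ , b′∈ = ∈-concat⁻′ bs y∈ in All.lookup d b′∈ _ x∈ y∈′ })

  -- The cleaning starts from all covered elements. The block rule has potential at most their
  -- number and every other rule at most C times it, so the hypothesis on M gives the surplus that
  -- `clean` needs. A block has suc M * L entries and richness for the block key loses at most the
  -- factor suc M, so L petals survive in each block that still meets the core.
  stabilise : ∀ {R} (irr : ∀ x → ¬ R x x) M L C keys Ω (P : Packing R (suc M * L) Ω) →
    0 < length (Packing.covered P) → length Ω ≤ C * length (Packing.covered P) →
    1 + length keys * C ≤ M →
    Stabilised R (suc M) L keys Ω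
  stabilise {R} irr M L C keys Ω P ne dense M≥ = record
    { core = core ; nonempty = pos
    ; core-sub = λ x∈ → let b , x∈b , b∈ = ∈-concat⁻′ P.blocks (sub x∈) in P.block-sub b∈ x∈b
    ; unique = u
    ; petals = petals
    ; rich = λ k∈ x∈ → st (there (∈-map⁺ _ k∈)) x∈ }
    where
    module P = Packing P
    blockKey : A → List ℕ
    blockKey x = blockId P.blocks x ∷ []
    rules : List (Rule A)
    rules = record { key = blockKey ; space = P.covered } ∷ map (λ k → record { key = k ; space = Ω }) keys
    pots : ∀ ks → ∑ (map (λ k → record { key = k ; space = Ω }) ks) (pot P.covered) ≤ length ks * length Ω
    pots [] = z≤n
    pots (k ∷ ks) = +-mono-≤ (length-filter (alive? k P.covered) Ω) (pots ks)
    start : ∑ rules (pot P.covered) < suc M * length P.covered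
    start = begin-strict
      ∑ rules (pot P.covered)                          ≤⟨ +-mono-≤ (length-filter (alive? blockKey P.covered) P.covered) (pots keys) ⟩
      length P.covered + length keys * length Ω        ≤⟨ +-monoʳ-≤ (length P.covered) (*-monoʳ-≤ (length keys) dense) ⟩
      length P.covered + length keys * (C * length P.covered) ≡⟨ cong (length P.covered +_) (sym (*-assoc (length keys) C _)) ⟩
      (1 + length keys * C) * length P.covered         ≤⟨ *-monoˡ-≤ (length P.covered) M≥ ⟩
      M * length P.covered                             <⟨ +-monoˡ-≤ (M * length P.covered) ne ⟩
      suc M * length P.covered                         ∎
      where open ≤-Reasoning
    uC : Unique P.covered
    uC = concat-unique (λ b∈ → AllPairs⇒Unique irr (P.block-pairs b∈)) P.disjoint
    cl = clean (suc M) rules (length P.covered) P.covered ≤-refl uC start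
    core = proj₁ cl
    pos = proj₁ (proj₂ cl)
    sub : ∀ {x} → x ∈ core → x ∈ P.covered
    sub = proj₁ (proj₂ (proj₂ cl))
    u = proj₁ (proj₂ (proj₂ (proj₂ cl)))
    st = proj₂ (proj₂ (proj₂ (proj₂ cl)))
    petals : ∀ {x} → x ∈ core → ∃ λ b → L ≤ length b × x ∈ b × (∀ {y} → y ∈ b → y ∈ core) × AllPairs R b
    petals {x} x∈ with ∈-concat⁻′ P.blocks (sub x∈)
    ... | b , x∈b , b∈ = filter (_∈A? core) b , *-cancelˡ-≤ (suc M) bound , ∈-filter⁺ (_∈A? core) x∈b x∈
          , (λ y∈ → proj₂ (∈-filter⁻ (_∈A? core) {xs = b} y∈)) , APP.filter⁺ (_∈A? core) (P.block-pairs b∈)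
      where
      open ≤-Reasoning
      bound : suc M * L ≤ suc M * length (filter (_∈A? core) b)
      bound = begin
        suc M * L                    ≡⟨ sym (P.block-length b∈) ⟩
        length b                     ≤⟨ ⊆⇒length≤ (AllPairs⇒Unique irr (P.block-pairs b∈))
                                          (λ y∈ → ∈-filter⁺ (sameKey? blockKey x) (∈-concat⁺′ y∈ b∈)
                                             (cong (_∷ []) (blockId-same P.disjoint b∈ y∈ x∈b))) ⟩
        class blockKey x P.covered   ≤⟨ st (here refl) x∈ ⟩
        suc M * class blockKey x core ≤⟨ *-monoʳ-≤ (suc M) (⊆⇒length≤ (Unique-filter (sameKey? blockKey x) u)
                                          λ y∈ → let y∈c , e = ∈-filter⁻ (sameKey? blockKey x) {xs = core} y∈ in
                                            ∈-filter⁺ (_∈A? core) (blockId-injective P.disjoint b∈ x∈b (sub y∈c) (∷-injectiveˡ e)) y∈c) ⟩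
        suc M * length (filter (_∈A? core) b) ∎

-- Trees and their embeddings

-- graft q T attaches a new vertex to q; the new vertex is numbered zero and the old numbers are shifted.
data Tree : ℕ → Set where
  single : Tree 0
  graft  : ∀ {e} → Fin (suc e) → Tree e → Tree (suc e)

Edge : ∀ {e} → Tree e → Fin (suc e) → Fin (suc e) → Set
Edge single _ _ = ⊥
Edge (graft q T) zero zero = ⊥
Edge (graft q T) zero (suc p) = p ≡ q
Edge (graft q T) (suc p) zero = ⊥
Edge (graft q T) (suc p) (suc p′) = Edge T p p′

-- Connectedness in the form used below: a set that is neither empty nor everything is left by some
-- edge. If the set is constant on the older vertices, the edge of the newest vertex crosses.
boundary : ∀ {e} (T : Tree e) {P : Fin (suc e) → Set} (P? : Decidable P) → ∃ P → ∃ (λ q → ¬ P q) →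
  ∃₂ λ p q → P p × ¬ P q × (Edge T p q ⊎ Edge T q p)
boundary single P? (zero , px) (zero , ¬px) = ⊥-elim (¬px px)
boundary (graft q T) P? yesP noP with any? (P? ∘ suc) | any? (¬? ∘ P? ∘ suc)
... | yes y | yes z = let a , b , pa , pb , e = boundary T (P? ∘ suc) y z in suc a , suc b , pa , pb , e
boundary (graft q T) P? yesP (zero , ¬p0) | _ | no ¬z =
  suc q , zero , decidable-stable (P? (suc q)) (λ ¬p → ¬z (q , ¬p)) , ¬p0 , inj₂ refl
boundary (graft q T) P? yesP (suc z , ¬pz) | _ | no ¬z = ⊥-elim (¬z (z , ¬pz))
boundary (graft q T) P? (zero , p0) noP | no ¬y | yes _ = zero , suc q , p0 , (λ p → ¬y (q , p)) , inj₁ refl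
boundary (graft q T) P? (suc y , py) noP | no ¬y | yes _ = ⊥-elim (¬y (y , py))

Agree : ∀ {V : Set} {N} → List (Fin N) → Vec V N → Vec V N → Set
Agree U x y = ∀ p → p ∉ U → Vec.lookup x p ≡ Vec.lookup y p

lookup-ext : ∀ {V : Set} {N} {x y : Vec V N} → (∀ p → Vec.lookup x p ≡ Vec.lookup y p) → x ≡ y
lookup-ext {x = x} {y} e = trans (sym (tabulate∘lookup x)) (trans (tabulate-cong e) (tabulate∘lookup y))

restrict : ∀ {V : Set} {N N′} → (Fin N′ → Fin N) → Vec V N → Vec V N′
restrict ι h = tabulate (Vec.lookup h ∘ ι)

all-equal⇒length≤1 : ∀ {A : Set} {X : List A} → Unique X → (∀ {x y} → x ∈ X → y ∈ X → x ≡ y) → length X ≤ 1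
all-equal⇒length≤1 {X = []} _ _ = z≤n
all-equal⇒length≤1 {X = x ∷ []} _ _ = s≤s z≤n
all-equal⇒length≤1 {X = x ∷ y ∷ X} ((x≢y ∷ _) ∷ _) eq = ⊥-elim (x≢y (eq (here refl) (there (here refl))))

length-allFin : ∀ N → length (allFin N) ≡ N
length-allFin N = length-tabulate id

_∈F?_ : ∀ {N} (p : Fin N) (U : List (Fin N)) → Dec (p ∈ U)
p ∈F? U = Any.any? (p ≟_) U

module InGraph {n : ℕ} (G : Graph n) where

  V : Set
  V = Fin n

  _~_ : V → V → Set
  u ~ v = Adj G u v ≡ true

  ~-sym : ∀ {u v} → u ~ v → v ~ u
  ~-sym {u} {v} e = trans (sym (Graph.sym G u v)) e

  ~⇒≢ : ∀ {u v} → u ~ v → u ≢ v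
  ~⇒≢ {u} e refl = case trans (sym e) (Graph.irrefl G u) of λ ()

  ~? : ∀ u v → Dec (u ~ v)
  ~? u v = Adj G u v Bool.≟ true

  nbrs : V → List V
  nbrs v = filter (~? v) (allFin n)

  ∈-nbrs : ∀ {u v} → u ~ v → v ∈ nbrs u
  ∈-nbrs {u} e = ∈-filter⁺ (~? u) (∈-allFin _) e

  nbrs-~ : ∀ {u v} → v ∈ nbrs u → u ~ v
  nbrs-~ {u} v∈ = proj₂ (∈-filter⁻ (~? u) {xs = allFin n} v∈)

  nbrs-unique : ∀ v → Unique (nbrs v)
  nbrs-unique v = Unique-filter (~? v) (UniqueP.allFin⁺ n)

  deg≡length-nbrs : ∀ v → deg G v ≡ length (nbrs v)
  deg≡length-nbrs v = go (allFin n)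
    where
    go : ∀ us → ∑ us (λ u → if Adj G v u then 1 else 0) ≡ length (filter (~? v) us)
    go [] = refl
    go (u ∷ us) with Adj G v u
    ... | true = cong suc (go us)
    ... | false = go us

  IsHom : ∀ {e} → Tree e → Vec V (suc e) → Set
  IsHom T h = ∀ {p q} → Edge T p q → Vec.lookup h p ~ Vec.lookup h q

  IsInj : ∀ {N} → Vec V N → Set
  IsInj h = ∀ {p q} → Vec.lookup h p ≡ Vec.lookup h q → p ≡ q

  fresh : ∀ {N} → Vec V N → V → List V
  fresh h v = filter (λ u → ¬? (u ∈F? Vec.toList h)) (nbrs v)

  embeddings : ∀ {e} → Tree e → List (Vec V (suc e))
  embeddings single = map (_∷ []) (allFin n)
  embeddings (graft q T) = concat (map (λ h → map (_∷ h) (fresh h (Vec.lookup h q))) (embeddings T))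

  ∈-toList : ∀ {N} (h : Vec V N) p → Vec.lookup h p ∈ Vec.toList h
  ∈-toList (x ∷ h) zero = here refl
  ∈-toList (x ∷ h) (suc p) = there (∈-toList h p)

  toList-∈ : ∀ {N} (h : Vec V N) {v} → v ∈ Vec.toList h → ∃ λ p → v ≡ Vec.lookup h p
  toList-∈ (x ∷ h) (here e) = zero , e
  toList-∈ (x ∷ h) (there v∈) = let p , e = toList-∈ h v∈ in suc p , e

  embeddings-complete : ∀ {e} (T : Tree e) h → IsHom T h → IsInj h → h ∈ embeddings T
  embeddings-complete single (v ∷ []) hom inj = ∈-map⁺ (_∷ []) (∈-allFin v)
  embeddings-complete (graft q T) (v ∷ h) hom inj =
    ∈-concat⁺′ (∈-map⁺ (_∷ h) (∈-filter⁺ (λ u → ¬? (u ∈F? Vec.toList h)) (∈-nbrs (~-sym (hom {zero} {suc q} refl)))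
                 λ v∈ → let p , e = toList-∈ h v∈ in case inj {zero} {suc p} e of λ ()))
               (∈-map⁺ _ (embeddings-complete T h (λ {p} {q} → hom {suc p} {suc q})
                 (λ {p} {q} e → case inj {suc p} {suc q} e of λ { refl → refl })))

  private
    unpack : ∀ {e} q (T : Tree e) {h} → h ∈ embeddings (graft q T) →
      ∃₂ λ v h′ → h ≡ v ∷ h′ × h′ ∈ embeddings T × v ∈ fresh h′ (Vec.lookup h′ q)
    unpack q T h∈ with ∈-concat⁻′ (map (λ h → map (_∷ h) (fresh h (Vec.lookup h q))) (embeddings T)) h∈
    ... | hs , h∈hs , hs∈ with ∈-map⁻ (λ h → map (_∷ h) (fresh h (Vec.lookup h q))) hs∈
    ... | h′ , h′∈ , refl with ∈-map⁻ (_∷ h′) h∈hs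
    ... | v , v∈ , refl = v , h′ , refl , h′∈ , v∈

  embeddings-hom : ∀ {e} (T : Tree e) {h} → h ∈ embeddings T → IsHom T h
  embeddings-hom single h∈ ()
  embeddings-hom (graft q T) h∈ {p} {p′} edge with unpack q T h∈
  embeddings-hom (graft q T) h∈ {zero} {suc p′} refl | v , h′ , refl , h′∈ , v∈ =
    ~-sym (nbrs-~ (proj₁ (∈-filter⁻ (λ u → ¬? (u ∈F? Vec.toList h′)) v∈)))
  embeddings-hom (graft q T) h∈ {suc p} {suc p′} edge | v , h′ , refl , h′∈ , v∈ = embeddings-hom T h′∈ edge

  embeddings-inj : ∀ {e} (T : Tree e) {h} → h ∈ embeddings T → IsInj h
  embeddings-inj single h∈ {zero} {zero} _ = refl
  embeddings-inj (graft q T) h∈ {p} {p′} eq with unpack q T h∈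
  embeddings-inj (graft q T) h∈ {zero} {zero} eq | _ = refl
  embeddings-inj (graft q T) h∈ {suc p} {suc p′} eq | v , h′ , refl , h′∈ , v∈ = cong suc (embeddings-inj T h′∈ eq)
  embeddings-inj (graft q T) h∈ {zero} {suc p′} eq | v , h′ , refl , h′∈ , v∈ =
    ⊥-elim (proj₂ (∈-filter⁻ (λ u → ¬? (u ∈F? Vec.toList h′)) {xs = nbrs (Vec.lookup h′ q)} v∈) (subst (_∈ Vec.toList h′) (sym eq) (∈-toList h′ p′)))
  embeddings-inj (graft q T) h∈ {suc p} {zero} eq | v , h′ , refl , h′∈ , v∈ =
    ⊥-elim (proj₂ (∈-filter⁻ (λ u → ¬? (u ∈F? Vec.toList h′)) {xs = nbrs (Vec.lookup h′ q)} v∈) (subst (_∈ Vec.toList h′) eq (∈-toList h′ p)))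

  embeddings-unique : ∀ {e} (T : Tree e) → Unique (embeddings T)
  embeddings-unique single = UniqueP.map⁺ (λ { refl → refl }) (UniqueP.allFin⁺ n)
  embeddings-unique (graft q T) = go (embeddings-unique T)
    where
    ext : Vec V _ → List (Vec V _)
    ext h = map (_∷ h) (fresh h (Vec.lookup h q))
    go : ∀ {hs} → Unique hs → Unique (concat (map ext hs))
    go [] = []
    go {h ∷ hs} (h∉ ∷ u) = UniqueP.++⁺
      (UniqueP.map⁺ (λ { refl → refl }) (Unique-filter (λ u → ¬? (u ∈F? Vec.toList h)) (nbrs-unique (Vec.lookup h q)))) (go u)
      λ { (x∈ , y∈) → let v , _ , e₁ = ∈-map⁻ (_∷ h) x∈
                          l , l∈ , m∈ = ∈-concat⁻′ (map ext hs) y∈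
                          h′ , h′∈ , e₂ = ∈-map⁻ ext m∈
                          v′ , _ , e₃ = ∈-map⁻ (_∷ h′) (subst (_ ∈_) e₂ l∈)
                      in All.lookup h∉ h′∈ (VecP.∷-injectiveʳ (trans (sym e₁) e₃)) }

  module _ {d E : ℕ} (deg≥ : ∀ v → d + suc E ≤ deg G v) where

    -- The slack `suc E` in the degree pays for the vertices that h already occupies.
    fresh-count : ∀ {N} (h : Vec V N) v → N ≤ suc E → d ≤ length (fresh h v)
    fresh-count {N} h v N≤ = +-cancelʳ-≤ (suc E) d _ (begin
      d + suc E                    ≤⟨ deg≥ v ⟩
      deg G v                      ≡⟨ deg≡length-nbrs v ⟩
      length (nbrs v)              ≡⟨ #-split (_∈F? Vec.toList h) (nbrs v) ⟩
      length used + length (fresh h v) ≤⟨ +-monoˡ-≤ _ used≤ ⟩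
      N + length (fresh h v)       ≤⟨ +-monoˡ-≤ _ N≤ ⟩
      suc E + length (fresh h v)   ≡⟨ +-comm (suc E) _ ⟩
      length (fresh h v) + suc E   ∎)
      where
      open ≤-Reasoning
      used = filter (_∈F? Vec.toList h) (nbrs v)
      used≤ : length used ≤ N
      used≤ = ≤-trans (⊆⇒length≤ (Unique-filter (_∈F? Vec.toList h) (nbrs-unique v)) (λ x∈ → proj₂ (∈-filter⁻ (_∈F? Vec.toList h) {xs = nbrs v} x∈)))
                (≤-reflexive (VecP.length-toList h))

    embeddings-count : ∀ {e} (T : Tree e) → e ≤ E → n * d ^ e ≤ length (embeddings T)
    embeddings-count single _ = ≤-reflexive (trans (*-identityʳ n) (sym (trans (length-map (_∷ []) (allFin n)) (length-allFin n))))
    embeddings-count {suc e} (graft q T) e≤ = begin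
      n * (d * d ^ e)                ≡⟨ cong (n *_) (*-comm d (d ^ e)) ⟩
      n * (d ^ e * d)                ≡⟨ sym (*-assoc n (d ^ e) d) ⟩
      n * d ^ e * d                  ≤⟨ *-monoˡ-≤ d (embeddings-count T (<⇒≤ e≤)) ⟩
      length (embeddings T) * d      ≤⟨ go (embeddings T) ⟩
      length (embeddings (graft q T)) ∎
      where
      open ≤-Reasoning
      ext : Vec V _ → List (Vec V _)
      ext h = map (_∷ h) (fresh h (Vec.lookup h q))
      go : ∀ hs → length hs * d ≤ length (concat (map ext hs))
      go [] = z≤n
      go (h ∷ hs) = begin
        d + length hs * d                              ≤⟨ +-mono-≤ (fresh-count h (Vec.lookup h q) (m≤n⇒m≤1+n e≤)) (go hs) ⟩
        length (fresh h (Vec.lookup h q)) + length (concat (map ext hs)) ≡⟨ cong (_+ _) (sym (length-map (_∷ h) (fresh h (Vec.lookup h q)))) ⟩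
        length (ext h) + length (concat (map ext hs))  ≡⟨ sym (length-++ (ext h)) ⟩
        length (concat (map ext (h ∷ hs)))             ∎

  module _ {D : ℕ} {{_ : NonZero D}} (deg≤ : ∀ v → deg G v ≤ D) where

    -- By `boundary` some free position p is joined to a position q outside U, where all members of
    -- X take the same value. So p has at most D values, and fixing one of them removes p from U.
    extension-bound : ∀ {e} (T : Tree e) fuel (U : List (Fin (suc e))) → length U ≤ fuel → ∃ (_∉ U) →
      ∀ {X} → Unique X → (∀ {x} → x ∈ X → IsHom T x) → (∀ {x y} → x ∈ X → y ∈ X → Agree U x y) →
      length X ≤ D ^ length U
    extension-bound T fuel U le out {[]} _ _ _ = z≤n
    extension-bound T fuel U le out {h₀ ∷ X₀} uX hom agree with any? (_∈F? U)
    ... | no ¬p = ≤-trans (all-equal⇒length≤1 uX λ x∈ y∈ → lookup-ext λ p → agree x∈ y∈ p (λ p∈ → ¬p (p , p∈)))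
                    (m^n>0 D (length U))
    extension-bound T zero [] le out {h₀ ∷ X₀} uX hom agree | yes (_ , ())
    extension-bound T (suc fuel) U le out {X@(h₀ ∷ X₀)} uX hom agree | yes inn
      with boundary T (_∈F? U) inn out
    ... | p , q , p∈ , q∉ , edge = begin
      length X                             ≤⟨ cover-bound (λ x v → Vec.lookup x p ≟ v) X (nbrs (Vec.lookup h₀ q)) (D ^ length U′)
                                                (λ x∈ → _ , at-p x∈ , refl) (λ {v} _ → small v) ⟩
      length (nbrs (Vec.lookup h₀ q)) * D ^ length U′ ≤⟨ *-monoˡ-≤ _ (≤-trans (≤-reflexive (sym (deg≡length-nbrs (Vec.lookup h₀ q)))) (deg≤ _)) ⟩
      D ^ suc (length U′)                  ≤⟨ ^-monoʳ-≤ D shrink ⟩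
      D ^ length U                         ∎
      where
      open ≤-Reasoning
      U′ = filter (λ r → ¬? (r ≟ p)) U
      shrink : length U′ < length U
      shrink = filter-notAll (λ r → ¬? (r ≟ p)) U (lose p∈ (λ ¬e → ¬e refl))
      at-p : ∀ {x} → x ∈ X → Vec.lookup x p ∈ nbrs (Vec.lookup h₀ q)
      at-p {x} x∈ = ∈-nbrs (subst (_~ Vec.lookup x p) (agree x∈ (here refl) q q∉) ([ ~-sym ∘ hom x∈ , hom x∈ ]′ edge))
      small : ∀ v → #[ (λ x → Vec.lookup x p ≟ v) ] X ≤ D ^ length U′
      small v = extension-bound T fuel U′ (≤-pred (≤-trans shrink le))
        (proj₁ out , λ r∈ → proj₂ out (proj₁ (∈-filter⁻ (λ r → ¬? (r ≟ p)) {xs = U} r∈)))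
        (Unique-filter (λ x → Vec.lookup x p ≟ v) uX)
        (λ x∈ → hom (proj₁ (∈-filter⁻ (λ x → Vec.lookup x p ≟ v) {xs = X} x∈)))
        λ x∈ y∈ r r∉ → let x∈X , ex = ∈-filter⁻ (λ x → Vec.lookup x p ≟ v) {xs = X} x∈
                           y∈X , ey = ∈-filter⁻ (λ x → Vec.lookup x p ≟ v) {xs = X} y∈
                       in case r ≟ p of λ { (yes refl) → trans ex (sym ey)
                                          ; (no r≢) → agree x∈X y∈X r (λ r∈ → r∉ (∈-filter⁺ (λ r → ¬? (r ≟ p)) r∈ r≢)) }

    vec≟ : ∀ {N} (x y : Vec V N) → Dec (x ≡ y)
    vec≟ = VecP.≡-dec _≟_

    -- The image of ι occupies e′ + 1 of the e + 1 positions, so e ∸ e′ remain free once the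
    -- restriction is known. This transfers the rarity of packed embeddings from a subtree to the
    -- whole spider.
    restriction-bound : ∀ {e e′} (T : Tree e) (ι : Fin (suc e′) → Fin (suc e)) → (∀ {p q} → ι p ≡ ι q → p ≡ q) →
      (Bad : List (Vec V (suc e′))) →
      #[ (λ h → Any.any? (vec≟ (restrict ι h)) Bad) ] (embeddings T) ≤ length Bad * D ^ (e ∸ e′)
    restriction-bound {e} {e′} T ι ι-inj Bad = cover-bound (λ h b → vec≟ (restrict ι h) b) X Bad (D ^ (e ∸ e′))
      (λ h∈ → let b , b∈ , eq = find (proj₂ (∈-filter⁻ hit? {xs = embeddings T} h∈)) in b , b∈ , eq) (λ {b} _ → small b)
      where
      hit? = λ h → Any.any? (vec≟ (restrict ι h)) Bad
      X = filter hit? (embeddings T)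
      image = map ι (allFin (suc e′))
      U = filter (λ p → ¬? (p ∈F? image)) (allFin (suc e))
      ∈image : ∀ {p} → p ∉ U → p ∈ image
      ∈image {p} p∉ = decidable-stable (p ∈F? image) (λ p∉i → p∉ (∈-filter⁺ (λ p → ¬? (p ∈F? image)) (∈-allFin p) p∉i))
      U-length : length U ≤ e ∸ e′
      U-length = m+n≤o⇒m≤o∸n (length U) (≤-pred (begin
        suc (length U + e′)        ≡⟨ sym (+-suc (length U) e′) ⟩
        length U + suc e′          ≡⟨ cong (length U +_) (sym (trans (length-map ι (allFin (suc e′))) (length-allFin (suc e′)))) ⟩
        length U + length image    ≡⟨ sym (length-++ U) ⟩
        length (U ++ image)        ≤⟨ ⊆⇒length≤ (UniqueP.++⁺ (Unique-filter (λ p → ¬? (p ∈F? image)) (UniqueP.allFin⁺ (suc e))) (UniqueP.map⁺ ι-inj (UniqueP.allFin⁺ (suc e′)))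
                                        (λ { (p∈ , p∈i) → proj₂ (∈-filter⁻ (λ p → ¬? (p ∈F? image)) {xs = allFin (suc e)} p∈) p∈i }))
                                        (λ _ → ∈-allFin _) ⟩
        length (allFin (suc e))    ≡⟨ length-allFin (suc e) ⟩
        suc e                      ∎))
        where open ≤-Reasoning
      small : ∀ b → #[ (λ h → vec≟ (restrict ι h) b) ] X ≤ D ^ (e ∸ e′)
      small b = ≤-trans (extension-bound T (length U) U ≤-refl
          (ι zero , λ p∈ → proj₂ (∈-filter⁻ (λ p → ¬? (p ∈F? image)) {xs = allFin (suc e)} p∈) (∈-map⁺ ι (∈-allFin zero)))
          (Unique-filter (λ h → vec≟ (restrict ι h) b) (Unique-filter hit? (embeddings-unique T)))
          (λ x∈ → embeddings-hom T (proj₁ (∈-filter⁻ hit? {xs = embeddings T} (proj₁ (∈-filter⁻ (λ h → vec≟ (restrict ι h) b) {xs = X} x∈)))))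
          (λ {x} {y} x∈ y∈ p p∉ → let q , _ , e = ∈-map⁻ ι (∈image p∉)
                                      ex = proj₂ (∈-filter⁻ (λ h → vec≟ (restrict ι h) b) {xs = X} x∈)
                                      ey = proj₂ (∈-filter⁻ (λ h → vec≟ (restrict ι h) b) {xs = X} y∈)
                                  in subst (λ p → Vec.lookup x p ≡ Vec.lookup y p) (sym e)
                                       (trans (sym (lookup∘tabulate (Vec.lookup x ∘ ι) q))
                                         (trans (cong (λ z → Vec.lookup z q) (trans ex (sym ey))) (lookup∘tabulate (Vec.lookup y ∘ ι) q)))))
        (^-monoʳ-≤ D U-length)

-- Sunflowers

length-cartesianProduct : ∀ {A B : Set} (xs : List A) (ys : List B) → length (cartesianProduct xs ys) ≡ length xs * length ys
length-cartesianProduct [] ys = refl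
length-cartesianProduct (x ∷ xs) ys =
  trans (length-++ (map (x ,_) ys)) (cong₂ _+_ (length-map (x ,_) ys) (length-cartesianProduct xs ys))

-- The factor m * (suc u * suc u) bounds the number of triples (y, p, q) in `sunflower`: a member y
-- of the hitting set and two positions.
sunBound : ℕ → ℕ → ℕ
sunBound m zero = 1
sunBound m (suc u) = suc (m * (suc u * suc u) * sunBound m u)

1≤sunBound : ∀ m u → 1 ≤ sunBound m u
1≤sunBound m zero = ≤-refl
1≤sunBound m (suc u) = s≤s z≤n

module Sunflowers {n : ℕ} where

  private V = Fin n

  -- Different positions are compared as well: a vertex of one petal may not reappear elsewhere in
  -- another.
  Apart : ∀ {N} → List (Fin N) → Vec V N → Vec V N → Set
  Apart U x y = ∀ p q → p ∈ U → q ∈ U → Vec.lookup x p ≢ Vec.lookup y q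

  Petal : ∀ {N} → List (Fin N) → Vec V N → Vec V N → Set
  Petal U x y = Agree U x y × Apart U x y

  apart? : ∀ {N} (U : List (Fin N)) x y → Dec (Apart U x y)
  apart? U x y = all? λ p → all? λ q → (p ∈F? U) →-dec ((q ∈F? U) →-dec ¬? (Vec.lookup x p ≟ Vec.lookup y q))

  petal? : ∀ {N} (U : List (Fin N)) x y → Dec (Petal U x y)
  petal? U x y = (all? λ p → ¬? (p ∈F? U) →-dec (Vec.lookup x p ≟ Vec.lookup y p)) ×-dec apart? U x y

  ¬apart : ∀ {N} (U : List (Fin N)) x y → ¬ Apart U x y → ∃₂ λ p q → p ∈ U × q ∈ U × Vec.lookup x p ≡ Vec.lookup y q
  ¬apart U x y ¬a with any? (λ p → any? λ q → (p ∈F? U) ×-dec ((q ∈F? U) ×-dec (Vec.lookup x p ≟ Vec.lookup y q)))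
  ... | yes (p , q , p∈ , q∈ , e) = p , q , p∈ , q∈ , e
  ... | no ¬e = ⊥-elim (¬a λ p q p∈ q∈ e → ¬e (p , q , p∈ , q∈ , e))

  -- The Erdős-Rado argument with U as the complement of the kernel. If no m members are apart on U,
  -- a hitting set y₁, y₂, ... of fewer than or equal to m members exists, and by pigeonhole many x
  -- agree with one vertex of one y at one position q. Then q joins the kernel and U shrinks. U′
  -- stays nonempty because distinct members differ somewhere.
  sunflower : ∀ {N} m u (U : List (Fin N)) → length U ≤ u → ∀ {X} → Unique X →
    (∀ {x y} → x ∈ X → y ∈ X → Agree U x y) → sunBound m u < length X →
    ∃ λ U′ → (∀ {p} → p ∈ U′ → p ∈ U) × (∃ λ p → p ∈ U′) × Clique (Petal U′) m X
  sunflower m u U le {X} uX agree big with any? (_∈F? U)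
  ... | no ¬p = ⊥-elim (<⇒≱ big (≤-trans (all-equal⇒length≤1 uX λ x∈ y∈ → lookup-ext λ p → agree x∈ y∈ p λ p∈ → ¬p (p , p∈)) (1≤sunBound m u)))
  sunflower m zero [] le uX agree big | yes (_ , ())
  sunflower m (suc u) U le {X} uX agree big | yes (p₀ , p₀∈)
    with greedy-clique (apart? U) (λ x a → a p₀ p₀ p₀∈ p₀∈ refl) m X
  ... | inj₁ (b , len , sub , ap) = U , id , (p₀ , p₀∈) , b , len , sub , pairs sub ap
    where
    pairs : ∀ {b} → (∀ {x} → x ∈ b → x ∈ X) → AllPairs (Apart U) b → AllPairs (Petal U) b
    pairs s [] = []
    pairs s (a ∷ as) = All.tabulate (λ y∈ → agree (s (here refl)) (s (there y∈)) , All.lookup a y∈) ∷ pairs (s ∘ there) as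
  ... | inj₂ (b , len , hit) with pigeonhole-list hits? X triples (sunBound m u) hit′ big′
    where
    triples = cartesianProduct b (cartesianProduct U U)
    hits? : ∀ (x : Vec V _) (t : Vec V _ × _ × _) → Dec (Vec.lookup x (proj₂ (proj₂ t)) ≡ Vec.lookup (proj₁ t) (proj₁ (proj₂ t)))
    hits? x t = Vec.lookup x (proj₂ (proj₂ t)) ≟ Vec.lookup (proj₁ t) (proj₁ (proj₂ t))
    hit′ : ∀ {x} → x ∈ X → ∃ λ t → t ∈ triples × Vec.lookup x (proj₂ (proj₂ t)) ≡ Vec.lookup (proj₁ t) (proj₁ (proj₂ t))
    hit′ {x} x∈ = let y , y∈ , ¬a = hit x∈
                      p , q , p∈ , q∈ , e = ¬apart U y x ¬a
                  in (y , p , q) , ∈-cartesianProduct⁺ y∈ (∈-cartesianProduct⁺ p∈ q∈) , sym e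
    big′ : length triples * sunBound m u < length X
    big′ = ≤-<-trans (*-monoˡ-≤ (sunBound m u) (begin
      length triples                  ≡⟨ length-cartesianProduct b _ ⟩
      length b * length (cartesianProduct U U) ≡⟨ cong (length b *_) (length-cartesianProduct U U) ⟩
      length b * (length U * length U) ≤⟨ *-mono-≤ len (*-mono-≤ le le) ⟩
      m * (suc u * suc u)             ∎)) (<-trans (n<1+n _) big)
      where open ≤-Reasoning
  ...   | (y , p , q) , t∈ , big″ =
    let U″ , sub″ , ne , b , l , s , ap = sunflower m u U′ (≤-pred (≤-trans shrink le)) (Unique-filter same? uX) agree′ big″
    in U″ , (λ r∈ → proj₁ (∈-filter⁻ (λ r → ¬? (r ≟ q)) {xs = U} (sub″ r∈))) , ne , b , l
     , (λ x∈ → proj₁ (∈-filter⁻ same? {xs = X} (s x∈))) , ap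
    where
    same? = λ (x : Vec V _) → Vec.lookup x q ≟ Vec.lookup y p
    U′ = filter (λ r → ¬? (r ≟ q)) U
    q∈ : q ∈ U
    q∈ = proj₂ (∈-cartesianProduct⁻ U U (proj₂ (∈-cartesianProduct⁻ b (cartesianProduct U U) t∈)))
    shrink : length U′ < length U
    shrink = filter-notAll (λ r → ¬? (r ≟ q)) U (lose q∈ (λ ¬e → ¬e refl))
    agree′ : ∀ {x z} → x ∈ filter same? X → z ∈ filter same? X → Agree U′ x z
    agree′ x∈ z∈ r r∉ =
      let x∈X , ex = ∈-filter⁻ same? {xs = X} x∈
          z∈X , ez = ∈-filter⁻ same? {xs = X} z∈
      in case r ≟ q of λ { (yes refl) → trans ex (sym ez)
                         ; (no r≢) → agree x∈X z∈X r (λ r∈ → r∉ (∈-filter⁺ (λ r → ¬? (r ≟ q)) r∈ r≢)) }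

  -- Applied to the ends of the legs; this is the source of the power n^s in the hypothesis on the
  -- minimum degree.
  pin : ∀ {N} (ps : List (Fin N)) c {X : List (Vec V N)} → Unique X → n ^ length ps * c < length X →
    ∃ λ X′ → (∀ {x} → x ∈ X′ → x ∈ X) × Unique X′ × c < length X′ ×
      (∀ {x y p} → x ∈ X′ → y ∈ X′ → p ∈ ps → Vec.lookup x p ≡ Vec.lookup y p)
  pin [] c {X} uX big = X , id , uX , subst (_< length X) (*-identityˡ c) big , λ _ _ ()
  pin (p ∷ ps) c {X} uX big
    with pigeonhole-list (λ (x : Vec V _) v → Vec.lookup x p ≟ v) X (allFin n) (n ^ length ps * c) (λ _ → _ , ∈-allFin _ , refl)
           (subst (_< length X) (trans (*-assoc n _ c) (cong (_* (n ^ length ps * c)) (sym (length-allFin n)))) big)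
  ... | v , _ , big′ with pin ps c (Unique-filter (λ x → Vec.lookup x p ≟ v) uX) big′
  ...   | X′ , sub , u , big″ , same = X′ , proj₁ ∘ back , u , big″
        , λ { x∈ y∈ (here refl) → trans (proj₂ (back x∈)) (sym (proj₂ (back y∈)))
            ; x∈ y∈ (there p∈) → same x∈ y∈ p∈ }
    where
    back : ∀ {x} → x ∈ X′ → x ∈ X × Vec.lookup x p ≡ v
    back x∈ = ∈-filter⁻ (λ x → Vec.lookup x p ≟ v) {xs = X} (sub x∈)

-- Spiders

up : ∀ {e} ℓ → Fin (suc e) → Fin (suc (ℓ + e))
up zero p = p
up (suc ℓ) p = suc (up ℓ p)

tip : ∀ {e} ℓ → Fin (suc e) → Fin (suc (ℓ + e))
tip zero q = q
tip (suc ℓ) q = zero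

attach : ∀ {e} → Tree e → Fin (suc e) → ∀ ℓ → Tree (ℓ + e)
attach T q zero = T
attach T q (suc ℓ) = graft (tip ℓ q) (attach T q ℓ)

-- the vertex m steps before the end of a path of length ℓ attached at q
along : ∀ {e} → Fin (suc e) → ∀ ℓ → ℕ → Fin (suc (ℓ + e))
along q zero m = q
along q (suc ℓ) zero = zero
along q (suc ℓ) (suc m) = suc (along q ℓ m)

along-tip : ∀ {e} (q : Fin (suc e)) ℓ → along q ℓ 0 ≡ tip ℓ q
along-tip q zero = refl
along-tip q (suc ℓ) = refl

along-full : ∀ {e} (q : Fin (suc e)) ℓ → along q ℓ ℓ ≡ up ℓ q
along-full q zero = refl
along-full q (suc ℓ) = cong suc (along-full q ℓ)

up-injective : ∀ {e} ℓ {p q : Fin (suc e)} → up ℓ p ≡ up ℓ q → p ≡ q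
up-injective zero eq = eq
up-injective (suc ℓ) eq = up-injective ℓ (FinP.suc-injective eq)

along-injective : ∀ {e} (q : Fin (suc e)) ℓ {m m′} → m ≤ ℓ → m′ ≤ ℓ → along q ℓ m ≡ along q ℓ m′ → m ≡ m′
along-injective q zero z≤n z≤n _ = refl
along-injective q (suc ℓ) z≤n z≤n _ = refl
along-injective q (suc ℓ) (s≤s a) (s≤s b) eq = cong suc (along-injective q ℓ a b (FinP.suc-injective eq))

along≡up : ∀ {e} (q : Fin (suc e)) ℓ {m p} → m ≤ ℓ → along q ℓ m ≡ up ℓ p → m ≡ ℓ × q ≡ p
along≡up q zero z≤n eq = refl , eq
along≡up q (suc ℓ) (s≤s le) eq = let a , b = along≡up q ℓ le (FinP.suc-injective eq) in cong suc a , b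

attach-edge : ∀ {e} (T : Tree e) q ℓ {m} → m < ℓ → Edge (attach T q ℓ) (along q ℓ m) (along q ℓ (suc m))
attach-edge T q (suc ℓ) {zero} _ = along-tip q ℓ
attach-edge T q (suc ℓ) {suc m} (s≤s lt) = attach-edge T q ℓ lt

up-edge : ∀ {e} (T : Tree e) r ℓ {p q} → Edge T p q → Edge (attach T r ℓ) (up ℓ p) (up ℓ q)
up-edge T r zero ed = ed
up-edge T r (suc ℓ) ed = up-edge T r ℓ ed

attach-cover : ∀ {e} (q : Fin (suc e)) ℓ (p : Fin (suc (ℓ + e))) →
  (∃ λ p′ → p ≡ up ℓ p′) ⊎ (∃ λ m → m < ℓ × p ≡ along q ℓ m)
attach-cover q zero p = inj₁ (p , refl)
attach-cover q (suc ℓ) zero = inj₂ (0 , s≤s z≤n , refl)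
attach-cover q (suc ℓ) (suc p) with attach-cover q ℓ p
... | inj₁ (p′ , e) = inj₁ (p′ , cong suc e)
... | inj₂ (m , lt , e) = inj₂ (suc m , s≤s lt , cong suc e)

attach-edge-cover : ∀ {e} (T : Tree e) q ℓ a b → Edge (attach T q ℓ) a b →
  (∃₂ λ a′ b′ → Edge T a′ b′ × a ≡ up ℓ a′ × b ≡ up ℓ b′) ⊎
  (∃ λ m → m < ℓ × a ≡ along q ℓ m × b ≡ along q ℓ (suc m))
attach-edge-cover T q zero a b ed = inj₁ (a , b , ed , refl , refl)
attach-edge-cover T q (suc ℓ) zero (suc b) ed = inj₂ (0 , s≤s z≤n , refl , cong suc (trans ed (sym (along-tip q ℓ))))
attach-edge-cover T q (suc ℓ) (suc a) (suc b) ed with attach-edge-cover T q ℓ a b ed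
... | inj₁ (a′ , b′ , ed′ , e₁ , e₂) = inj₁ (a′ , b′ , ed′ , cong suc e₁ , cong suc e₂)
... | inj₂ (m , lt , e₁ , e₂) = inj₂ (suc m , s≤s lt , cong suc e₁ , cong suc e₂)

size : ∀ {s} → Vec ℕ s → ℕ
size = Vec.sum

root : ∀ {s} (js : Vec ℕ s) → Fin (suc (size js))
root [] = zero
root (ℓ ∷ js) = up ℓ (root js)

spider : ∀ {s} (js : Vec ℕ s) → Tree (size js)
spider [] = single
spider (ℓ ∷ js) = attach (spider js) (root js) ℓ

-- the vertex at distance r from the root on leg i (for r at most the length of the leg)
pos : ∀ {s} (js : Vec ℕ s) → Fin s → ℕ → Fin (suc (size js))
pos (ℓ ∷ js) zero r = along (root js) ℓ (ℓ ∸ r)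
pos (ℓ ∷ js) (suc i) r = up ℓ (pos js i r)

pos-root : ∀ {s} (js : Vec ℕ s) i → pos js i 0 ≡ root js
pos-root (ℓ ∷ js) zero = along-full (root js) ℓ
pos-root (ℓ ∷ js) (suc i) = cong (up ℓ) (pos-root js i)

∸-step : ∀ {r ℓ} → r < ℓ → ℓ ∸ r ≡ suc (ℓ ∸ suc r)
∸-step {r} {ℓ} lt = +-∸-assoc 1 {ℓ} {suc r} lt

pos-edge : ∀ {s} (js : Vec ℕ s) i {r} → r < Vec.lookup js i → Edge (spider js) (pos js i (suc r)) (pos js i r)
pos-edge (ℓ ∷ js) zero {r} lt =
  subst (λ m → Edge (attach (spider js) (root js) ℓ) (along (root js) ℓ (ℓ ∸ suc r)) (along (root js) ℓ m)) (sym (∸-step lt))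
    (attach-edge (spider js) (root js) ℓ (≤-trans (≤-reflexive (sym (∸-step lt))) (m∸n≤m ℓ r)))
pos-edge (ℓ ∷ js) (suc i) lt = up-edge (spider js) (root js) ℓ (pos-edge js i lt)

pos≡root : ∀ {s} (js : Vec ℕ s) i {r} → r ≤ Vec.lookup js i → pos js i r ≡ root js → r ≡ 0
pos≡root (ℓ ∷ js) zero {r} le eq = ∸-cancelˡ-≡ le z≤n (proj₁ (along≡up (root js) ℓ (m∸n≤m ℓ r) eq))
pos≡root (ℓ ∷ js) (suc i) le eq = pos≡root js i le (up-injective ℓ eq)

-- The coordinates (leg, distance) determine a vertex, except that all legs meet at distance zero.
SamePlace : ∀ {s} → Fin s → ℕ → Fin s → ℕ → Set
SamePlace i r i′ r′ = (r ≡ 0 × r′ ≡ 0) ⊎ (i ≡ i′ × r ≡ r′)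

pos-injective : ∀ {s} (js : Vec ℕ s) i i′ {r r′} → r ≤ Vec.lookup js i → r′ ≤ Vec.lookup js i′ →
  pos js i r ≡ pos js i′ r′ → SamePlace i r i′ r′
pos-injective (ℓ ∷ js) zero zero {r} {r′} le le′ eq =
  inj₂ (refl , ∸-cancelˡ-≡ le le′ (along-injective (root js) ℓ (m∸n≤m ℓ r) (m∸n≤m ℓ r′) eq))
pos-injective (ℓ ∷ js) zero (suc i′) {r} le le′ eq =
  let e , f = along≡up (root js) ℓ (m∸n≤m ℓ r) eq in inj₁ (∸-cancelˡ-≡ le z≤n e , pos≡root js i′ le′ (sym f))
pos-injective (ℓ ∷ js) (suc i) zero {r′ = r′} le le′ eq =
  let e , f = along≡up (root js) ℓ (m∸n≤m ℓ r′) (sym eq) in inj₁ (pos≡root js i le (sym f) , ∸-cancelˡ-≡ le′ z≤n e)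
pos-injective (ℓ ∷ js) (suc i) (suc i′) le le′ eq with pos-injective js i i′ le le′ (up-injective ℓ eq)
... | inj₁ z = inj₁ z
... | inj₂ (refl , e) = inj₂ (refl , e)

pos-cover : ∀ {s} (js : Vec ℕ s) p → p ≡ root js ⊎ (∃₂ λ i r → r < Vec.lookup js i × p ≡ pos js i (suc r))
pos-cover [] zero = inj₁ refl
pos-cover (ℓ ∷ js) p with attach-cover (root js) ℓ p
... | inj₂ (m , lt , e) = inj₂ (zero , ℓ ∸ suc m , ≤-trans (≤-reflexive (sym (∸-step lt))) (m∸n≤m ℓ m)
        , trans e (cong (along (root js) ℓ) (trans (sym (m∸[m∸n]≡n (<⇒≤ lt))) (cong (ℓ ∸_) (∸-step lt)))))
... | inj₁ (p′ , e) with pos-cover js p′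
...   | inj₁ e′ = inj₁ (trans e (cong (up ℓ) e′))
...   | inj₂ (i , r , lt , e′) = inj₂ (suc i , r , lt , trans e (cong (up ℓ) e′))

edge-cover : ∀ {s} (js : Vec ℕ s) a b → Edge (spider js) a b →
  ∃₂ λ i r → r < Vec.lookup js i × a ≡ pos js i (suc r) × b ≡ pos js i r
edge-cover (ℓ ∷ js) a b ed with attach-edge-cover (spider js) (root js) ℓ a b ed
... | inj₂ (m , lt , e₁ , e₂) = zero , ℓ ∸ suc m , ≤-trans (≤-reflexive (sym (∸-step lt))) (m∸n≤m ℓ m)
        , trans e₁ (cong (along (root js) ℓ) (trans (sym (m∸[m∸n]≡n (<⇒≤ lt))) (cong (ℓ ∸_) (∸-step lt))))
        , trans e₂ (cong (along (root js) ℓ) (sym (m∸[m∸n]≡n lt)))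
... | inj₁ (a′ , b′ , ed′ , e₁ , e₂) with edge-cover js a′ b′ ed′
...   | i , r , lt , e₁′ , e₂′ = suc i , r , lt , trans e₁ (cong (up ℓ) e₁′) , trans e₂ (cong (up ℓ) e₂′)

decode : ∀ {s} (js : Vec ℕ (suc s)) p → ∃₂ λ i r → r ≤ Vec.lookup js i × p ≡ pos js i r
decode js p with pos-cover js p
... | inj₁ e = zero , 0 , z≤n , trans e (sym (pos-root js zero))
... | inj₂ (i , r , lt , e) = i , suc r , lt , e

-- Defines a map out of a spider by coordinates. `decode` makes an arbitrary choice of the leg for
-- the root, and `same-root` makes the result independent of it.
module Place {s N : ℕ} (js : Vec ℕ (suc s)) (f : Fin (suc s) → ℕ → Fin N)
  (same-root : ∀ i i′ → f i 0 ≡ f i′ 0) where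

  place : Fin (suc (size js)) → Fin N
  place p = let i , r , _ = decode js p in f i r

  place-pos : ∀ i {r} → r ≤ Vec.lookup js i → place (pos js i r) ≡ f i r
  place-pos i {r} le with decode js (pos js i r)
  ... | i′ , r′ , le′ , e with pos-injective js i i′ le le′ e
  ...   | inj₁ (refl , refl) = same-root i′ i
  ...   | inj₂ (refl , refl) = refl

  place-injective : (∀ {i i′ r r′} → r ≤ Vec.lookup js i → r′ ≤ Vec.lookup js i′ → f i r ≡ f i′ r′ → SamePlace i r i′ r′) →
    ∀ {p q} → place p ≡ place q → p ≡ q
  place-injective inj {p} {q} e with decode js p | decode js q
  ... | i , r , le , ep | i′ , r′ , le′ , eq with inj le le′ e
  ...   | inj₁ (refl , refl) = trans ep (trans (trans (pos-root js i) (sym (pos-root js i′))) (sym eq))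
  ...   | inj₂ (refl , refl) = trans ep (sym eq)

module Inner {s : ℕ} (js : Vec ℕ (suc s)) (pos-legs : ∀ i → 1 ≤ Vec.lookup js i) where

  end : Fin (suc s) → Fin (suc (size js))
  end i = pos js i (Vec.lookup js i)

  isEnd? : ∀ p → Dec (∃ λ i → p ≡ end i)
  isEnd? p = any? λ i → p ≟ end i

  inner : List (Fin (suc (size js)))
  inner = filter (¬? ∘ isEnd?) (allFin _)

  inner-length : length inner ≤ suc (size js)
  inner-length = ≤-trans (length-filter (¬? ∘ isEnd?) (allFin _)) (≤-reflexive (length-allFin _))

  end∉inner : ∀ i → end i ∉ inner
  end∉inner i p∈ = proj₂ (∈-filter⁻ (¬? ∘ isEnd?) {xs = allFin _} p∈) (i , refl)

  pos∈inner : ∀ i {r} → r < Vec.lookup js i → pos js i r ∈ inner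
  pos∈inner i {r} lt = ∈-filter⁺ (¬? ∘ isEnd?) (∈-allFin _) λ { (i′ , e) →
    case pos-injective js i i′ (<⇒≤ lt) ≤-refl e of λ
      { (inj₁ (_ , z)) → <⇒≢ (pos-legs i′) (sym z)
      ; (inj₂ (refl , refl)) → <-irrefl refl lt } }

  inner-pos : ∀ {p} → p ∈ inner → ∃₂ λ i r → r < Vec.lookup js i × p ≡ pos js i r
  inner-pos {p} p∈ with decode js p
  ... | i , r , le , e = i , r , ≤∧≢⇒< le (λ { refl → proj₂ (∈-filter⁻ (¬? ∘ isEnd?) {xs = allFin _} p∈) (i , e) }) , e

  ∉inner-end : ∀ {p} → p ∉ inner → ∃ λ i → p ≡ end i
  ∉inner-end {p} p∉ = decidable-stable (isEnd? p) λ ¬e → p∉ (∈-filter⁺ (¬? ∘ isEnd?) (∈-allFin _) ¬e)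

-- Paths and subdivisions

lookup-unique : ∀ {A : Set} {xs : List A} → Unique xs → ∀ i j → lookup xs i ≡ lookup xs j → i ≡ j
lookup-unique (_ ∷ _) zero zero _ = refl
lookup-unique {xs = x ∷ xs} (x∉ ∷ u) zero (suc j) e = ⊥-elim (All.lookup x∉ (∈-lookup j) e)
lookup-unique {xs = x ∷ xs} (x∉ ∷ u) (suc i) zero e = ⊥-elim (All.lookup x∉ (∈-lookup i) (sym e))
lookup-unique (x∉ ∷ u) (suc i) (suc j) e = cong suc (lookup-unique u i j e)

length-concat-map : ∀ {A B : Set} (f : A → List B) c xs → (∀ x → length (f x) ≤ c) → length (concat (map f xs)) ≤ length xs * c
length-concat-map f c [] le = z≤n
length-concat-map f c (x ∷ xs) le = ≤-trans (≤-reflexive (length-++ (f x))) (+-mono-≤ (le x) (length-concat-map f c xs le))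

length-concat-family : ∀ {B : Set} {s} (f : Fin s → List B) c → (∀ i → length (f i) ≤ c) → length (concat (map f (allFin s))) ≤ s * c
length-concat-family {s = s} f c le = ≤-trans (length-concat-map f c (allFin s) le) (≤-reflexive (cong (_* c) (length-allFin s)))

∈-family : ∀ {B : Set} {s} (f : Fin s → List B) i {v} → v ∈ f i → v ∈ concat (map f (allFin s))
∈-family f i v∈ = ∈-concat⁺′ v∈ (∈-map⁺ f (∈-allFin i))

-- Greedy choice: each chosen list joins the forbidden one, and `bound` leaves room for s lists of
-- length c.
choose-disjoint : ∀ {B : Set} s {P : Fin s → List B → Set} c bound →
  (∀ i F → length F ≤ bound → ∃ λ xs → P i xs × length xs ≤ c × (∀ {v} → v ∈ xs → v ∉ F)) →
  ∀ F → length F + s * c ≤ bound →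
  ∃ λ (xs : Fin s → List B) → (∀ i → P i (xs i)) × (∀ i {v} → v ∈ xs i → v ∉ F) ×
    (∀ {i i′ v} → i ≢ i′ → v ∈ xs i → v ∉ xs i′)
choose-disjoint zero c bound ex F le = (λ ()) , (λ ()) , (λ ()) , λ { {i = ()} }
choose-disjoint {B} (suc s) {P} c bound ex F le
  with ex zero F (≤-trans (m≤m+n (length F) _) le)
... | x , px , lx , outx with choose-disjoint s {P ∘ suc} c bound (ex ∘ suc) (x ++ F) le′
  where
  le′ : length (x ++ F) + s * c ≤ bound
  le′ = begin
    length (x ++ F) + s * c       ≡⟨ cong (_+ s * c) (length-++ x) ⟩
    length x + length F + s * c   ≤⟨ +-monoˡ-≤ (s * c) (+-monoˡ-≤ (length F) lx) ⟩
    c + length F + s * c          ≡⟨ cong (_+ s * c) (+-comm c (length F)) ⟩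
    length F + c + s * c          ≡⟨ +-assoc (length F) c (s * c) ⟩
    length F + (c + s * c)        ≤⟨ le ⟩
    bound                         ∎
    where open ≤-Reasoning
... | xs , pxs , out , dis = xs′ , pxs′ , out′ , dis′
  where
  xs′ : Fin (suc s) → List B
  xs′ zero = x
  xs′ (suc i) = xs i
  pxs′ : ∀ i → P i (xs′ i)
  pxs′ zero = px
  pxs′ (suc i) = pxs i
  out′ : ∀ i {v} → v ∈ xs′ i → v ∉ F
  out′ zero v∈ = outx v∈
  out′ (suc i) v∈ v∈F = out i v∈ (∈-++⁺ʳ x v∈F)
  dis′ : ∀ {i i′ v} → i ≢ i′ → v ∈ xs′ i → v ∉ xs′ i′
  dis′ {zero} {zero} ne _ _ = ne refl
  dis′ {zero} {suc i′} ne v∈ v∈′ = out i′ v∈′ (∈-++⁺ˡ v∈)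
  dis′ {suc i} {zero} ne v∈ v∈′ = out i v∈ (∈-++⁺ˡ v∈′)
  dis′ {suc i} {suc i′} ne v∈ v∈′ = dis (ne ∘ cong suc) v∈ v∈′

module Paths {n : ℕ} (G : Graph n) where
  open InGraph G

  -- Path a xs b lists the vertices after a, including the end; IPath a xs b only the internal ones.
  data Path : V → List V → V → Set where
    []  : ∀ {a} → Path a [] a
    _∷_ : ∀ {a c xs b} → a ~ c → Path c xs b → Path a (c ∷ xs) b

  data IPath : V → List V → V → Set where
    [_] : ∀ {a b} → a ~ b → IPath a [] b
    _∷_ : ∀ {a c xs b} → a ~ c → IPath c xs b → IPath a (c ∷ xs) b

  _⊕_ : ∀ {a xs c ys b} → Path a xs c → IPath c ys b → IPath a (xs ++ ys) b
  [] ⊕ q = q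
  (e ∷ p) ⊕ q = e ∷ (p ⊕ q)

  _⊙_ : ∀ {a xs c ys b} → IPath a xs c → IPath c ys b → IPath a (xs ++ c ∷ ys) b
  [ e ] ⊙ q = e ∷ q
  (e ∷ p) ⊙ q = e ∷ (p ⊙ q)

  downList : (ℕ → V) → ℕ → List V
  downList f zero = []
  downList f (suc r) = f (suc r) ∷ downList f r

  upList : (ℕ → V) → ℕ → List V
  upList f zero = []
  upList f (suc r) = f 1 ∷ upList (f ∘ suc) r

  down-path : ∀ f r → (∀ {r′} → r′ ≤ r → f r′ ~ f (suc r′)) → IPath (f (suc r)) (downList f r) (f 0)
  down-path f zero adj = [ ~-sym (adj z≤n) ]
  down-path f (suc r) adj = ~-sym (adj ≤-refl) ∷ down-path f r (adj ∘ m≤n⇒m≤1+n)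

  up-path : ∀ f r → (∀ {r′} → r′ ≤ r → f r′ ~ f (suc r′)) → IPath (f 0) (upList f r) (f (suc r))
  up-path f zero adj = [ adj z≤n ]
  up-path f (suc r) adj = adj z≤n ∷ up-path (f ∘ suc) r (adj ∘ s≤s)

  length-downList : ∀ f r → length (downList f r) ≡ r
  length-downList f zero = refl
  length-downList f (suc r) = cong suc (length-downList f r)

  length-upList : ∀ f r → length (upList f r) ≡ r
  length-upList f zero = refl
  length-upList f (suc r) = cong suc (length-upList (f ∘ suc) r)

  ∈-downList : ∀ f r {v} → v ∈ downList f r → ∃ λ r′ → r′ < r × v ≡ f (suc r′)
  ∈-downList f (suc r) (here e) = r , ≤-refl , e
  ∈-downList f (suc r) (there v∈) = let r′ , lt , e = ∈-downList f r v∈ in r′ , m≤n⇒m≤1+n lt , e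

  ∈-upList : ∀ f r {v} → v ∈ upList f r → ∃ λ r′ → r′ < r × v ≡ f (suc r′)
  ∈-upList f (suc r) (here e) = 0 , s≤s z≤n , e
  ∈-upList f (suc r) (there v∈) = let r′ , lt , e = ∈-upList (f ∘ suc) r v∈ in suc r′ , s≤s lt , e

  downList-unique : ∀ f r → (∀ {a b} → a ≤ r → b ≤ r → f a ≡ f b → a ≡ b) → Unique (downList f r)
  downList-unique f zero inj = []
  downList-unique f (suc r) inj =
    All.tabulate (λ v∈ e → let r′ , lt , e′ = ∈-downList f r v∈ in <⇒≢ (s≤s lt) (sym (inj ≤-refl (m≤n⇒m≤1+n lt) (trans e e′))))
    ∷ downList-unique f r λ a b → inj (m≤n⇒m≤1+n a) (m≤n⇒m≤1+n b)

  upList-unique : ∀ f r → (∀ {a b} → a ≤ r → b ≤ r → f a ≡ f b → a ≡ b) → Unique (upList f r)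
  upList-unique f zero inj = []
  upList-unique f (suc r) inj =
    All.tabulate (λ v∈ e → let r′ , lt , e′ = ∈-upList (f ∘ suc) r v∈ in case inj (s≤s z≤n) (s≤s lt) (trans e e′) of λ ())
    ∷ upList-unique (f ∘ suc) r λ a b e → cong pred (inj (s≤s a) (s≤s b) e)

  record Spider {s : ℕ} (ys : Fin s → V) (k : ℕ) : Set where
    field
      hd    : V
      mid   : Fin s → List V
      path  : ∀ i → IPath (ys i) (mid i) hd
      len   : ∀ i → suc (length (mid i)) ≡ k
      uniq  : ∀ i → Unique (mid i)
      dis   : ∀ {i i′ v} → i ≢ i′ → v ∈ mid i → v ∉ mid i′
      hd∉   : ∀ i → hd ∉ mid i

    verts : List V
    verts = hd ∷ concat (map mid (allFin s))

    length-verts : length verts ≤ suc (s * k)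
    length-verts = s≤s (length-concat-family mid k λ i → ≤-trans (n≤1+n _) (≤-reflexive (len i)))

  -- `Spider` does not ask that its vertices differ from the prescribed ends ys; this is obtained by
  -- putting ys into F, as is disjointness from earlier spiders.
  Robust : {s : ℕ} → (Fin s → V) → ℕ → ℕ → Set
  Robust ys k bound = ∀ F → length F ≤ bound → ∃ λ (S : Spider ys k) → ∀ {v} → v ∈ Spider.verts S → v ∉ F

  -- Past the end of the walk the value stays b, which matches `pathVertex`, where all indices from
  -- k on give the right branch vertex.
  nth : V → List V → V → ℕ → V
  nth a xs b zero = a
  nth a [] b (suc r) = b
  nth a (x ∷ xs) b (suc r) = nth x xs b r

  nth-adj : ∀ {a xs b} → IPath a xs b → ∀ r → r ≤ length xs → nth a xs b r ~ nth a xs b (suc r)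
  nth-adj [ e ] zero _ = e
  nth-adj (e ∷ p) zero _ = e
  nth-adj (e ∷ p) (suc r) (s≤s le) = nth-adj p r le

  nth-lookup : ∀ a xs b (r : Fin (length xs)) → nth a xs b (suc (toℕ r)) ≡ lookup xs r
  nth-lookup a (x ∷ xs) b zero = refl
  nth-lookup a (x ∷ xs) b (suc r) = nth-lookup x xs b r

  nth-end : ∀ a xs b r → length xs ≤ r → nth a xs b (suc r) ≡ b
  nth-end a [] b r _ = refl
  nth-end a (x ∷ xs) b (suc r) (s≤s le) = nth-end x xs b r le

  -- Greedy choice of t disjoint spiders on the same ends. The bound counts the s ends and t spiders
  -- with at most suc (s * k) further vertices each.
  assemble : ∀ {s t k} (ys : Fin s → V) → (∀ {i i′} → ys i ≡ ys i′ → i ≡ i′) →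
    Robust ys k (s + t * suc (s * k)) → ContainsSubdivKst G s t k
  assemble {s} {t} {k} ys ys-inj rob = φ , φ-inj , φ-adj
    where
    F₀ = map ys (allFin s)
    chosen = choose-disjoint t {λ _ xs → Σ (Spider ys k) λ S → xs ≡ Spider.verts S} (suc (s * k)) (s + t * suc (s * k))
      (λ _ F le → let S , out = rob F le in Spider.verts S , (S , refl) , Spider.length-verts S , out)
      F₀ (≤-reflexive (cong (_+ t * suc (s * k)) (trans (length-map ys (allFin s)) (length-allFin s))))
    S : Fin t → Spider ys k
    S j = proj₁ (proj₁ (proj₂ chosen) j)
    module S j = Spider (S j)
    outside : ∀ j {v} → v ∈ S.verts j → ∀ i → v ≢ ys i
    outside j v∈ i e = proj₁ (proj₂ (proj₂ chosen)) j (subst (_ ∈_) (sym (proj₂ (proj₁ (proj₂ chosen) j))) v∈)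
      (subst (_∈ F₀) (sym e) (∈-map⁺ ys (∈-allFin i)))
    apart : ∀ {j j′ v} → j ≢ j′ → v ∈ S.verts j → v ∉ S.verts j′
    apart {j} {j′} {v} ne v∈ v∈′ = proj₂ (proj₂ (proj₂ chosen)) ne
      (subst (v ∈_) (sym (proj₂ (proj₁ (proj₂ chosen) j))) v∈) (subst (v ∈_) (sym (proj₂ (proj₁ (proj₂ chosen) j′))) v∈′)
    k-1 : ∀ i j → k ∸ 1 ≡ length (S.mid j i)
    k-1 i j = cong pred (sym (S.len j i))
    φ : SubVertex s t k → V
    φ (left i) = ys i
    φ (right j) = S.hd j
    φ (internal i j r) = lookup (S.mid j i) (cast (k-1 i j) r)
    hd∈ : ∀ j → S.hd j ∈ S.verts j
    hd∈ j = here refl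
    mid∈ : ∀ i j r → lookup (S.mid j i) (cast (k-1 i j) r) ∈ S.verts j
    mid∈ i j r = there (∈-family (S.mid j) i (∈-lookup (cast (k-1 i j) r)))
    cast-inj : ∀ {a b} (e : a ≡ b) {x y : Fin a} → cast e x ≡ cast e y → x ≡ y
    cast-inj e {x} {y} q = toℕ-injective (trans (sym (toℕ-cast e x)) (trans (cong toℕ q) (toℕ-cast e y)))
    φ-inj : ∀ {x y} → φ x ≡ φ y → x ≡ y
    φ-inj {left i} {left i′} e = cong left (ys-inj e)
    φ-inj {left i} {right j} e = ⊥-elim (outside j (hd∈ j) i (sym e))
    φ-inj {left i} {internal i′ j r} e = ⊥-elim (outside j (mid∈ i′ j r) i (sym e))
    φ-inj {right j} {left i} e = ⊥-elim (outside j (hd∈ j) i e)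
    φ-inj {internal i′ j r} {left i} e = ⊥-elim (outside j (mid∈ i′ j r) i e)
    φ-inj {right j} {right j′} e with j ≟ j′
    ... | yes refl = refl
    ... | no ne = ⊥-elim (apart ne (hd∈ j) (subst (_∈ S.verts j′) (sym e) (hd∈ j′)))
    φ-inj {right j} {internal i j′ r} e with j ≟ j′
    ... | yes refl = ⊥-elim (S.hd∉ j i (subst (_∈ S.mid j i) (sym e) (∈-lookup (cast (k-1 i j) r))))
    ... | no ne = ⊥-elim (apart ne (hd∈ j) (subst (_∈ S.verts j′) (sym e) (mid∈ i j′ r)))
    φ-inj {internal i j′ r} {right j} e with j ≟ j′
    ... | yes refl = ⊥-elim (S.hd∉ j i (subst (_∈ S.mid j i) e (∈-lookup (cast (k-1 i j) r))))
    ... | no ne = ⊥-elim (apart ne (hd∈ j) (subst (_∈ S.verts j′) e (mid∈ i j′ r)))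
    φ-inj {internal i j r} {internal i′ j′ r′} e with j ≟ j′
    ... | no ne = ⊥-elim (apart ne (mid∈ i j r) (subst (_∈ S.verts j′) (sym e) (mid∈ i′ j′ r′)))
    ... | yes refl with i ≟ i′
    ...   | no ne = ⊥-elim (S.dis j ne (∈-lookup (cast (k-1 i j) r)) (subst (_∈ S.mid j i′) (sym e) (∈-lookup (cast (k-1 i′ j) r′))))
    ...   | yes refl = cong (internal i j) (cast-inj (k-1 i j) (lookup-unique (S.uniq j i) _ _ e))
    φ-path : ∀ i j (p : Fin (suc k)) → φ (pathVertex k i j p) ≡ nth (ys i) (S.mid j i) (S.hd j) (toℕ p)
    φ-path i j p with toℕ p
    ... | zero = refl
    ... | suc q with q <? (k ∸ 1)
    ...   | yes lt = sym (trans (cong (nth (ys i) (S.mid j i) (S.hd j) ∘ suc) (sym (trans (toℕ-cast (k-1 i j) (fromℕ< lt)) (toℕ-fromℕ< lt))))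
                       (nth-lookup (ys i) (S.mid j i) (S.hd j) (cast (k-1 i j) (fromℕ< lt))))
    ...   | no ¬lt = sym (nth-end (ys i) (S.mid j i) (S.hd j) q (subst (_≤ q) (k-1 i j) (≮⇒≥ ¬lt)))
    φ-adj : ∀ i j (m : Fin k) → φ (pathVertex k i j (inject₁ m)) ~ φ (pathVertex k i j (suc m))
    φ-adj i j m rewrite φ-path i j (inject₁ m) | φ-path i j (suc m) | toℕ-inject₁ m =
      nth-adj (S.path j i) (toℕ m) (≤-pred (≤-trans (toℕ<n m) (≤-reflexive (sym (S.len j i)))))

-- Families closed under moves

AllPairs⇒≤1 : ∀ {A : Set} {R : A → A → Set} {P : A → Set} (P? : Decidable P) {xs} → AllPairs R xs →
  (∀ {x y} → P x → P y → ¬ R x y) → #[ P? ] xs ≤ 1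
AllPairs⇒≤1 P? {[]} [] excl = z≤n
AllPairs⇒≤1 P? {x ∷ xs} (r ∷ rs) excl with P? x
... | no _ = AllPairs⇒≤1 P? rs excl
... | yes px = s≤s (≤-reflexive (cong length (filter-none P? (All.map (λ rxy py → excl px py rxy) r))))

occurrences : ∀ {s} → Fin s → List (Fin s) → ℕ
occurrences i ops = #[ (λ o → i ≟ o) ] ops

occurrences-++ : ∀ {s} (i : Fin s) xs ys → occurrences i (xs ++ ys) ≡ occurrences i xs + occurrences i ys
occurrences-++ i xs ys = trans (cong length (filter-++ (i ≟_) xs ys)) (length-++ (filter (i ≟_) xs))

module _ {s : ℕ} (e : Fin s → ℕ) where

  repeated : List (Fin s) → List (Fin s)
  repeated is = concat (map (λ i → replicate (e i) i) is)

  occurrences-∉ : ∀ i is → i ∉ is → occurrences i (repeated is) ≡ 0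
  occurrences-∉ i [] _ = refl
  occurrences-∉ i (i′ ∷ is) i∉ = trans (occurrences-++ i (replicate (e i′) i′) (repeated is))
    (cong₂ _+_ (cong length (filter-none (i ≟_) (AllP.replicate⁺ (e i′) (i∉ ∘ here)))) (occurrences-∉ i is (i∉ ∘ there)))

  occurrences-∈ : ∀ i {is} → Unique is → i ∈ is → occurrences i (repeated is) ≡ e i
  occurrences-∈ i {i′ ∷ is} (i∉ ∷ u) (here refl) = trans (occurrences-++ i (replicate (e i) i) (repeated is))
    (trans (cong₂ _+_ (trans (cong length (filter-all (i ≟_) (AllP.replicate⁺ (e i) refl))) (length-replicate (e i)))
                      (occurrences-∉ i is (λ p → All.lookup i∉ p refl))) (+-identityʳ (e i)))
  occurrences-∈ i {i′ ∷ is} (i′∉ ∷ u) (there p) = trans (occurrences-++ i (replicate (e i′) i′) (repeated is))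
    (cong₂ _+_ (cong length (filter-none (i ≟_) (AllP.replicate⁺ (e i′) λ { refl → All.lookup i′∉ p refl }))) (occurrences-∈ i u p))

module Families {n : ℕ} (G : Graph n) where
  open InGraph G public
  open Paths G public

  Abundant : ℕ → ℕ → (V → Set) → Set
  Abundant d M P = ∃ λ vs → Unique vs × d ≤ M * length vs × (∀ {v} → v ∈ vs → P v)

  -- Embedded spiders with legs of lengths suc (q i), closed under replacing everything but the ends of the
  -- legs (petals) and under replacing the end of a single leg (move).
  record Family {s : ℕ} (q : Fin s → ℕ) (L M d : ℕ) : Set₁ where
    field
      {Obj}    : Set
      objs     : List Obj
      at       : Obj → Fin s → ℕ → V
      nonempty : ∃ λ x → x ∈ objs
      head     : ∀ {x} → x ∈ objs → ∀ i i′ → at x i 0 ≡ at x i′ 0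
      adj      : ∀ {x} → x ∈ objs → ∀ i {r} → r ≤ q i → at x i r ~ at x i (suc r)
      inj      : ∀ {x} → x ∈ objs → ∀ {i i′ r r′} → r ≤ suc (q i) → r′ ≤ suc (q i′) →
                 at x i r ≡ at x i′ r′ → SamePlace i r i′ r′

    leaf : Obj → Fin s → V
    leaf x i = at x i (suc (q i))

    Separate : Obj → Obj → Set
    Separate y z = ∀ {i i′ r r′} → r ≤ q i → r′ ≤ q i′ → at y i r ≢ at z i′ r′

    Moved : Obj → Fin s → V → Set
    Moved x i v = ∃ λ y → y ∈ objs × leaf y i ≡ v × (∀ i′ {r} → r ≤ suc (q i′) → ¬ (i′ ≡ i × r ≡ suc (q i)) → at y i′ r ≡ at x i′ r)

    field
      petals : ∀ {x} → x ∈ objs → ∃ λ b → L ≤ length b ×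
               (∀ {y} → y ∈ b → y ∈ objs × (∀ i → leaf y i ≡ leaf x i)) × AllPairs Separate b
      move   : ∀ {x} → x ∈ objs → ∀ i → Abundant d M (Moved x i)

    leaf-inj : ∀ {x} → x ∈ objs → ∀ {i i′} → leaf x i ≡ leaf x i′ → i ≡ i′
    leaf-inj x∈ e with inj x∈ ≤-refl ≤-refl e
    ... | inj₂ (i≡i′ , _) = i≡i′

    -- The petals are pairwise disjoint, so a forbidden vertex meets at most one of them, and there
    -- are more than length F petals.
    petal-avoiding : ∀ {x} → x ∈ objs → ∀ F → length F < L →
      ∃ λ y → y ∈ objs × (∀ i → leaf y i ≡ leaf x i) × (∀ i {r} → r ≤ q i → at y i r ∉ F)
    petal-avoiding {x} x∈ F lt with petals x∈
    ... | b , le , good , sep with Any.any? (λ y → ¬? (any? λ i → any? λ (r : Fin (suc (q i))) → at y i (toℕ r) ∈F? F)) b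
    ...   | yes p = let y , y∈ , out = find p in y , proj₁ (good y∈) , proj₂ (good y∈)
              , λ i {r} r≤ v∈ → out (i , fromℕ< (s≤s r≤) , subst (λ r → at y i r ∈ F) (sym (toℕ-fromℕ< (s≤s r≤))) v∈)
    ...   | no ¬p = ⊥-elim (<⇒≱ lt (≤-trans le (≤-trans (cover-bound hits? b F 1 cov (λ {f} _ → AllPairs⇒≤1 (λ y → hits? y f) sep one))
                        (≤-reflexive (*-identityʳ (length F))))))
      where
      Hits : Obj → V → Set
      Hits y f = ∃ λ i → ∃ λ (r : Fin (suc (q i))) → at y i (toℕ r) ≡ f
      hits? : ∀ y f → Dec (Hits y f)
      hits? y f = any? λ i → any? λ r → at y i (toℕ r) ≟ f
      cov : ∀ {y} → y ∈ b → ∃ λ f → f ∈ F × Hits y f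
      cov {y} y∈ with any? (λ i → any? λ (r : Fin (suc (q i))) → at y i (toℕ r) ∈F? F)
      ... | yes (i , r , f∈) = at y i (toℕ r) , f∈ , i , r , refl
      ... | no ¬h = ⊥-elim (¬p (lose y∈ ¬h))
      one : ∀ {y z f} → Hits y f → Hits z f → ¬ Separate y z
      one (i , r , e) (i′ , r′ , e′) sp = sp (≤-pred (toℕ<n r)) (≤-pred (toℕ<n r′)) (trans e (sym e′))

    -- W is the budget of forbidden vertices: fewer than the petals, and fewer than the at least d /
    -- M values to which an end can be moved.
    module Moves (W : ℕ) (W<L : W < L) (MW<d : M * W < d) where

      move-avoiding : ∀ {x} → x ∈ objs → ∀ i F → length F ≤ W →
        ∃ λ y → y ∈ objs × leaf y i ∉ F × (∀ i′ {r} → r ≤ suc (q i′) → ¬ (i′ ≡ i × r ≡ suc (q i)) → at y i′ r ≡ at x i′ r)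
      move-avoiding x∈ i F le with move x∈ i
      ... | vs , u , many , ext with avoid _≟_ {vs} {F} u (*-cancelˡ-< M _ _ (<-≤-trans (≤-<-trans (*-monoʳ-≤ M le) MW<d) many))
      ...   | v , v∈ , v∉ with ext v∈
      ...     | y , y∈ , e , same = y , y∈ , subst (_∉ F) (sym e) v∉ , same

      -- Passing to a petal keeps all ends and refreshes the interior; the move then keeps
      -- everything but one end. So both new vertices of the walk avoid F while the other ends stay.
      advance : ∀ {x} → x ∈ objs → ∀ i F → length F ≤ W →
        ∃₂ λ p y → y ∈ objs × leaf x i ~ p × p ~ leaf y i × p ∉ F × leaf y i ∉ F × (∀ i′ → i′ ≢ i → leaf y i′ ≡ leaf x i′)
      advance {x} x∈ i F le with petal-avoiding x∈ F (≤-<-trans le W<L)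
      ... | z , z∈ , same , out with move-avoiding z∈ i F le
      ...   | y , y∈ , y∉ , keep = at z i (q i) , y , y∈
              , subst (_~ at z i (q i)) (same i) (~-sym (adj z∈ i ≤-refl))
              , subst (_~ leaf y i) (keep i (n≤1+n _) (λ z → 1+n≢n (sym (proj₂ z)))) (adj y∈ i ≤-refl)
              , out i ≤-refl , y∉ , λ i′ ne → trans (keep i′ ≤-refl (ne ∘ proj₁)) (same i′)

      private
        prepend : ∀ {i i′ : Fin s} → Dec (i′ ≡ i) → List V → List V → List V
        prepend (yes _) xs ys = xs ++ ys
        prepend (no _) xs ys = ys

      -- Each entry of ops moves the end of the given leg by a walk of length two.
      advances : ∀ ops {x} → x ∈ objs → ∀ F → length F + 2 * length ops ≤ W →
        ∃₂ λ y (xs : Fin s → List V) → y ∈ objs × (∀ i → Path (leaf x i) (xs i) (leaf y i)) ×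
          (∀ i → length (xs i) ≡ 2 * occurrences i ops) × (∀ i → Unique (xs i)) ×
          (∀ {i i′ v} → i ≢ i′ → v ∈ xs i → v ∉ xs i′) × (∀ {i v} → v ∈ xs i → v ∉ F)
      advances [] {x} x∈ F le = x , (λ _ → []) , x∈ , (λ _ → []) , (λ _ → refl) , (λ _ → []) , (λ _ ()) , λ ()
      advances (o ∷ ops) {x} x∈ F le with advance x∈ o F (≤-trans (m≤m+n (length F) _) le)
      ... | p , y₁ , y₁∈ , e₁ , e₂ , p∉ , u∉ , same
        with advances ops y₁∈ (p ∷ leaf y₁ o ∷ F) (≤-trans (≤-reflexive (solve 2 (λ f l → con 2 :+ f :+ con 2 :* l := f :+ con 2 :* (con 1 :+ l)) refl (length F) (length ops))) le)
      ...   | y , xs , y∈ , paths , lens , uniqs , dis , outs = y , xs′ , y∈ , paths′ , lens′ , uniqs′ , (λ {i} {i′} → dis′ {i} {i′}) , λ {i} → outs′ {i}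
        where
        xs′ : Fin s → List V
        xs′ i = prepend (i ≟ o) (p ∷ leaf y₁ o ∷ []) (xs i)
        paths′ : ∀ i → Path (leaf x i) (xs′ i) (leaf y i)
        paths′ i with i ≟ o
        ... | yes refl = e₁ ∷ e₂ ∷ paths i
        ... | no ne = subst (λ v → Path v (xs i) (leaf y i)) (same i ne) (paths i)
        lens′ : ∀ i → length (xs′ i) ≡ 2 * occurrences i (o ∷ ops)
        lens′ i with i ≟ o
        ... | yes refl = trans (cong (2 +_) (lens i)) (solve 1 (λ l → con 2 :+ con 2 :* l := con 2 :* (con 1 :+ l)) refl (occurrences i ops))
        ... | no ne = lens i
        uniqs′ : ∀ i → Unique (xs′ i)
        uniqs′ i with i ≟ o
        ... | yes refl = ((λ e → ~⇒≢ e₂ e) ∷ All.tabulate (λ v∈ e → outs v∈ (here (sym e))))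
                         ∷ All.tabulate (λ v∈ e → outs v∈ (there (here (sym e)))) ∷ uniqs i
        ... | no _ = uniqs i
        outs′ : ∀ {i v} → v ∈ xs′ i → v ∉ F
        outs′ {i} v∈ with i ≟ o
        outs′ {i} (here refl) | yes refl = p∉
        outs′ {i} (there (here refl)) | yes refl = u∉
        outs′ {i} (there (there v∈)) | yes refl = outs v∈ ∘ there ∘ there
        outs′ {i} v∈ | no _ = outs v∈ ∘ there ∘ there
        dis′ : ∀ {i i′ v} → i ≢ i′ → v ∈ xs′ i → v ∉ xs′ i′
        dis′ {i} {i′} ne v∈ v∈′ with i ≟ o | i′ ≟ o
        ... | yes refl | yes refl = ne refl
        ... | no _ | no _ = dis ne v∈ v∈′
        dis′ ne (here refl) v∈′ | yes refl | no _ = outs v∈′ (here refl)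
        dis′ ne (there (here refl)) v∈′ | yes refl | no _ = outs v∈′ (there (here refl))
        dis′ ne (there (there v∈)) v∈′ | yes refl | no _ = dis ne v∈ v∈′
        dis′ ne v∈ (here refl) | no _ | yes refl = outs v∈ (here refl)
        dis′ ne v∈ (there (here refl)) | no _ | yes refl = outs v∈ (there (here refl))
        dis′ ne v∈ (there (there v∈′)) | no _ | yes refl = dis ne v∈ v∈′

      -- For legs whose start is the neighbour of the end, the first step of the path is the end
      -- itself, which must avoid F. The interior is kept so that the starts do not change.
      replace-leaves : ∀ {os} → Unique os → ∀ {x} → x ∈ objs → ∀ F → length F ≤ W →
        ∃ λ y → y ∈ objs × (∀ {i} → i ∈ os → leaf y i ∉ F) × (∀ {i} → i ∉ os → leaf y i ≡ leaf x i) ×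
          (∀ i {r} → r ≤ q i → at y i r ≡ at x i r)
      replace-leaves [] {x} x∈ F le = x , x∈ , (λ ()) , (λ _ → refl) , λ _ _ → refl
      replace-leaves {o ∷ os} (o∉ ∷ u) {x} x∈ F le with move-avoiding x∈ o F le
      ... | y₁ , y₁∈ , y₁∉ , keep with replace-leaves u y₁∈ F le
      ...   | y , y∈ , out , same , inner = y , y∈
              , (λ { (here refl) → subst (_∉ F) (sym (same (λ i∈ → All.lookup o∉ i∈ refl))) y₁∉ ; (there i∈) → out i∈ })
              , (λ {i} i∉ → trans (same (i∉ ∘ there)) (keep i ≤-refl (λ z → i∉ (here (proj₁ z)))))
              , λ i r≤ → trans (inner i r≤) (keep i (m≤n⇒m≤1+n r≤) λ { (refl , e) → <⇒≢ (s≤s r≤) e })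

  module _ {s L M d : ℕ} {q : Fin (suc s) → ℕ} (fam : Family q L M d) where
    open Family fam

    private
      pick : ∀ {P : Set} → Dec P → V → V → V
      pick (yes _) a b = a
      pick (no _) a b = b

      only : ∀ {P : Set} → Dec P → V → List V
      only (yes _) a = a ∷ []
      only (no _) a = []

    anchor : List (Fin (suc s)) → Obj → Fin (suc s) → V
    anchor os x i = pick (i ∈F? os) (at x i (q i)) (leaf x i)

    -- The stages are x, then `y₁` with new ends on the legs in `os`, then `y₂` after the moves,
    -- then a petal z of `y₂`. Each stage avoids all vertices of the earlier ones, recorded in the
    -- growing lists F, `F₁`, `F₂`. A leg of the result is the optional first edge, 2 * e i steps of
    -- moves, and the leg of z down to its head.
    module Glue (k : ℕ) (os : List (Fin (suc s))) (e : Fin (suc s) → ℕ)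
      (lens : ∀ i → k ≡ indicator (i ∈F? os) + (2 * e i + suc (q i)))
      (x y₁ y₂ z : Obj) (xs : Fin (suc s) → List V) (F F₁ F₂ : List V)
      (y₁∈ : y₁ ∈ objs) (z∈ : z ∈ objs)
      (y₁-out : ∀ {i} → i ∈ os → leaf y₁ i ∉ F) (y₁-same : ∀ {i} → i ∉ os → leaf y₁ i ≡ leaf x i)
      (y₁-inner : ∀ i {r} → r ≤ q i → at y₁ i r ≡ at x i r)
      (walk : ∀ i → Path (leaf y₁ i) (xs i) (leaf y₂ i)) (xs-len : ∀ i → length (xs i) ≡ 2 * e i)
      (xs-uniq : ∀ i → Unique (xs i)) (xs-dis : ∀ {i i′ v} → i ≢ i′ → v ∈ xs i → v ∉ xs i′)
      (xs-out : ∀ {i v} → v ∈ xs i → v ∉ F₁)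
      (z-leaf : ∀ i → leaf z i ≡ leaf y₂ i) (z-out : ∀ i {r} → r ≤ q i → at z i r ∉ F₂)
      (F⊆F₁ : ∀ {v} → v ∈ F → v ∈ F₁) (F₁⊆F₂ : ∀ {v} → v ∈ F₁ → v ∈ F₂)
      (leaf∈F₁ : ∀ i → leaf y₁ i ∈ F₁) (xs⊆F₂ : ∀ i {v} → v ∈ xs i → v ∈ F₂) where

      hd = at z zero 0
      odd : Fin (suc s) → List V
      odd i = only (i ∈F? os) (leaf y₁ i)
      down : Fin (suc s) → List V
      down i = downList (at z i) (q i)
      mid : Fin (suc s) → List V
      mid i = odd i ++ (xs i ++ down i)
      start : ∀ i → Path (anchor os x i) (odd i) (leaf y₁ i)
      start i with i ∈F? os
      ... | yes i∈ = subst (_~ leaf y₁ i) (y₁-inner i ≤-refl) (adj y₁∈ i ≤-refl) ∷ []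
      ... | no i∉ = subst (λ v → Path v [] (leaf y₁ i)) (y₁-same i∉) []
      finish : ∀ i → IPath (leaf y₂ i) (down i) hd
      finish i = subst₂ (λ a b → IPath a (down i) b) (z-leaf i) (head z∈ i zero) (down-path (at z i) (q i) (adj z∈ i))
      odd-len : ∀ i → length (odd i) ≡ indicator (i ∈F? os)
      odd-len i with i ∈F? os
      ... | yes _ = refl
      ... | no _ = refl
      len : ∀ i → suc (length (mid i)) ≡ k
      len i = begin
        suc (length (odd i ++ (xs i ++ down i)))              ≡⟨ cong suc (trans (length-++ (odd i)) (cong (length (odd i) +_) (length-++ (xs i)))) ⟩
        suc (length (odd i) + (length (xs i) + length (down i))) ≡⟨ cong suc (cong₂ _+_ (odd-len i) (cong₂ _+_ (xs-len i) (length-downList (at z i) (q i)))) ⟩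
        suc (indicator (i ∈F? os) + (2 * e i + q i))          ≡⟨ solve 3 (λ a b c → con 1 :+ (a :+ (b :+ c)) := a :+ (b :+ (con 1 :+ c))) refl (indicator (i ∈F? os)) (2 * e i) (q i) ⟩
        indicator (i ∈F? os) + (2 * e i + suc (q i))          ≡⟨ sym (lens i) ⟩
        k                                                     ∎
        where open ≡-Reasoning
      odd-leaf : ∀ i {v} → v ∈ odd i → v ≡ leaf y₁ i × v ∉ F
      odd-leaf i v∈ with i ∈F? os
      odd-leaf i (here refl) | yes i∈ = refl , y₁-out i∈
      odd-uniq : ∀ i → Unique (odd i)
      odd-uniq i with i ∈F? os
      ... | yes _ = [] ∷ []
      ... | no _ = []
      down-at : ∀ i {v} → v ∈ down i → ∃ λ r → r < q i × v ≡ at z i (suc r)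
      down-at i = ∈-downList (at z i) (q i)
      down-out : ∀ i {v} → v ∈ down i → v ∉ F₂
      down-out i v∈ with down-at i v∈
      ... | r , lt , refl = z-out i lt
      data Part (i : Fin (suc s)) (v : V) : Set where
        isOdd  : v ≡ leaf y₁ i → v ∉ F → Part i v
        isWalk : v ∈ xs i → Part i v
        isDown : v ∈ down i → Part i v
      part : ∀ i {v} → v ∈ mid i → Part i v
      part i v∈ with ∈-++⁻ (odd i) v∈
      ... | inj₁ p = let a , b = odd-leaf i p in isOdd a b
      ... | inj₂ p with ∈-++⁻ (xs i) p
      ...   | inj₁ p′ = isWalk p′
      ...   | inj₂ p′ = isDown p′
      dis : ∀ {i i′ v} → i ≢ i′ → v ∈ mid i → v ∉ mid i′
      dis {i} {i′} ne v∈ v∈′ with part i v∈ | part i′ v∈′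
      ... | isOdd refl _ | isOdd e _ = ne (leaf-inj y₁∈ e)
      ... | isOdd refl _ | isWalk w = xs-out w (leaf∈F₁ i)
      ... | isOdd refl _ | isDown w = down-out i′ w (F₁⊆F₂ (leaf∈F₁ i))
      ... | isWalk w | isOdd refl _ = xs-out w (leaf∈F₁ i′)
      ... | isWalk w | isWalk w′ = xs-dis ne w w′
      ... | isWalk w | isDown w′ = down-out i′ w′ (xs⊆F₂ i w)
      ... | isDown w | isOdd refl _ = down-out i w (F₁⊆F₂ (leaf∈F₁ i′))
      ... | isDown w | isWalk w′ = down-out i w (xs⊆F₂ i′ w′)
      ... | isDown w | isDown w′ with down-at i w | down-at i′ w′
      ...   | r , lt , refl | r′ , lt′ , e′ with inj z∈ (s≤s (<⇒≤ lt)) (s≤s (<⇒≤ lt′)) e′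
      ...     | inj₂ (e″ , _) = ne e″
      hd-out : hd ∉ F₂
      hd-out = z-out zero z≤n
      hd∉ : ∀ i → hd ∉ mid i
      hd∉ i v∈ with part i v∈
      ... | isOdd e _ = hd-out (subst (_∈ F₂) (sym e) (F₁⊆F₂ (leaf∈F₁ i)))
      ... | isWalk w = hd-out (xs⊆F₂ i w)
      ... | isDown w with down-at i w
      ...   | r , lt , e with inj z∈ z≤n (s≤s (<⇒≤ lt)) e
      ...     | inj₁ (_ , ())
      uniq : ∀ i → Unique (mid i)
      uniq i = UniqueP.++⁺ (odd-uniq i)
        (UniqueP.++⁺ (xs-uniq i) (downList-unique (at z i) (q i) same-r) λ { (w , w′) → down-out i w′ (xs⊆F₂ i w) })
        λ { (w , w′) → case ∈-++⁻ (xs i) w′ of λ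
          { (inj₁ p) → xs-out p (subst (_∈ F₁) (sym (proj₁ (odd-leaf i w))) (leaf∈F₁ i))
          ; (inj₂ p) → down-out i p (F₁⊆F₂ (subst (_∈ F₁) (sym (proj₁ (odd-leaf i w))) (leaf∈F₁ i))) } }
        where
        same-r : ∀ {a b} → a ≤ q i → b ≤ q i → at z i a ≡ at z i b → a ≡ b
        same-r a≤ b≤ e with inj z∈ (m≤n⇒m≤1+n a≤) (m≤n⇒m≤1+n b≤) e
        ... | inj₁ (refl , refl) = refl
        ... | inj₂ (_ , r) = r
      spiderAt : Spider (anchor os x) k
      spiderAt = record { hd = hd ; mid = mid ; path = λ i → start i ⊕ (walk i ⊕ finish i) ; len = len ; uniq = uniq ; dis = dis ; hd∉ = hd∉ }
      verts-out : ∀ {v} → v ∈ Spider.verts spiderAt → v ∉ F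
      verts-out (here refl) v∈F = hd-out (F₁⊆F₂ (F⊆F₁ v∈F))
      verts-out (there v∈) v∈F with ∈-concat⁻′ (map mid (allFin (suc s))) v∈
      ... | l , v∈l , l∈ with ∈-map⁻ mid l∈
      ...   | i , _ , refl with part i v∈l
      ...     | isOdd _ o = o v∈F
      ...     | isWalk w = xs-out w (F⊆F₁ v∈F)
      ...     | isDown w = down-out i w (F₁⊆F₂ (F⊆F₁ v∈F))

    -- In the budget, suc s stands for the ends of `y₁`. The last summand bounds suc s walks of
    -- length at most 2 * (suc s * k) each, a crude bound that also covers the 2 vertices per move
    -- reserved by `advances`.
    spider-robust : ∀ k W bound → W < L → M * W < d → (os : List (Fin (suc s))) → Unique os → (e : Fin (suc s) → ℕ) →
      (∀ i → e i ≤ k) → (∀ i → k ≡ indicator (i ∈F? os) + (2 * e i + suc (q i))) →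
      bound + suc s + suc s * (2 * (suc s * k)) ≤ W →
      ∀ {x} → x ∈ objs → Robust (anchor os x) k bound
    spider-robust k W bound W<L MW<d os uos e e≤k lens room {x} x∈ F F≤
      with Moves.replace-leaves W W<L MW<d uos x∈ F (≤-trans F≤ (≤-trans (m≤m+n bound (suc s)) (≤-trans (m≤m+n (bound + suc s) _) room)))
    ... | y₁ , y₁∈ , y₁-out , y₁-same , y₁-inner
      with Moves.advances W W<L MW<d (repeated e (allFin (suc s))) y₁∈ (F ++ map (leaf y₁) (allFin (suc s)))
             (≤-trans (+-mono-≤ F₁≤ (≤-trans (*-monoʳ-≤ 2 ops≤) (m≤m+n (2 * (suc s * k)) _))) room)
      where
      ops≤ : length (repeated e (allFin (suc s))) ≤ suc s * k
      ops≤ = length-concat-family (λ i → replicate (e i) i) k λ i → ≤-trans (≤-reflexive (length-replicate (e i))) (e≤k i)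
      F₁≤ : length (F ++ map (leaf y₁) (allFin (suc s))) ≤ bound + suc s
      F₁≤ = ≤-trans (≤-reflexive (trans (length-++ F) (cong (length F +_) (trans (length-map (leaf y₁) (allFin (suc s))) (length-allFin (suc s)))))) (+-monoˡ-≤ (suc s) F≤)
    ...   | y₂ , xs , y₂∈ , walk , xs-len , xs-uniq , xs-dis , xs-out
      with petal-avoiding y₂∈ ((F ++ map (leaf y₁) (allFin (suc s))) ++ concat (map xs (allFin (suc s)))) (≤-<-trans F₂≤ W<L)
      where
      occ : ∀ i → occurrences i (repeated e (allFin (suc s))) ≡ e i
      occ i = occurrences-∈ e i (UniqueP.allFin⁺ (suc s)) (∈-allFin i)
      xs≤ : ∀ i → length (xs i) ≤ 2 * (suc s * k)
      xs≤ i = ≤-trans (≤-reflexive (xs-len i)) (*-monoʳ-≤ 2 (≤-trans (≤-trans (≤-reflexive (occ i)) (e≤k i)) (m≤m+n k _)))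
      F₁≤ : length (F ++ map (leaf y₁) (allFin (suc s))) ≤ bound + suc s
      F₁≤ = ≤-trans (≤-reflexive (trans (length-++ F) (cong (length F +_) (trans (length-map (leaf y₁) (allFin (suc s))) (length-allFin (suc s)))))) (+-monoˡ-≤ (suc s) F≤)
      F₂≤ : length ((F ++ map (leaf y₁) (allFin (suc s))) ++ concat (map xs (allFin (suc s)))) ≤ W
      F₂≤ = ≤-trans (≤-reflexive (length-++ (F ++ map (leaf y₁) (allFin (suc s))))) (≤-trans (+-mono-≤ F₁≤ (length-concat-family xs (2 * (suc s * k)) xs≤)) room)
    ...     | z , z∈ , z-leaf , z-out = Gl.spiderAt , Gl.verts-out
      where
      module Gl = Glue k os e lens x y₁ y₂ z xs F (F ++ map (leaf y₁) (allFin (suc s)))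
        ((F ++ map (leaf y₁) (allFin (suc s))) ++ concat (map xs (allFin (suc s)))) y₁∈ z∈ y₁-out y₁-same y₁-inner walk
        (λ i → trans (xs-len i) (cong (2 *_) (occurrences-∈ e i (UniqueP.allFin⁺ (suc s)) (∈-allFin i)))) xs-uniq xs-dis xs-out z-leaf z-out
        ∈-++⁺ˡ ∈-++⁺ˡ (λ i → ∈-++⁺ʳ F (∈-map⁺ (leaf y₁) (∈-allFin i)))
        (λ i v∈ → ∈-++⁺ʳ (F ++ map (leaf y₁) (allFin (suc s))) (∈-family xs i v∈))

-- Links

-- Pigeonhole in multiplicative form: some fibre is at least the average, stated without division.
pigeonhole-average : ∀ {A B : Set} {R : A → B → Set} (R? : ∀ a b → Dec (R a b)) xs ys →
  (∀ {x} → x ∈ xs → ∃ λ y → y ∈ ys × R x y) → 0 < length xs →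
  ∃ λ y → y ∈ ys × length xs ≤ length ys * #[ (λ a → R? a y) ] xs
pigeonhole-average R? xs ys cov ne with Any.any? (λ y → length xs ≤? length ys * #[ (λ a → R? a y) ] xs) ys
... | yes p = find p
pigeonhole-average R? (x ∷ xs₀) ys cov ne | no ¬p = ⊥-elim (<⇒≱ (n<1+n (length xs₀)) (*-cancelˡ-≤ (length ys) {{>-nonZero (∈-length (proj₁ (proj₂ (cov (here refl)))))}} (begin
  length ys * suc (length xs₀)      ≤⟨ *-monoʳ-≤ (length ys) (cover-∑ R? xs ys cov) ⟩
  length ys * ∑ ys f                ≡⟨ scale ys (length ys) ⟩
  ∑ ys (λ y → length ys * f y)      ≤⟨ ∑-mono ys (λ y∈ → ≤-pred (≰⇒> λ le → ¬p (lose y∈ le))) ⟩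
  ∑ ys (λ _ → length xs₀)           ≡⟨ ∑-const ys _ ⟩
  length ys * length xs₀            ∎)))
  where
  open ≤-Reasoning
  xs = x ∷ xs₀
  f = λ y → #[ (λ a → R? a y) ] xs
  scale : ∀ zs c → c * ∑ zs f ≡ ∑ zs (λ y → c * f y)
  scale [] c = *-zeroʳ c
  scale (z ∷ zs) c = trans (*-distribˡ-+ c (f z) (∑ zs f)) (cong (c * f z +_) (scale zs c))

sublists : {A : Set} → List A → List (List A)
sublists [] = [] ∷ []
sublists (x ∷ xs) = map (x ∷_) (sublists xs) ++ sublists xs

length-sublists : ∀ {A : Set} (xs : List A) → length (sublists xs) ≡ 2 ^ length xs
length-sublists [] = refl
length-sublists (x ∷ xs) = trans (length-++ (map (x ∷_) (sublists xs)))
  (cong₂ _+_ (trans (length-map (x ∷_) (sublists xs)) (length-sublists xs)) (trans (length-sublists xs) (sym (+-identityʳ _))))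

filter∈sublists : ∀ {A : Set} {P : A → Set} (P? : Decidable P) xs → filter P? xs ∈ sublists xs
filter∈sublists P? [] = here refl
filter∈sublists P? (x ∷ xs) with P? x
... | yes _ = ∈-++⁺ˡ (∈-map⁺ (x ∷_) (filter∈sublists P? xs))
... | no _ = ∈-++⁺ʳ (map (x ∷_) (sublists xs)) (filter∈sublists P? xs)

Biclique : {I B : Set} → (I → B → Set) → List I → ℕ → ℕ → Set
Biclique R is β q = ∃₂ λ is′ B′ → Unique is′ × Unique B′ × q ≤ length is′ × β ≤ 2 * (2 ^ length is * length B′) ×
  (∀ {a} → a ∈ is′ → a ∈ is) × (∀ {a b} → a ∈ is′ → b ∈ B′ → R a b)

-- Kővári–Sós–Turán: group the vertices b adjacent to many elements of I by their trace on I.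
kst : ∀ {I B : Set} (_≟I_ : (x y : I) → Dec (x ≡ y)) {R : I → B → Set} (R? : ∀ a b → Dec (R a b))
  (is : List I) (U : List B) β q → Unique is → Unique U → 0 < length is → 0 < β →
  (∀ {a} → a ∈ is → β ≤ #[ R? a ] U) → 2 * (length U * q) ≤ length is * β →
  Biclique R is β q
kst {I} {B} _≟I_ {R} R? is U β q uis uU is>0 β>0 dense small = result
  where
  trace : B → List I
  trace b = filter (λ a → R? a b) is
  full? : ∀ b → Dec (q ≤ length (trace b))
  full? b = q ≤? length (trace b)
  Ur = filter full? U
  m = length is
  count : m * β ≤ length Ur * m + length U * q
  count = begin
    m * β                                ≡⟨ sym (∑-const is β) ⟩
    ∑ is (λ _ → β)                       ≤⟨ ∑-mono is dense ⟩
    ∑ is (λ a → #[ R? a ] U)             ≡⟨ double-counting R? is U ⟩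
    ∑ U (λ b → length (trace b))         ≤⟨ ∑-rich U (λ b → length (trace b)) q m (λ {b} _ → length-filter (λ a → R? a b) is) ⟩
    length Ur * m + length U * q         ∎
    where open ≤-Reasoning
  -- By `small`, vertices with a trace shorter than q account for at most half of the incidences.
  β≤ : β ≤ 2 * length Ur
  β≤ = *-cancelˡ-≤ m {{>-nonZero is>0}} (+-cancelʳ-≤ (m * β) (m * β) _ (begin
    m * β + m * β                        ≤⟨ +-mono-≤ count count ⟩
    (length Ur * m + length U * q) + (length Ur * m + length U * q)
      ≡⟨ solve 3 (λ r m u → (r :* m :+ u) :+ (r :* m :+ u) := m :* (con 2 :* r) :+ con 2 :* u) refl (length Ur) m (length U * q) ⟩
    m * (2 * length Ur) + 2 * (length U * q) ≤⟨ +-monoʳ-≤ (m * (2 * length Ur)) small ⟩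
    m * (2 * length Ur) + m * β          ∎))
    where open ≤-Reasoning
  Ur>0 : 0 < length Ur
  Ur>0 = positive (length Ur) β≤
    where
    positive : ∀ r → β ≤ 2 * r → 0 < r
    positive zero le = ⊥-elim (<⇒≱ β>0 le)
    positive (suc r) _ = s≤s z≤n
  result : Biclique R is β q
  result with pigeonhole-average (λ b is′ → ≡-dec _≟I_ (trace b) is′) Ur (sublists is)
                (λ {b} _ → trace b , filter∈sublists (λ a → R? a b) is , refl) Ur>0
  ... | is′ , _ , large with find-one (filter (λ b → ≡-dec _≟I_ (trace b) is′) Ur) refl
    where
    find-one : ∀ l → l ≡ filter (λ b → ≡-dec _≟I_ (trace b) is′) Ur → ∃ λ b → b ∈ filter (λ b → ≡-dec _≟I_ (trace b) is′) Ur
    find-one [] e = ⊥-elim (<⇒≱ Ur>0 (≤-trans large (≤-reflexive (trans (cong (λ l → length (sublists is) * length l) (sym e)) (*-zeroʳ (length (sublists is)))))))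
    find-one (b ∷ l) e = b , subst (b ∈_) e (here refl)
  ...   | b₀ , b₀∈ = is′ , B′ , u′ , Unique-filter same? (Unique-filter full? uU) , q≤ , spread
          , (λ a∈ → proj₁ (∈-filter⁻ (λ a → R? a b₀) {xs = is} (subst (_ ∈_) (sym (same b₀∈)) a∈)))
          , λ {a} {b} a∈ b∈ → proj₂ (∈-filter⁻ (λ a → R? a b) {xs = is} (subst (a ∈_) (sym (same b∈)) a∈))
    where
    same? = λ b → ≡-dec _≟I_ (trace b) is′
    B′ = filter same? Ur
    same : ∀ {b} → b ∈ B′ → trace b ≡ is′
    same b∈ = proj₂ (∈-filter⁻ same? {xs = Ur} b∈)
    u′ : Unique is′
    u′ = subst Unique (same b₀∈) (Unique-filter (λ a → R? a b₀) uis)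
    q≤ : q ≤ length is′
    q≤ = subst (λ l → q ≤ length l) (same b₀∈) (proj₂ (∈-filter⁻ full? {xs = U} (proj₁ (∈-filter⁻ same? {xs = Ur} b₀∈))))
    spread : β ≤ 2 * (2 ^ m * length B′)
    spread = ≤-trans β≤ (*-monoʳ-≤ 2 (≤-trans large (≤-reflexive (cong (_* length B′) (length-sublists is)))))

Exactly : {A : Set} → ℕ → (A → Set) → Set
Exactly m P = ∃ λ zs → Unique zs × length zs ≡ m × (∀ {z} → z ∈ zs → P z)

module _ {A : Set} (_≟A_ : (x y : A) → Dec (x ≡ y)) where

  fibre? : (h : A) (p : A × A) → Dec (proj₁ p ≡ h)
  fibre? h p = proj₁ p ≟A h

  -- `total` gives the number of rows for Kővári-Sós-Turán, and `fibres` caps the pairs over one h,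
  -- so that a large set of pairs is spread over many h.
  record Fibred (m : ℕ) (P : A → A → Set) (hs : List A) : Set where
    field
      pairs  : List (A × A)
      unique : Unique pairs
      total  : length pairs ≡ length hs * m
      sound  : ∀ {p} → p ∈ pairs → proj₁ p ∈ hs × P (proj₁ p) (proj₂ p)
      fibres : ∀ h → #[ fibre? h ] pairs ≤ m

  fibred : ∀ {m P} {hs} → Unique hs →
    (∀ {h} → h ∈ hs → Exactly m (P h)) → Fibred m P hs
  fibred [] _ = record { pairs = [] ; unique = [] ; total = refl ; sound = λ () ; fibres = λ _ → z≤n }
  fibred {m} {P} {h ∷ hs} (h∉ ∷ u) ch = add (ch (here refl)) (fibred u (ch ∘ there))
    where
    add : Exactly m (P h) → Fibred m P hs → Fibred m P (h ∷ hs)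
    add (zs , uz , lz , pz) rest = record
      { pairs = row ++ pairs
      ; unique = UniqueP.++⁺ (UniqueP.map⁺ (λ { refl → refl }) uz) unique
          λ { (p∈ , p∈′) → case ∈-map⁻ (h ,_) p∈ of λ { (_ , _ , refl) → All.lookup h∉ (proj₁ (sound p∈′)) refl } }
      ; total = trans (length-++ row) (cong₂ _+_ (trans (length-map (h ,_) zs) lz) total)
      ; sound = λ p∈ → case ∈-++⁻ row p∈ of λ
          { (inj₁ q) → case ∈-map⁻ (h ,_) q of λ { (_ , z∈ , refl) → here refl , pz z∈ }
          ; (inj₂ q) → there (proj₁ (sound q)) , proj₂ (sound q) }
      ; fibres = fib }
      where
      open Fibred rest
      row = map (h ,_) zs
      fib : ∀ h′ → #[ fibre? h′ ] (row ++ pairs) ≤ m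
      fib h′ = subst (_≤ m) (sym (trans (cong length (filter-++ (fibre? h′) row pairs)) (length-++ (filter (fibre? h′) row)))) (part (h ≟A h′))
        where
        part : Dec (h ≡ h′) → #[ fibre? h′ ] row + #[ fibre? h′ ] pairs ≤ m
        part (yes refl) = ≤-trans (+-mono-≤ (≤-trans (length-filter (fibre? h) row) (≤-reflexive (trans (length-map (h ,_) zs) lz)))
            (≤-reflexive (cong length (filter-none (fibre? h) {xs = pairs} (All.tabulate λ p∈ e → All.lookup h∉ (proj₁ (sound p∈)) (sym e))))))
          (≤-reflexive (+-identityʳ m))
        part (no ne) = +-mono-≤ (≤-reflexive (cong length (filter-none (fibre? h′) {xs = row} (All.tabulate λ p∈ e →
            case ∈-map⁻ (h ,_) p∈ of λ { (_ , _ , refl) → ne e })))) (fibres h′)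

-- A path of length q₀ + 2 seen as a spider with two legs, whose head is the neighbour of one end of
-- the path.
legs : ℕ → Fin 2 → ℕ
legs q₀ zero = q₀
legs q₀ (suc _) = 0

module Links {n : ℕ} (G : Graph n) where
  open Families G public

  Detour : ℕ → V → V → List V → Set
  Detour k y h F = ∃ λ xs → IPath y xs h × suc (length xs) ≡ k × Unique xs × (∀ {v} → v ∈ xs → v ∉ F)

  Linked : ℕ → V → V → ℕ → Set
  Linked k y h bound = ∀ F → length F ≤ bound → Detour k y h F

  Anchored : ℕ → ℕ → ℕ → Set
  Anchored s k bound = ∃ λ (ys : Fin s → V) → (∀ {i i′} → ys i ≡ ys i′ → i ≡ i′) × Robust ys k bound

  -- Some h avoids F and becomes the head; the paths to it are chosen one after another. The links
  -- must therefore avoid F, h and up to s paths with fewer than k inner vertices each.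
  linked-robust : ∀ {s k bound} (ys : Fin s → V) (hs : List V) → Unique hs → bound < length hs →
    (∀ i {h} → h ∈ hs → Linked k (ys i) h (suc bound + s * k)) → Robust ys k bound
  linked-robust {s} {k} {bound} ys hs uhs many link F F≤ with avoid _≟_ {hs} {F} uhs (≤-<-trans F≤ many)
  ... | h , h∈ , h∉ with choose-disjoint s {λ i xs → IPath (ys i) xs h × suc (length xs) ≡ k × Unique xs} k (suc bound + s * k)
          (λ i F′ le → let xs , p , l , u , out = link i h∈ F′ le in xs , (p , l , u) , ≤-trans (n≤1+n _) (≤-reflexive l) , out)
          (h ∷ F) (+-monoˡ-≤ (s * k) (s≤s F≤))
  ...   | mid , good , out , dis = record
            { hd = h ; mid = mid ; path = proj₁ ∘ good ; len = proj₁ ∘ proj₂ ∘ good ; uniq = proj₂ ∘ proj₂ ∘ good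
            ; dis = dis ; hd∉ = λ i h∈ → out i h∈ (here refl) }
          , λ { (here refl) → h∉
              ; (there v∈) v∈F → let l , v∈l , l∈ = ∈-concat⁻′ (map mid (allFin s)) v∈
                                     i , _ , e = ∈-map⁻ mid l∈
                                 in out i (subst (_ ∈_) e v∈l) (there v∈F) }

  list⇒family : ∀ {s} {xs : List V} → Unique xs → s ≤ length xs →
    ∃ λ (ys : Fin s → V) → (∀ {i i′} → ys i ≡ ys i′ → i ≡ i′) × (∀ i → ys i ∈ xs)
  list⇒family {xs = xs} u le = (λ i → lookup xs (inject≤ i le))
    , (λ {i} {i′} e → inject≤-injective le le i i′ (lookup-unique u _ _ e)) , λ i → ∈-lookup (inject≤ i le)

  path-nil : ∀ {a xs b} → Path a xs b → length xs ≡ 0 → a ≡ b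
  path-nil [] _ = refl

  module _ {q₀ L M d : ℕ} (fam : Family (legs q₀) L M d) where
    open Family fam

    private
      long short : Fin 2
      long = zero
      short = suc zero

    module TwoLegs (W : ℕ) (W<L : W < L) (MW<d : M * W < d) where

      -- Only the short end is advanced, so the long end stays; a fresh petal then closes the path
      -- through its head. The moves contribute 2 * e edges and the petal q₀ + 2.
      link-path : ∀ {x} → x ∈ objs → ∀ e bound → bound + 2 + 2 * e ≤ W → Linked (2 + q₀ + 2 * e) (leaf x short) (leaf x long) bound
      link-path {x} x∈ e bound room F F≤
        with Moves.advances W W<L MW<d (replicate e short) x∈ (leaf x long ∷ leaf x short ∷ F)
               (≤-trans (+-mono-≤ (≤-trans (s≤s (s≤s F≤)) (≤-reflexive (+-comm 2 bound))) (≤-reflexive (cong (2 *_) (length-replicate e)))) room)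
      ... | y , xs , y∈ , walk , xs-len , xs-uniq , _ , xs-out
        with petal-avoiding y∈ (xs short ++ leaf x long ∷ leaf x short ∷ F) (≤-<-trans F₂≤ W<L)
        where
        occ : ∀ e′ → occurrences short (replicate e′ short) ≡ e′
        occ zero = refl
        occ (suc e′) = cong suc (occ e′)
        F₂≤ : length (xs short ++ leaf x long ∷ leaf x short ∷ F) ≤ W
        F₂≤ = begin
          length (xs short ++ leaf x long ∷ leaf x short ∷ F) ≡⟨ length-++ (xs short) ⟩
          length (xs short) + (2 + length F)   ≡⟨ cong (_+ (2 + length F)) (trans (xs-len short) (cong (2 *_) (occ e))) ⟩
          2 * e + (2 + length F)               ≤⟨ +-monoʳ-≤ (2 * e) (s≤s (s≤s F≤)) ⟩
          2 * e + (2 + bound)                  ≡⟨ solve 2 (λ a b → a :+ (con 2 :+ b) := b :+ con 2 :+ a) refl (2 * e) bound ⟩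
          bound + 2 + 2 * e                    ≤⟨ room ⟩
          W                                    ∎
          where open ≤-Reasoning
      ...   | z , z∈ , z-leaf , z-out = xs short ++ (hd ∷ inner) , path , len , uniq , out
        where
        hd = at z long 0
        inner = upList (at z long) q₀
        F₁ = leaf x long ∷ leaf x short ∷ F
        occ : ∀ e′ → occurrences short (replicate e′ short) ≡ e′
        occ zero = refl
        occ (suc e′) = cong suc (occ e′)
        occ-long : ∀ e′ → occurrences long (replicate e′ short) ≡ 0
        occ-long zero = refl
        occ-long (suc e′) = occ-long e′
        long-same : leaf z long ≡ leaf x long
        long-same = trans (z-leaf long) (sym (path-nil (walk long) (trans (xs-len long) (cong (2 *_) (occ-long e)))))
        path : IPath (leaf x short) (xs short ++ (hd ∷ inner)) (leaf x long)
        path = walk short ⊕ ([ subst₂ _~_ (z-leaf short) (head z∈ short long) (~-sym (adj z∈ short z≤n)) ]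
                 ⊙ subst (IPath hd inner) long-same (up-path (at z long) q₀ (adj z∈ long)))
        len : suc (length (xs short ++ (hd ∷ inner))) ≡ 2 + q₀ + 2 * e
        len = trans (cong suc (trans (length-++ (xs short)) (cong₂ _+_ (trans (xs-len short) (cong (2 *_) (occ e))) (cong suc (length-upList (at z long) q₀)))))
                (solve 2 (λ a b → con 1 :+ (a :+ (con 1 :+ b)) := con 2 :+ b :+ a) refl (2 * e) q₀)
        same-r : ∀ {a b} → a ≤ q₀ → b ≤ q₀ → at z long a ≡ at z long b → a ≡ b
        same-r a≤ b≤ eq with inj z∈ (m≤n⇒m≤1+n a≤) (m≤n⇒m≤1+n b≤) eq
        ... | inj₁ (refl , refl) = refl
        ... | inj₂ (_ , r) = r
        back-out : ∀ {v} → v ∈ hd ∷ inner → v ∉ xs short ++ F₁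
        back-out (here refl) = z-out long z≤n
        back-out (there v∈) with ∈-upList (at z long) q₀ v∈
        ... | r , lt , refl = z-out long lt
        uniq : Unique (xs short ++ (hd ∷ inner))
        uniq = UniqueP.++⁺ (xs-uniq short)
          (All.tabulate (λ v∈ eq → let r , lt , e′ = ∈-upList (at z long) q₀ v∈ in case same-r z≤n lt (trans eq e′) of λ ())
            ∷ upList-unique (at z long) q₀ same-r)
          λ { (p , p′) → back-out p′ (∈-++⁺ˡ p) }
        out : ∀ {v} → v ∈ xs short ++ (hd ∷ inner) → v ∉ F
        out v∈ v∈F with ∈-++⁻ (xs short) v∈
        ... | inj₁ p = xs-out p (there (there v∈F))
        ... | inj₂ p = back-out p (∈-++⁺ʳ (xs short) (there (there v∈F)))

      TailMoved : Obj → V → Set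
      TailMoved x v = ∃ λ y → y ∈ objs × at y long q₀ ≡ v × at y short 0 ≡ at x short 0

      abstract
        -- The auxiliary bipartite graph for Kővári-Sós-Turán: long ends against short ends.
        E : V → V → Set
        E z b = Any (λ x → leaf x long ≡ z × leaf x short ≡ b) objs

        E? : ∀ z b → Dec (E z b)
        E? z b = Any.any? (λ x → (leaf x long ≟ z) ×-dec (leaf x short ≟ b)) objs

        E-intro : ∀ {x z b} → x ∈ objs → leaf x long ≡ z → leaf x short ≡ b → E z b
        E-intro x∈ e e′ = lose x∈ (e , e′)

        E-elim : ∀ {z b} → E z b → ∃ λ x → x ∈ objs × leaf x long ≡ z × leaf x short ≡ b
        E-elim = find

      E-linked : ∀ {z b} → E z b → ∀ e bound → bound + 2 + 2 * e ≤ W → Linked (2 + q₀ + 2 * e) b z bound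
      E-linked ez e bound room with E-elim ez
      ... | x , x∈ , refl , refl = link-path x∈ e bound room

      -- The short leg is a single edge, so all vertices to which its end can be moved are
      -- neighbours of the head. As a vertex has at most D neighbours, a constant multiple of β,
      -- this is the positive density that Kővári-Sós-Turán needs.
      E-neighbours : ∀ {β} → 0 < M → M * β ≤ d → ∀ {x} → x ∈ objs → β ≤ #[ E? (leaf x long) ] (nbrs (at x short 0))
      E-neighbours M>0 Mβ≤ {x} x∈ with move x∈ short
      ... | bs , u , many , ext = ≤-trans (*-cancelˡ-≤ M {{>-nonZero M>0}} (≤-trans Mβ≤ many))
        (⊆⇒length≤ u λ {b} b∈ → let y , y∈ , e , same = ext b∈ in
          ∈-filter⁺ (E? (leaf x long)) (∈-nbrs (subst₂ _~_ (same short z≤n (λ ())) e (adj y∈ short z≤n)))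
            (E-intro y∈ (same long ≤-refl (λ ())) e))

      module Dense {D K′ β s k bound : ℕ} (m : ℕ) (deg≤ : ∀ v → deg G v ≤ D) (M>0 : 0 < M) (β>0 : 0 < β) (Mβ≤d : M * β ≤ d)
        (D≤ : D ≤ K′ * M * β) (room : suc bound + s * k + 3 + 2 * k ≤ W) where

        nbrs≤ : ∀ v → length (nbrs v) ≤ D
        nbrs≤ v = ≤-trans (≤-reflexive (sym (deg≡length-nbrs v))) (deg≤ v)

        sparse-enough : ∀ v c q → 2 * q * (K′ * M) ≤ c → 2 * (length (nbrs v) * q) ≤ c * β
        sparse-enough v c q le = begin
          2 * (length (nbrs v) * q)   ≤⟨ *-monoʳ-≤ 2 (*-monoˡ-≤ q (≤-trans (nbrs≤ v) D≤)) ⟩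
          2 * (K′ * M * β * q)        ≡⟨ solve 3 (λ a b q → con 2 :* (a :* b :* q) := con 2 :* q :* a :* b) refl (K′ * M) β q ⟩
          2 * q * (K′ * M) * β        ≤⟨ *-monoˡ-≤ β le ⟩
          c * β                       ∎
          where open ≤-Reasoning

        record Bipartite (q : ℕ) : Set where
          field
            as bs : List V
            as-unique : Unique as
            bs-unique : Unique bs
            as-many : q ≤ length as
            bs-many : β ≤ 2 * (2 ^ m * length bs)
            joined : ∀ {a b} → a ∈ as → b ∈ bs → E a b

        -- The rows come from moving the long end of one object, which keeps the head, so their
        -- partners lie in one neighbourhood. Only m rows are used, a constant; hence the loss of
        -- 2^m in the number of columns is constant too.
        bipartite : 0 < m → M * m ≤ d → ∀ q → 2 * q * (K′ * M) ≤ m → Bipartite q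
        bipartite m>0 Mm≤ q q≤ = build (proj₂ nonempty) (move (proj₂ nonempty) long)
          where
          build : ∀ {x} → x ∈ objs → Abundant d M (Moved x long) → Bipartite q
          build {x} x∈ (zs , u , many , ext) = collect (kst _≟_ E? is U β q (Unique-take m u) (nbrs-unique (at x short 0))
            (subst (0 <_) (sym len) m>0) β>0 dense (sparse-enough (at x short 0) (length is) q (subst (_ ≤_) (sym len) q≤)))
            where
            is = take m zs
            U = nbrs (at x short 0)
            len : length is ≡ m
            len = length-take≤ m zs (*-cancelˡ-≤ M {{>-nonZero M>0}} (≤-trans Mm≤ many))
            dense : ∀ {z} → z ∈ is → β ≤ #[ E? z ] U
            dense {z} z∈ = from (ext (∈-take m zs z∈))
              where
              from : Moved x long z →
                     β ≤ #[ E? z ] U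
              from (y , y∈ , e , same) = subst₂ (λ z w → β ≤ #[ E? z ] (nbrs w)) e (same short z≤n (λ ())) (E-neighbours M>0 Mβ≤d y∈)
            collect : Biclique E is β q → Bipartite q
            collect (as , bs , ua , ub , qa , βb , _ , j) = record
              { as = as ; bs = bs ; as-unique = ua ; bs-unique = ub ; as-many = qa
              ; bs-many = subst (λ l → β ≤ 2 * (2 ^ l * length bs)) len βb ; joined = j }

        many-from : ∀ {c t l} → 2 * (2 ^ c * t) ≤ β → β ≤ 2 * (2 ^ c * l) → t ≤ l
        many-from {c} {t} {l} lo hi = *-cancelˡ-≤ (2 ^ c) {{>-nonZero (m^n>0 2 c)}} (*-cancelˡ-≤ 2 (≤-trans lo hi))

        even-link : 0 < m → M * m ≤ d → 2 * suc bound * (K′ * M) ≤ m → 2 * (2 ^ m * s) ≤ β →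
          ∀ e → e ≤ k → k ≡ 2 + q₀ + 2 * e → Anchored s k bound
        even-link m>0 Mm≤ m≥ s≤ e e≤ k≡ =
          let ys , ys-inj , ys∈ = list⇒family bs-unique (many-from {m} s≤ bs-many)
          in ys , ys-inj , linked-robust ys as as-unique as-many λ i h∈ →
               subst (λ k′ → Linked k′ (ys i) _ bound₁) (sym k≡) (E-linked (joined h∈ (ys∈ i)) e bound₁ room₁)
          where
          open Bipartite (bipartite m>0 Mm≤ (suc bound) m≥)
          bound₁ = suc bound + s * k
          room₁ : bound₁ + 2 + 2 * e ≤ W
          room₁ = ≤-trans (+-mono-≤ (+-monoʳ-≤ bound₁ (n≤1+n 2)) (*-monoʳ-≤ 2 e≤)) room

        private
          bound₁ Q : ℕ
          bound₁ = suc bound + s * k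
          Q = suc bound₁

        -- Here the objects are paths of length two, and the heads of the petals between h and b are
        -- distinct common neighbours of h and b.
        hub : q₀ ≡ 0 → ∀ {h b} → E h b → L ≤ #[ ~? b ] (nbrs h)
        hub q₀≡0 {h} {b} ehb = from (E-elim ehb)
          where
          from : (∃ λ x → x ∈ objs × leaf x long ≡ h × leaf x short ≡ b) → L ≤ #[ ~? b ] (nbrs h)
          from (x , x∈ , eh , eb) = count (petals x∈)
            where
            count : (∃ λ ps → L ≤ length ps × (∀ {y} → y ∈ ps → y ∈ objs × (∀ i → leaf y i ≡ leaf x i)) × AllPairs Separate ps) →
                    L ≤ #[ ~? b ] (nbrs h)
            count (ps , many , good , sep) = ≤-trans many (≤-trans (≤-reflexive (sym (length-map hd ps)))
                (⊆⇒length≤ (APP.map⁺ (AP.map (λ sp → sp z≤n z≤n) sep)) λ v∈ → mem (∈-map⁻ hd v∈)))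
              where
              hd = λ y → at y long 0
              mem : ∀ {v} → (∃ λ y → y ∈ ps × v ≡ hd y) → v ∈ filter (~? b) (nbrs h)
              mem (y , y∈ps , refl) = ∈-filter⁺ (~? b)
                (∈-nbrs (~-sym (subst (hd y ~_) (trans (proj₂ (good y∈ps) long) eh)
                  (subst (λ r → hd y ~ at y long (suc r)) (sym q₀≡0) (adj (proj₁ (good y∈ps)) long z≤n)))))
                (~-sym (subst₂ _~_ (head (proj₁ (good y∈ps)) short long) (trans (proj₂ (good y∈ps) short) eb) (adj (proj₁ (good y∈ps)) short z≤n)))

        -- A vertex x with many neighbours b among the common partners of the a's serves as a leaf: go from x to b, then to a.
        odd-link₂ : q₀ ≡ 0 → 0 < m → M * m ≤ d → 2 * suc (suc bound) * (K′ * M) ≤ m → s + K′ * M * Q * (2 * 2 ^ m) ≤ L →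
          ∀ e → e ≤ k → k ≡ 3 + q₀ + 2 * e → Anchored s k bound
        odd-link₂ q₀≡0 m>0 Mm≤ m≥ L≥ e e≤ k≡ = go as as-unique as-many joined
          where
          open Bipartite (bipartite m>0 Mm≤ (suc (suc bound)) m≥)
          l = length bs
          g : V → ℕ
          g x = #[ (λ b → ~? b x) ] bs
          wide? = λ x → Q ≤? g x
          l>0 : 0 < l
          l>0 = positive l bs-many
            where
            positive : ∀ r → β ≤ 2 * (2 ^ m * r) → 0 < r
            positive zero le = ⊥-elim (<⇒≱ β>0 (≤-trans le (≤-reflexive (cong (2 *_) (*-zeroʳ (2 ^ m))))))
            positive (suc r) _ = s≤s z≤n
          room₁ : suc bound₁ + 2 + 2 * e ≤ W
          room₁ = ≤-trans (+-mono-≤ (≤-reflexive (sym (+-suc bound₁ 2))) (*-monoʳ-≤ 2 e≤)) room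
          go : ∀ as → Unique as → suc (suc bound) ≤ length as → (∀ {a b} → a ∈ as → b ∈ bs → E a b) → Anchored s k bound
          -- One of the a's is spent as the vertex whose neighbours are the candidates for x; the
          -- other ones serve as heads. This explains suc (suc bound).
          go (h₀ ∷ hs) (_ ∷ uhs) (s≤s many) joined =
            let xs , xs-inj , xs∈ = list⇒family (Unique-filter wide? (nbrs-unique h₀)) enough
            in xs , xs-inj , linked-robust xs hs uhs many λ i h∈ →
                 link (xs i) (proj₂ (∈-filter⁻ wide? {xs = nbrs h₀} (xs∈ i))) (joined (there h∈))
            where
            gx = filter wide? (nbrs h₀)
            counted : l * L ≤ length gx * l + length (nbrs h₀) * Q
            counted = begin
              l * L                               ≡⟨ sym (∑-const bs L) ⟩
              ∑ bs (λ _ → L)                      ≤⟨ ∑-mono bs (λ b∈ → hub q₀≡0 (joined (here refl) b∈)) ⟩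
              ∑ bs (λ b → #[ ~? b ] (nbrs h₀))    ≡⟨ double-counting ~? bs (nbrs h₀) ⟩
              ∑ (nbrs h₀) g                       ≤⟨ ∑-rich (nbrs h₀) g Q l (λ {x} _ → length-filter (λ b → ~? b x) bs) ⟩
              length gx * l + length (nbrs h₀) * Q ∎
              where open ≤-Reasoning
            -- `bs-many` makes the degree of h₀ at most a constant multiple of l. So the x with
            -- fewer than `Q` neighbours among the b's use up only a constant number of the common
            -- neighbours per b, and L exceeds this constant by s.
            enough : s ≤ length gx
            enough = +-cancelʳ-≤ (K′ * M * Q * (2 * 2 ^ m)) s (length gx) (≤-trans L≥ (*-cancelˡ-≤ l {{>-nonZero l>0}} (begin
              l * L                               ≤⟨ counted ⟩
              length gx * l + length (nbrs h₀) * Q ≤⟨ +-monoʳ-≤ (length gx * l) (*-monoˡ-≤ Q (≤-trans (nbrs≤ h₀) (≤-trans D≤ (*-monoʳ-≤ (K′ * M) bs-many)))) ⟩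
              length gx * l + K′ * M * (2 * (2 ^ m * l)) * Q
                ≡⟨ solve 5 (λ g l km p q → g :* l :+ km :* (con 2 :* (p :* l)) :* q := l :* (g :+ km :* q :* (con 2 :* p))) refl (length gx) l (K′ * M) (2 ^ m) Q ⟩
              l * (length gx + K′ * M * Q * (2 * 2 ^ m)) ∎)))
              where open ≤-Reasoning
            link : ∀ x → Q ≤ g x → ∀ {h} → (∀ {b} → b ∈ bs → E h b) → Linked k x h bound₁
            link x wide {h} ehb F F≤ = via (avoid _≟_ {filter (λ b → ~? b x) bs} {F} (Unique-filter (λ b → ~? b x) bs-unique) (≤-trans (s≤s F≤) wide))
              where
              via : (∃ λ b → b ∈ filter (λ b → ~? b x) bs × b ∉ F) →
                    Detour k x h F
              via (b , b∈ , b∉) =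
                let b∈bs , b~x = ∈-filter⁻ (λ b → ~? b x) {xs = bs} b∈
                    xs , p , len , u , out = E-linked (ehb b∈bs) e (suc bound₁) room₁ (b ∷ F) (s≤s F≤)
                in b ∷ xs , ~-sym b~x ∷ p , trans (cong suc len) (sym k≡)
                   , All.tabulate (λ v∈ e′ → out v∈ (here (sym e′))) ∷ u
                   , λ { (here refl) → b∉ ; (there v∈) → out v∈ ∘ there }

        -- Two rounds of moves around one head w: first the neighbour h of the long end, then for
        -- each h the long end z. Kővári-Sós-Turán is applied with the pairs (h, z) as rows and the
        -- neighbours of w as columns. The h become heads and the surviving columns become branch
        -- vertices; a path from b to z is prolonged by the edge from z to h, with at least `Q`
        -- choices of z.
        odd-link₃ : (∀ {x} → x ∈ objs → Abundant d M (TailMoved x)) → 1 ≤ q₀ →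
          0 < m → M * m ≤ d → 2 * (suc bound + Q) * (K′ * M) ≤ m → 2 * (2 ^ (m * m) * s) ≤ β →
          ∀ e → e ≤ k → k ≡ 3 + q₀ + 2 * e → Anchored s k bound
        odd-link₃ move₂ q₀≥1 m>0 Mm≤ m≥ s≤ e e≤ k≡ = first (proj₂ nonempty)
          where
          take-m : ∀ {vs : List V} → d ≤ M * length vs → length (take m vs) ≡ m
          take-m {vs} many = length-take≤ m vs (*-cancelˡ-≤ M {{>-nonZero M>0}} (≤-trans Mm≤ many))
          room₁ : suc bound₁ + 2 + 2 * e ≤ W
          room₁ = ≤-trans (+-mono-≤ (≤-reflexive (sym (+-suc bound₁ 2))) (*-monoʳ-≤ 2 e≤)) room
          Good : V → V → V → Set
          Good w h z = h ~ z × β ≤ #[ E? z ] (nbrs w)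

          children : ∀ {x} → x ∈ objs → Exactly m (Good (at x short 0) (at x long q₀))
          children {x} x∈ = from (move x∈ long)
            where
            from : Abundant d M (Moved x long) →
                   Exactly m (Good (at x short 0) (at x long q₀))
            from (vs , u , many , ext) = take m vs , Unique-take m u , take-m many , λ z∈ → good (ext (∈-take m vs z∈))
              where
              good : ∀ {z} → Moved x long z →
                     Good (at x short 0) (at x long q₀) z
              good (y , y∈ , refl , same) =
                subst (_~ leaf y long) (same long (n≤1+n q₀) (λ z → 1+n≢n (sym (proj₂ z)))) (adj y∈ long ≤-refl)
                , subst (λ w → β ≤ #[ E? (leaf y long) ] (nbrs w)) (same short z≤n (λ ())) (E-neighbours M>0 Mβ≤d y∈)

          first : ∀ {x} → x ∈ objs → Anchored s k bound
          first {x} x∈ = second (move₂ x∈)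
            where
            w = at x short 0
            second : Abundant d M (TailMoved x) → Anchored s k bound
            second (vs , u , many , ext) = third (kst (×P.≡-dec _≟_ _≟_) (λ p b → E? (proj₂ p) b) pairs (nbrs w) β ((suc bound + Q) * m)
                unique (nbrs-unique w) (subst (0 <_) (sym total′) (*-mono-≤ m>0 m>0)) β>0
                (λ p∈ → proj₂ (proj₂ (sound p∈)))
                (sparse-enough w (length pairs) ((suc bound + Q) * m) (≤-trans (≤-reflexive (solve 3 (λ a m c → con 2 :* (a :* m) :* c := con 2 :* a :* c :* m) refl (suc bound + Q) m (K′ * M)))
                   (≤-trans (*-monoˡ-≤ m m≥) (≤-reflexive (sym total′))))))
              where
              hs = take m vs
              rows : ∀ {h} → h ∈ hs → Exactly m (Good w h)
              rows {h} h∈ = from (ext (∈-take m vs h∈))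
                where
                from : TailMoved x h → Exactly m (Good w h)
                from (y , y∈ , e₁ , e₂) = subst₂ (λ w h → Exactly m (Good w h)) e₂ e₁ (children y∈)
              uhs : Unique hs
              uhs = Unique-take m u
              open Fibred (fibred _≟_ {m} {Good w} uhs rows)
              total′ : length pairs ≡ m * m
              total′ = trans total (cong (_* m) (take-m many))
              third : Biclique (λ p b → E (proj₂ p) b) pairs β ((suc bound + Q) * m) → Anchored s k bound
              third (ps , bs , ups , ubs , ps-many , bs-many , sub , joined) =
                let ys , ys-inj , ys∈ = list⇒family ubs (many-from {m * m} s≤ (subst (λ l → β ≤ 2 * (2 ^ l * length bs)) total′ bs-many))
                in ys , ys-inj , linked-robust ys heads (Unique-filter head? uhs) heads-many λ i h∈ →
                     link (ys i) (proj₂ (∈-filter⁻ head? {xs = hs} h∈)) (λ p∈ → joined p∈ (ys∈ i))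
                where
                head? = λ h → Q ≤? #[ fibre? _≟_ h ] ps
                heads = filter head? hs
                -- The h with fewer than `Q` pairs use up at most m * Q of the (suc bound + Q) * m
                -- pairs, and any other h has at most m of the rest.
                heads-many : suc bound ≤ length heads
                heads-many = *-cancelʳ-≤ (suc bound) (length heads) m {{>-nonZero m>0}} (+-cancelʳ-≤ (m * Q) _ _ (begin
                  suc bound * m + m * Q           ≡⟨ solve 3 (λ b q m → b :* m :+ m :* q := (b :+ q) :* m) refl (suc bound) Q m ⟩
                  (suc bound + Q) * m             ≤⟨ ps-many ⟩
                  length ps                       ≤⟨ cover-∑ (λ p h → fibre? _≟_ h p) ps hs (λ p∈ → _ , proj₁ (sound (sub p∈)) , refl) ⟩
                  ∑ hs (λ h → #[ fibre? _≟_ h ] ps) ≤⟨ ∑-rich hs (λ h → #[ fibre? _≟_ h ] ps) Q m (λ {h} _ → cap h) ⟩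
                  length heads * m + length hs * Q ≡⟨ cong (λ l → length heads * m + l * Q) (take-m many) ⟩
                  length heads * m + m * Q        ∎))
                  where
                  open ≤-Reasoning
                  cap : ∀ h → #[ fibre? _≟_ h ] ps ≤ m
                  cap h = ≤-trans (⊆⇒length≤ (Unique-filter (fibre? _≟_ h) ups) λ p∈ →
                    let p∈ps , eq = ∈-filter⁻ (fibre? _≟_ h) {xs = ps} p∈ in ∈-filter⁺ (fibre? _≟_ h) (sub p∈ps) eq) (fibres h)
                link : ∀ y {h} → Q ≤ #[ fibre? _≟_ h ] ps → (∀ {p} → p ∈ ps → E (proj₂ p) y) → Linked k y h bound₁
                link y {h} wide ezy F F≤ = via (avoid _≟_ {map proj₂ fib} {F} (ufib (Unique-filter (fibre? _≟_ h) ups) (λ p∈ → proj₂ (∈-filter⁻ (fibre? _≟_ h) {xs = ps} p∈)))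
                    (≤-trans (s≤s F≤) (≤-trans wide (≤-reflexive (sym (length-map proj₂ fib))))))
                  where
                  fib = filter (fibre? _≟_ h) ps
                  ufib : ∀ {l : List (V × V)} → Unique l → (∀ {p} → p ∈ l → proj₁ p ≡ h) → Unique (map proj₂ l)
                  ufib [] _ = []
                  ufib {p ∷ l} (p∉ ∷ ul) same = All.tabulate (λ v∈ e′ → let p′ , p′∈ , e″ = ∈-map⁻ proj₂ v∈ in
                    All.lookup p∉ p′∈ (cong₂ _,_ (trans (same (here refl)) (sym (same (there p′∈)))) (trans e′ e″))) ∷ ufib ul (same ∘ there)
                  via : (∃ λ z → z ∈ map proj₂ fib × z ∉ F) →
                        Detour k y h F
                  via (z , z∈ , z∉) = from (∈-map⁻ proj₂ z∈)
                    where
                    from : (∃ λ p → p ∈ fib × z ≡ proj₂ p) →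
                           Detour k y h F
                    from (p , p∈ , refl) =
                      let p∈ps , eq = ∈-filter⁻ (fibre? _≟_ h) {xs = ps} p∈
                          h~z = subst (_~ z) eq (proj₁ (proj₂ (sound (sub p∈ps))))
                          -- In `linked-robust` the head h belongs to the forbidden list F, so the
                          -- path to z does not run through h.
                          xs , pth , len , u , out = E-linked (ezy p∈ps) e (suc bound₁) room₁ (z ∷ F) (s≤s F≤)
                      in xs ++ z ∷ [] , pth ⊙ [ ~-sym h~z ]
                         , trans (cong suc (trans (length-++ xs) (+-comm (length xs) 1))) (trans (cong suc len) (sym k≡))
                         , UniqueP.++⁺ u ([] ∷ []) (λ { (v∈ , here refl) → out v∈ (here refl) })
                         , λ v∈ v∈F → case ∈-++⁻ xs v∈ of λ { (inj₁ q) → out q (there v∈F) ; (inj₂ (here refl)) → z∉ v∈F }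

-- Families from packings

AllPairs-related : ∀ {A : Set} {R : A → A → Set} {b x y} → AllPairs R b → x ∈ b → y ∈ b → x ≡ y ⊎ R x y ⊎ R y x
AllPairs-related (r ∷ rs) (here refl) (here refl) = inj₁ refl
AllPairs-related (r ∷ rs) (here refl) (there y∈) = inj₂ (inj₁ (All.lookup r y∈))
AllPairs-related (r ∷ rs) (there x∈) (here refl) = inj₂ (inj₂ (All.lookup r x∈))
AllPairs-related (r ∷ rs) (there x∈) (there y∈) = AllPairs-related rs x∈ y∈

map-∈-≡ : ∀ {A B : Set} {f g : A → B} xs → map f xs ≡ map g xs → ∀ {x} → x ∈ xs → f x ≡ g x
map-∈-≡ (x ∷ xs) e (here refl) = ∷-injectiveˡ e
map-∈-≡ (x ∷ xs) e (there x∈) = map-∈-≡ xs (∷-injectiveʳ e) x∈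

map-≡ : ∀ {A B : Set} {f g : A → B} xs → (∀ {x} → x ∈ xs → f x ≡ g x) → map f xs ≡ map g xs
map-≡ [] e = refl
map-≡ (x ∷ xs) e = cong₂ _∷_ (e (here refl)) (map-≡ xs (e ∘ there))

keyOff : ∀ {n N} → List (Fin N) → Vec (Fin n) N → List ℕ
keyOff {N = N} U h = map (λ p → toℕ (Vec.lookup h p)) (filter (λ p → ¬? (p ∈F? U)) (allFin N))

keyOff⇒Agree : ∀ {n N} (U : List (Fin N)) (x y : Vec (Fin n) N) → keyOff U x ≡ keyOff U y → Agree U x y
keyOff⇒Agree U x y e p p∉ = toℕ-injective (map-∈-≡ _ e (∈-filter⁺ (λ p → ¬? (p ∈F? U)) (∈-allFin p) p∉))

Agree⇒keyOff : ∀ {n N} (U : List (Fin N)) (x y : Vec (Fin n) N) → Agree U x y → keyOff U x ≡ keyOff U y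
Agree⇒keyOff {N = N} U x y a = map-≡ _ λ p∈ → cong toℕ (a _ (proj₂ (∈-filter⁻ (λ p → ¬? (p ∈F? U)) {xs = allFin N} p∈)))

module SpiderFamilies {n : ℕ} (G : Graph n) where
  open Families G public
  open Sunflowers {n} public

  module Legs {s : ℕ} (q : Fin (suc s) → ℕ) where

    js : Vec ℕ (suc s)
    js = tabulate (suc ∘ q)

    T : Tree (size js)
    T = spider js

    js-lookup : ∀ i → Vec.lookup js i ≡ suc (q i)
    js-lookup = lookup∘tabulate (suc ∘ q)

    ≤js : ∀ {i r} → r ≤ suc (q i) → r ≤ Vec.lookup js i
    ≤js {i} le = ≤-trans le (≤-reflexive (sym (js-lookup i)))

    P : Fin (suc s) → ℕ → Fin (suc (size js))
    P = pos js

    P-edge : ∀ i {r} → r ≤ q i → Edge T (P i (suc r)) (P i r)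
    P-edge i le = pos-edge js i (≤js {i} (s≤s le))

    P-inj : ∀ i i′ {r r′} → r ≤ suc (q i) → r′ ≤ suc (q i′) → P i r ≡ P i′ r′ → SamePlace i r i′ r′
    P-inj i i′ le le′ = pos-injective js i i′ (≤js {i} le) (≤js {i′} le′)

    P-edge-cover : ∀ a b → Edge T a b → ∃₂ λ i r → r ≤ q i × a ≡ P i (suc r) × b ≡ P i r
    P-edge-cover a b ed with edge-cover js a b ed
    ... | i , r , lt , ea , eb = i , r , ≤-pred (≤-trans lt (≤-reflexive (js-lookup i))) , ea , eb

    end : Fin (suc s) → Fin (suc (size js))
    end i = P i (suc (q i))

    open Inner js (λ i → ≤-trans (s≤s z≤n) (≤-reflexive (sym (js-lookup i)))) public using (inner; inner-length)
    private module In = Inner js (λ i → ≤-trans (s≤s z≤n) (≤-reflexive (sym (js-lookup i))))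

    P∈inner : ∀ i {r} → r ≤ q i → P i r ∈ inner
    P∈inner i le = In.pos∈inner i (≤-trans (s≤s le) (≤-reflexive (sym (js-lookup i))))

    end∉inner : ∀ i → end i ∉ inner
    end∉inner i = subst (λ r → P i r ∉ inner) (js-lookup i) (In.end∉inner i)

    inner-P : ∀ {p} → p ∈ inner → ∃₂ λ i r → r ≤ q i × p ≡ P i r
    inner-P p∈ with In.inner-pos p∈
    ... | i , r , lt , e = i , r , ≤-pred (≤-trans lt (≤-reflexive (js-lookup i))) , e

    ∉inner-end : ∀ {p} → p ∉ inner → ∃ λ i → p ≡ end i
    ∉inner-end p∉ with In.∉inner-end p∉
    ... | i , e = i , trans e (cong (P i) (js-lookup i))

    petal-irr : ∀ (x : Vec V (suc (size js))) → ¬ Petal inner x x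
    petal-irr x (_ , ap) = ap _ _ (P∈inner zero z≤n) (P∈inner zero z≤n) refl

    Ω : List (Vec V (suc (size js)))
    Ω = embeddings T

    -- A class of `leafKey` varies only the end of leg i; a class of `tailKey` varies its last two
    -- vertices, for the first round of moves in `odd-link₃`.
    leafKey tailKey : Fin (suc s) → Vec V (suc (size js)) → List ℕ
    leafKey i = keyOff (end i ∷ [])
    tailKey i = keyOff (end i ∷ P i (q i) ∷ [])

    keys : List (Vec V (suc (size js)) → List ℕ)
    keys = map leafKey (allFin (suc s)) ++ map tailKey (allFin (suc s))

    length-keys : length keys ≡ suc s + suc s
    length-keys = trans (length-++ (map leafKey (allFin (suc s)))) (cong₂ _+_
      (trans (length-map leafKey (allFin (suc s))) (length-allFin (suc s))) (trans (length-map tailKey (allFin (suc s))) (length-allFin (suc s))))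

    update-inj : ∀ (x : Vec V (suc (size js))) p v → IsInj x → v ∉ Vec.toList x → IsInj (x [ p ]≔ v)
    update-inj x p v inj v∉ {a} {b} e with a ≟ p | b ≟ p
    ... | yes refl | yes refl = refl
    ... | yes refl | no b≢ = ⊥-elim (v∉ (subst (_∈ Vec.toList x)
            (sym (trans (sym (lookup∘update p x v)) (trans e (lookup∘update′ b≢ x v)))) (∈-toList x b)))
    ... | no a≢ | yes refl = ⊥-elim (v∉ (subst (_∈ Vec.toList x)
            (trans (sym (lookup∘update′ a≢ x v)) (trans e (lookup∘update p x v))) (∈-toList x a)))
    ... | no a≢ | no b≢ = inj (trans (sym (lookup∘update′ a≢ x v)) (trans e (lookup∘update′ b≢ x v)))

    fresh-~ : ∀ (x : Vec V (suc (size js))) {v u} → u ∈ fresh x v → v ~ u × u ∉ Vec.toList x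
    fresh-~ x {v} u∈ = let a , b = ∈-filter⁻ (λ u → ¬? (u ∈F? Vec.toList x)) {xs = nbrs v} u∈ in nbrs-~ a , b

    -- The edge at the end of leg i is exempt: in `tail-class` the vertex before the end is changed
    -- first, which may break that edge until the end is replaced.
    HomOffEnd : Fin (suc s) → Vec V (suc (size js)) → Set
    HomOffEnd i x = ∀ i′ r → r ≤ q i′ → P i′ (suc r) ≢ end i → Vec.lookup x (P i′ (suc r)) ~ Vec.lookup x (P i′ r)

    P≢end : ∀ i i′ {r} → r ≤ q i′ → P i′ r ≢ end i
    P≢end i i′ le e with P-inj i′ i (m≤n⇒m≤1+n le) ≤-refl e
    ... | inj₁ (_ , ())
    ... | inj₂ (refl , refl) = 1+n≰n le

    update-embedding : ∀ x i v → IsInj x → HomOffEnd i x → v ∈ fresh x (Vec.lookup x (P i (q i))) → x [ end i ]≔ v ∈ Ω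
    update-embedding x i v inj hom v∈ = embeddings-complete T _ (λ {a} {b} → hom′ a b) (update-inj x (end i) v inj (proj₂ (fresh-~ x v∈)))
      where
      x′ = x [ end i ]≔ v
      keep : ∀ {p} → p ≢ end i → Vec.lookup x′ p ≡ Vec.lookup x p
      keep ne = lookup∘update′ ne x v
      go : ∀ i′ r → r ≤ q i′ → Vec.lookup x′ (P i′ (suc r)) ~ Vec.lookup x′ (P i′ r)
      go i′ r le with P i′ (suc r) ≟ end i
      ... | no ne = subst₂ _~_ (sym (keep ne)) (sym (keep (P≢end i i′ le))) (hom i′ r le ne)
      ... | yes e with P-inj i′ i (s≤s le) ≤-refl e
      ...   | inj₂ (refl , refl) = subst₂ _~_ (sym (lookup∘update (end i) x v)) (sym (keep (P≢end i i′ le))) (~-sym (proj₁ (fresh-~ x v∈)))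
      hom′ : ∀ a b → Edge T a b → Vec.lookup x′ a ~ Vec.lookup x′ b
      hom′ a b ed with P-edge-cover a b ed
      ... | i′ , r , le , refl , refl = go i′ r le

    Ω⇒HomOffEnd : ∀ {x} i → x ∈ Ω → HomOffEnd i x
    Ω⇒HomOffEnd i x∈ i′ r le _ = embeddings-hom T x∈ (P-edge i′ le)

    module _ {d E : ℕ} (deg≥ : ∀ v → d + suc E ≤ deg G v) (size≤ : size js ≤ E) where

      leaf-class : ∀ x i → IsInj x → HomOffEnd i x → d ≤ class (leafKey i) x Ω
      leaf-class x i inj hom = ≤-trans (fresh-count deg≥ x (Vec.lookup x (P i (q i))) (s≤s size≤))
        (≤-trans (≤-reflexive (sym (length-map upd fs))) (⊆⇒length≤
          (UniqueP.map⁺ (λ {v} {v′} e → trans (sym (lookup∘update (end i) x v)) (trans (cong (λ h → Vec.lookup h (end i)) e) (lookup∘update (end i) x v′)))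
             (Unique-filter (λ u → ¬? (u ∈F? Vec.toList x)) (nbrs-unique (Vec.lookup x (P i (q i))))))
          λ h∈ → mem (∈-map⁻ upd h∈)))
        where
        upd : V → Vec V (suc (size js))
        upd v = x [ end i ]≔ v
        fs = fresh x (Vec.lookup x (P i (q i)))
        mem : ∀ {h} → (∃ λ v → v ∈ fs × h ≡ upd v) → h ∈ filter (sameKey? (leafKey i) x) Ω
        mem (v , v∈ , refl) = ∈-filter⁺ (sameKey? (leafKey i) x) (update-embedding x i v inj hom v∈)
          (Agree⇒keyOff (end i ∷ []) (upd v) x λ p p∉ → lookup∘update′ (λ e → p∉ (here e)) x v)

      -- There are d choices for the vertex before the end and then d for the end; the positive q i
      -- keeps the head out of the change.
      tail-class : ∀ {x} i {q′} → q i ≡ suc q′ → x ∈ Ω → d * d ≤ class (tailKey i) x Ω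
      tail-class {x} i {q′} qi x∈ = begin
        d * d                        ≤⟨ *-monoˡ-≤ d (fresh-count deg≥ x (Vec.lookup x (P i q′)) (s≤s size≤)) ⟩
        length fs * d                ≡⟨ sym (∑-const fs d) ⟩
        ∑ fs (λ _ → d)               ≤⟨ ∑-mono fs (λ {v} v∈ → ≤-trans (leaf-class (x [ p ]≔ v) i (update-inj x p v (embeddings-inj T x∈) (proj₂ (fresh-~ x v∈))) (hom-off v∈)) (sub v∈)) ⟩
        ∑ fs (λ v → #[ (λ h → Vec.lookup h p ≟ v) ] Y)  ≡⟨ sym (double-counting (λ h v → Vec.lookup h p ≟ v) Y fs) ⟩
        ∑ Y (λ h → #[ (λ v → Vec.lookup h p ≟ v) ] fs)  ≤⟨ ∑-mono Y (λ {h} _ → all-equal⇒length≤1 (Unique-filter (λ v → Vec.lookup h p ≟ v) ufs)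
                                                            λ a∈ b∈ → trans (sym (proj₂ (∈-filter⁻ (λ v → Vec.lookup h p ≟ v) {xs = fs} a∈))) (proj₂ (∈-filter⁻ (λ v → Vec.lookup h p ≟ v) {xs = fs} b∈))) ⟩
        ∑ Y (λ _ → 1)                ≡⟨ trans (∑-const Y 1) (*-identityʳ (length Y)) ⟩
        length Y                     ∎
        where
        open ≤-Reasoning
        p = P i (q i)
        fs = fresh x (Vec.lookup x (P i q′))
        ufs : Unique fs
        ufs = Unique-filter (λ u → ¬? (u ∈F? Vec.toList x)) (nbrs-unique (Vec.lookup x (P i q′)))
        Y = filter (sameKey? (tailKey i) x) Ω
        hom-off : ∀ {v} → v ∈ fs → HomOffEnd i (x [ p ]≔ v)
        hom-off {v} v∈ i′ r le ne with P i′ (suc r) ≟ p | P i′ r ≟ p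
        ... | yes e | yes e′ = case P-inj i′ i′ (s≤s le) (m≤n⇒m≤1+n le) (trans e (sym e′)) of λ
                { (inj₂ (_ , e″)) → ⊥-elim (1+n≢n e″) }
        ... | no _ | yes e′ = ⊥-elim (case P-inj i′ i (m≤n⇒m≤1+n le) (n≤1+n (q i)) e′ of λ
                { (inj₁ (_ , z)) → case trans (sym z) qi of λ () ; (inj₂ (refl , refl)) → ne refl })
        ... | no ne₁ | no ne₂ = subst₂ _~_ (sym (lookup∘update′ ne₁ x v)) (sym (lookup∘update′ ne₂ x v)) (embeddings-hom T x∈ (P-edge i′ le))
        ... | yes e | no ne₂ = subst₂ _~_ (sym (trans (cong (Vec.lookup (x [ p ]≔ v)) e) (lookup∘update p x v)))
                (trans (cong (Vec.lookup x) (sym (parent (P-inj i′ i (s≤s le) (n≤1+n (q i)) e)))) (sym (lookup∘update′ ne₂ x v))) (~-sym (proj₁ (fresh-~ x v∈)))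
          where
          parent : SamePlace i′ (suc r) i (q i) → P i′ r ≡ P i q′
          parent (inj₂ (refl , e″)) = cong (P i) (cong pred (trans e″ qi))
        sub : ∀ {v} → v ∈ fs → class (leafKey i) (x [ p ]≔ v) Ω ≤ #[ (λ h → Vec.lookup h p ≟ v) ] Y
        sub {v} v∈ = ⊆⇒length≤ (Unique-filter (sameKey? (leafKey i) (x [ p ]≔ v)) (embeddings-unique T)) λ {h} h∈ →
          let h∈Ω , e = ∈-filter⁻ (sameKey? (leafKey i) (x [ p ]≔ v)) {xs = Ω} h∈
              agr = keyOff⇒Agree (end i ∷ []) h (x [ p ]≔ v) e
          in ∈-filter⁺ (λ h → Vec.lookup h p ≟ v) (∈-filter⁺ (sameKey? (tailKey i) x) h∈Ω
               (Agree⇒keyOff (end i ∷ p ∷ []) h x λ r r∉ → trans (agr r (λ { (here e′) → r∉ (here e′) })) (lookup∘update′ (λ e′ → r∉ (there (here e′))) x v)))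
             (trans (agr p (λ { (here e′) → P≢end i i ≤-refl e′ })) (lookup∘update p x v))

      module _ {D M L K′ : ℕ} {{_ : NonZero D}} (deg≤ : ∀ v → deg G v ≤ D) (K′>0 : 0 < K′) (d>0 : 0 < d) (D≤ : D ≤ K′ * d)
        (S : Stabilised (VecP.≡-dec _≟_) (Petal inner) M L keys Ω) where

        open Stabilised S

        private
          at : Vec V (suc (size js)) → Fin (suc s) → ℕ → V
          at h i r = Vec.lookup h (P i r)

          Class : (Vec V (suc (size js)) → List ℕ) → Vec V (suc (size js)) → List (Vec V (suc (size js)))
          Class k x = filter (sameKey? k x) core

          core-class : ∀ U x y → y ∈ Class (keyOff U) x → y ∈ core × Agree U y x
          core-class U x y y∈ = let a , e = ∈-filter⁻ (sameKey? (keyOff U) x) {xs = core} y∈ in a , keyOff⇒Agree U y x e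

        -- The core keeps at least d² / M members of the class. Members with the same vertex before
        -- the end differ only at the end, so there are at most D ≤ `K′` d of them, which leaves d /
        -- (M * K′) different vertices.
        tail-move : ∀ {x} → x ∈ core → ∀ i {q′} → q i ≡ suc q′ →
          Abundant d (M * K′) (λ v → ∃ λ y → y ∈ core × at y i (q i) ≡ v × Agree (end i ∷ P i (q i) ∷ []) y x)
        tail-move {x} x∈ i {q′} qi = vs , UniqueDec.deduplicate-! _≟_ (map val Y) , bound
            , λ v∈ → from (∈-map⁻ val (∈-deduplicate⁻ _≟_ (map val Y) v∈))
          where
          p = P i (q i)
          val : Vec V (suc (size js)) → V
          val h = Vec.lookup h p
          Y = Class (tailKey i) x
          vs = deduplicate _≟_ (map val Y)
          from : ∀ {v} → (∃ λ y → y ∈ Y × v ≡ val y) → ∃ λ y → y ∈ core × at y i (q i) ≡ v × Agree (end i ∷ p ∷ []) y x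
          from (y , y∈ , refl) = let a , b = core-class (end i ∷ p ∷ []) x y y∈ in y , a , refl , b
          small : ∀ v → #[ (λ h → val h ≟ v) ] Y ≤ D
          small v = ≤-trans (extension-bound deg≤ T 1 (end i ∷ []) ≤-refl (P i 0 , λ { (here e) → P≢end i i z≤n e })
              (Unique-filter (λ h → val h ≟ v) (Unique-filter (sameKey? (tailKey i) x) unique))
              (λ {h} h∈ → embeddings-hom T (core-sub (proj₁ (core-class (end i ∷ p ∷ []) x h (proj₁ (in-Y h∈))))))
              (λ {h} {h′} h∈ h′∈ r r∉ → agree {h} {h′} h∈ h′∈ r (r ≟ p) (λ e → r∉ (here e))))
            (≤-reflexive (*-identityʳ D))
            where
            in-Y : ∀ {h} → h ∈ filter (λ h → val h ≟ v) Y → h ∈ Y × val h ≡ v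
            in-Y h∈ = ∈-filter⁻ (λ h → val h ≟ v) {xs = Y} h∈
            agree : ∀ {h h′} → h ∈ filter (λ h → val h ≟ v) Y → h′ ∈ filter (λ h → val h ≟ v) Y → ∀ r → Dec (r ≡ p) → r ≢ end i →
                    Vec.lookup h r ≡ Vec.lookup h′ r
            agree h∈ h′∈ r (yes refl) _ = trans (proj₂ (in-Y h∈)) (sym (proj₂ (in-Y h′∈)))
            agree h∈ h′∈ r (no ne) r≢ = trans (off h∈) (sym (off h′∈))
              where
              off : ∀ {h} → h ∈ filter (λ h → val h ≟ v) Y → Vec.lookup h r ≡ Vec.lookup x r
              off {h} h∈ = proj₂ (core-class (end i ∷ p ∷ []) x h (proj₁ (in-Y h∈))) r λ { (here e) → r≢ e ; (there (here e)) → ne e }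
          bound : d ≤ M * K′ * length vs
          bound = *-cancelˡ-≤ d {{>-nonZero d>0}} (begin
            d * d                         ≤⟨ tail-class i qi (core-sub x∈) ⟩
            class (tailKey i) x Ω         ≤⟨ rich (∈-++⁺ʳ (map leafKey (allFin (suc s))) (∈-map⁺ tailKey (∈-allFin i))) x∈ ⟩
            M * length Y                  ≤⟨ *-monoʳ-≤ M (cover-bound (λ h v → val h ≟ v) Y vs D
                                              (λ h∈ → _ , ∈-deduplicate⁺ _≟_ (∈-map⁺ val h∈) , refl) (λ {v} _ → small v)) ⟩
            M * (length vs * D)           ≤⟨ *-monoʳ-≤ M (*-monoʳ-≤ (length vs) D≤) ⟩
            M * (length vs * (K′ * d))    ≡⟨ rearrange M (length vs) K′ d ⟩
            d * (M * K′ * length vs)      ∎)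
            where
            open ≤-Reasoning
            rearrange : ∀ a b c d → a * (b * (c * d)) ≡ d * (a * c * b)
            rearrange = solve 4 (λ a b c d → a :* (b :* (c :* d)) := d :* (a :* c :* b)) refl

        LeafMoved : Vec V (suc (size js)) → Fin (suc s) → V → Set
        LeafMoved x i v = ∃ λ y → y ∈ core × at y i (suc (q i)) ≡ v ×
          (∀ i′ {r} → r ≤ suc (q i′) → ¬ (i′ ≡ i × r ≡ suc (q i)) → at y i′ r ≡ at x i′ r)

        leaf-move : ∀ {x} → x ∈ core → ∀ i → Abundant d (M * K′) (LeafMoved x i)
        leaf-move {x} x∈ i = map val Y , uvs (Unique-filter (sameKey? (leafKey i) x) unique) (λ {y} → core-class (end i ∷ []) x y) , bound , λ v∈ → from (∈-map⁻ val v∈)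
          where
          val : Vec V (suc (size js)) → V
          val h = Vec.lookup h (end i)
          Y = Class (leafKey i) x
          uvs : ∀ {Z} → Unique Z → (∀ {y} → y ∈ Z → y ∈ core × Agree (end i ∷ []) y x) → Unique (map val Z)
          uvs [] _ = []
          uvs {h ∷ Z} (h∉ ∷ u) c = All.tabulate (λ v∈ e → let h′ , h′∈ , e′ = ∈-map⁻ val v∈ in
              All.lookup h∉ h′∈ (lookup-ext λ p → ext h h′ (proj₂ (c (here refl))) (proj₂ (c (there h′∈))) (trans e e′) p (p ≟ end i)))
            ∷ uvs u (c ∘ there)
            where
            ext : ∀ h h′ → Agree (end i ∷ []) h x → Agree (end i ∷ []) h′ x → val h ≡ val h′ → ∀ p → Dec (p ≡ end i) → Vec.lookup h p ≡ Vec.lookup h′ p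
            ext h h′ a a′ e p (yes refl) = e
            ext h h′ a a′ e p (no ne) = trans (a p λ { (here z) → ne z }) (sym (a′ p λ { (here z) → ne z }))
          from : ∀ {v} → (∃ λ y → y ∈ Y × v ≡ val y) → LeafMoved x i v
          from (y , y∈ , refl) = y , proj₁ (core-class (end i ∷ []) x y y∈) , refl
            , λ i′ {r} le ne → proj₂ (core-class (end i ∷ []) x y y∈) (P i′ r) λ { (here e) → case P-inj i′ i le ≤-refl e of λ { (inj₂ z) → ne (conv z) } }
            where
            conv : ∀ {i′ r} → i′ ≡ i × r ≡ suc (q i) → i′ ≡ i × r ≡ suc (q i)
            conv z = z
          bound : d ≤ M * K′ * length (map val Y)
          bound = begin
            d                             ≤⟨ leaf-class x i (embeddings-inj T (core-sub x∈)) (Ω⇒HomOffEnd i (core-sub x∈)) ⟩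
            class (leafKey i) x Ω         ≤⟨ rich (∈-++⁺ˡ (∈-map⁺ leafKey (∈-allFin i))) x∈ ⟩
            -- Weakened by the factor `K′` so that both kinds of moves share one constant.
            M * length Y                  ≤⟨ *-monoˡ-≤ (length Y) (m≤m*n M K′ {{>-nonZero K′>0}}) ⟩
            M * K′ * length Y             ≡⟨ cong (M * K′ *_) (sym (length-map val Y)) ⟩
            M * K′ * length (map val Y)   ∎
            where open ≤-Reasoning

        family : Family q L (M * K′) d
        family = record
          { objs = core ; at = at ; nonempty = some core nonempty
          ; head = λ {x} _ i i′ → cong (Vec.lookup x) (trans (pos-root js i) (sym (pos-root js i′)))
          ; adj = λ x∈ i le → ~-sym (embeddings-hom T (core-sub x∈) (P-edge i le))
          ; inj = λ x∈ {i} {i′} le le′ e → P-inj i i′ le le′ (embeddings-inj T (core-sub x∈) e)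
          ; petals = λ x∈ → let b , many , x∈b , sub , ap = petals x∈ in
              b , many , (λ y∈ → sub y∈ , λ i → same-end (AllPairs-related ap y∈ x∈b) i) ,
              AP.map (λ pt {i} {i′} {r} {r′} le le′ → proj₂ pt _ _ (P∈inner i le) (P∈inner i′ le′)) ap
          ; move = leaf-move }
          where
          some : ∀ c → 0 < length c → ∃ λ x → x ∈ c
          some (x ∷ _) _ = x , here refl
          same-end : ∀ {x y} → y ≡ x ⊎ Petal inner y x ⊎ Petal inner x y → ∀ i → at y i (suc (q i)) ≡ at x i (suc (q i))
          same-end (inj₁ refl) i = refl
          same-end (inj₂ (inj₁ pt)) i = proj₁ pt (end i) (end∉inner i)
          same-end (inj₂ (inj₂ pt)) i = sym (proj₁ pt (end i) (end∉inner i))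

-- Components of the complement of a kernel

sum-constant : ∀ m c → Vec.sum (tabulate {n = m} (λ _ → c)) ≡ m * c
sum-constant zero c = refl
sum-constant (suc m) c = cong (c +_) (sum-constant m c)

-- With Q meaning outside the kernel, `climb` and `descend` find the nearest kernel vertices on both
-- sides along a leg.
climb : ∀ {Q : ℕ → Set} (Q? : Decidable Q) m b → Q b → ¬ Q (b + suc m) →
  ∃ λ c → b ≤ c × c ≤ b + m × (∀ {x} → b ≤ x → x ≤ c → Q x) × ¬ Q (suc c)
climb {Q} Q? zero b qb ¬q = b , ≤-refl , m≤m+n b 0 , (λ le le′ → subst Q (≤-antisym le le′) qb) , λ q → ¬q (subst Q (+-comm 1 b) q)
climb {Q} Q? (suc m) b qb ¬q with Q? (suc b)
... | no ¬qs = b , ≤-refl , m≤m+n b (suc m) , (λ le le′ → subst Q (≤-antisym le le′) qb) , ¬qs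
... | yes qs with climb Q? m (suc b) qs (λ q → ¬q (subst Q (sym (+-suc b (suc m))) q))
...   | c , b≤ , c≤ , all , ¬qc = c , <⇒≤ b≤ , ≤-trans c≤ (≤-reflexive (sym (+-suc b m)))
        , (λ {x} le le′ → case m≤n⇒m<n∨m≡n le of λ { (inj₁ lt) → all lt le′ ; (inj₂ e) → subst Q e qb }) , ¬qc

descend : ∀ {Q : ℕ → Set} (Q? : Decidable Q) b → Q b → ¬ Q 0 →
  ∃ λ a → a < b × ¬ Q a × (∀ {x} → a < x → x ≤ b → Q x)
descend Q? zero qb ¬q = ⊥-elim (¬q qb)
descend {Q} Q? (suc b) qb ¬q with Q? b
... | no ¬qb = b , ≤-refl , ¬qb , λ lt le → subst Q (≤-antisym lt le) qb
... | yes qb′ with descend Q? b qb′ ¬q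
...   | a , a< , ¬qa , all = a , m≤n⇒m≤1+n a< , ¬qa
        , λ {x} lt le → case m≤n⇒m<n∨m≡n le of λ { (inj₁ lt′) → all lt (≤-pred lt′) ; (inj₂ e) → subst Q (sym e) qb }

vectors : ∀ {A : Set} → List A → ∀ m → List (Vec A m)
vectors xs zero = [] ∷ []
vectors xs (suc m) = cartesianProductWith _∷_ xs (vectors xs m)

∈-vectors : ∀ {A : Set} (xs : List A) {m} (v : Vec A m) → (∀ i → Vec.lookup v i ∈ xs) → v ∈ vectors xs m
∈-vectors xs [] _ = here refl
∈-vectors xs (x ∷ v) mem = ∈-cartesianProductWith⁺ _∷_ (mem zero) (∈-vectors xs v (mem ∘ suc))

-- The subtrees of the spider with S legs of length suc k′ cut out by a set of its vertices: shorter spiders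
-- around the head, and the subpath of leg i from distance a to distance a + q₀ + 2.
data Shape (S k′ : ℕ) : Set where
  spid : Vec (Fin (suc k′)) S → Shape S k′
  link : (i : Fin S) (a q₀ : ℕ) → a + suc q₀ ≤ k′ → Shape S k′

module _ (S k′ : ℕ) where

  link-if : (i : Fin S) (a q₀ : ℕ) → Dec (a + suc q₀ ≤ k′) → List (Shape S k′)
  link-if i a q₀ (yes p) = link i a q₀ p ∷ []
  link-if i a q₀ (no _) = []

  links : List (Shape S k′)
  links = concat (map (λ i → concat (map (λ a → concat (map (λ q₀ → link-if i a q₀ (a + suc q₀ ≤? k′)) (upTo k′))) (upTo k′))) (allFin S))

  shapes : List (Shape S k′)
  shapes = map spid (vectors (allFin (suc k′)) S) ++ links

  spid∈shapes : ∀ v → spid v ∈ shapes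
  spid∈shapes v = ∈-++⁺ˡ (∈-map⁺ spid (∈-vectors _ v λ i → ∈-allFin _))

  link∈shapes : ∀ i a q₀ → a + suc q₀ ≤ k′ → ∃ λ p → link i a q₀ p ∈ shapes
  link∈shapes i a q₀ le with a + suc q₀ ≤? k′ in eq
  ... | no ¬le = ⊥-elim (¬le le)
  ... | yes p = p , ∈-++⁺ʳ (map spid (vectors (allFin (suc k′)) S))
    (∈-concat⁺′ (∈-concat⁺′ (∈-concat⁺′ (subst (λ z → link i a q₀ p ∈ link-if i a q₀ z) (sym eq) (here refl))
      (∈-map⁺ (λ q₀ → link-if i a q₀ (a + suc q₀ ≤? k′)) (∈-upTo⁺ (≤-trans (m≤n+m (suc q₀) a) le))))
      (∈-map⁺ (λ a → concat (map (λ q₀ → link-if i a q₀ (a + suc q₀ ≤? k′)) (upTo k′))) (∈-upTo⁺ (≤-trans (≤-trans (s≤s (m≤m+n a q₀)) (≤-reflexive (sym (+-suc a q₀)))) le))))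
      (∈-map⁺ (λ i → concat (map (λ a → concat (map (λ q₀ → link-if i a q₀ (a + suc q₀ ≤? k′)) (upTo k′))) (upTo k′))) (∈-allFin i)))

^-distribʳ-* : ∀ e a b → (a * b) ^ e ≡ a ^ e * b ^ e
^-distribʳ-* zero a b = refl
^-distribʳ-* (suc e) a b = trans (cong (a * b *_) (^-distribʳ-* e a b))
  (solve 4 (λ a b x y → (a :* b) :* (x :* y) := (a :* x) :* (b :* y)) refl a b (a ^ e) (b ^ e))

clean-majority : ∀ p K e {n d D x y total} → 0 < K → D ≤ K * d → n * d ^ e ≤ total → total ≡ x + y →
  2 * (suc p * K ^ e) * x ≤ p * (n * D ^ e) → n * d ^ e ≤ 2 * y
clean-majority p K e {n} {d} {D} {x} {y} K>0 D≤ count refl bound = +-cancelʳ-≤ (n * d ^ e) (n * d ^ e) (2 * y) (begin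
  n * d ^ e + n * d ^ e    ≤⟨ +-mono-≤ count count ⟩
  (x + y) + (x + y)        ≡⟨ solve 2 (λ x y → (x :+ y) :+ (x :+ y) := con 2 :* y :+ con 2 :* x) refl x y ⟩
  2 * y + 2 * x            ≤⟨ +-monoʳ-≤ (2 * y) few ⟩
  2 * y + n * d ^ e        ∎)
  where
  open ≤-Reasoning
  c = suc p * K ^ e
  c>0 : 0 < c
  c>0 = *-mono-≤ {1} {suc p} (s≤s z≤n) (m^n>0 K {{>-nonZero K>0}} e)
  few : 2 * x ≤ n * d ^ e
  few = *-cancelˡ-≤ c {{>-nonZero c>0}} (begin
    c * (2 * x)                      ≡⟨ solve 2 (λ c x → c :* (con 2 :* x) := con 2 :* c :* x) refl c x ⟩
    2 * c * x                        ≤⟨ bound ⟩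
    p * (n * D ^ e)                  ≤⟨ *-mono-≤ (n≤1+n p) (*-monoʳ-≤ n (^-monoˡ-≤ e D≤)) ⟩
    suc p * (n * (K * d) ^ e)        ≡⟨ cong (λ z → suc p * (n * z)) (^-distribʳ-* e K d) ⟩
    suc p * (n * (K ^ e * d ^ e))    ≡⟨ solve 4 (λ p n a b → p :* (n :* (a :* b)) := p :* a :* (n :* b)) refl (suc p) n (K ^ e) (d ^ e) ⟩
    c * (n * d ^ e)                  ∎)

module Dichotomy {n : ℕ} (G : Graph n) (s k′ : ℕ) where
  open SpiderFamilies G public

  S : ℕ
  S = suc s

  module B = Legs {s} (λ _ → k′)

  N : ℕ
  N = suc (size B.js)

  B-size : size B.js ≡ S * suc k′
  B-size = sum-constant S (suc k′)

  -- A subtree of the big spider with its own spider coordinates. `f-edge` allows both orientations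
  -- because the long leg of a link runs towards the root of the big spider.
  record Pattern : Set where
    field
      {extra} : ℕ
      q      : Fin (suc extra) → ℕ
      f      : Fin (suc extra) → ℕ → Fin N
      f-root : ∀ i i′ → f i 0 ≡ f i′ 0
      f-inj  : ∀ i i′ {r r′} → r ≤ suc (q i) → r′ ≤ suc (q i′) → f i r ≡ f i′ r′ → SamePlace i r i′ r′
      f-edge : ∀ i {r} → r ≤ q i → Edge B.T (f i (suc r)) (f i r) ⊎ Edge B.T (f i r) (f i (suc r))

  P-root : ∀ i i′ → B.P i 0 ≡ B.P i′ 0
  P-root i i′ = trans (pos-root B.js i) (sym (pos-root B.js i′))

  P-height : ∀ i {x y} → x ≤ suc k′ → y ≤ suc k′ → B.P i x ≡ B.P i y → x ≡ y
  P-height i le le′ e with B.P-inj i i le le′ e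
  ... | inj₁ (refl , refl) = refl
  ... | inj₂ (_ , e′) = e′

  pattern-of : Shape S k′ → Pattern
  pattern-of (spid v) = record
    { q = λ i → toℕ (Vec.lookup v i) ; f = B.P ; f-root = P-root
    ; f-inj = λ i i′ le le′ → B.P-inj i i′ (≤-trans le (toℕ<n (Vec.lookup v i))) (≤-trans le′ (toℕ<n (Vec.lookup v i′)))
    ; f-edge = λ i le → inj₁ (B.P-edge i (≤-trans le (≤-pred (toℕ<n (Vec.lookup v i))))) }
  pattern-of (link i a q₀ h≤) = record
    { q = legs q₀ ; f = f ; f-root = same ; f-inj = inj ; f-edge = edge }
    where
    -- The head of a link is the neighbour of its outer end: the long leg goes down to distance a,
    -- the short leg up to h + 1.
    h = a + suc q₀
    f : Fin 2 → ℕ → Fin N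
    f zero r = B.P i (h ∸ r)
    f (suc _) r = B.P i (h + r)
    h∸≤ : ∀ r → h ∸ r ≤ suc k′
    h∸≤ r = ≤-trans (m∸n≤m h r) (m≤n⇒m≤1+n h≤)
    h+≤ : ∀ {r} → r ≤ 1 → h + r ≤ suc k′
    h+≤ le = ≤-trans (+-mono-≤ h≤ le) (≤-reflexive (+-comm k′ 1))
    ≤h : ∀ {r} → r ≤ suc q₀ → r ≤ h
    ≤h le = ≤-trans le (m≤n+m (suc q₀) a)
    same : ∀ j j′ → f j 0 ≡ f j′ 0
    same zero zero = refl
    same zero (suc _) = cong (B.P i) (sym (+-identityʳ h))
    same (suc _) zero = cong (B.P i) (+-identityʳ h)
    same (suc _) (suc _) = refl
    both-zero : ∀ {r r′} → r ≤ h → h ∸ r ≡ h + r′ → r ≡ 0 × r′ ≡ 0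
    both-zero {r} {r′} le e = ∸-cancelˡ-≡ le z≤n (trans e (trans (cong (h +_) r′≡0) (+-identityʳ h))) , r′≡0
      where
      r′≡0 : r′ ≡ 0
      r′≡0 = n≤0⇒n≡0 (+-cancelˡ-≤ h r′ 0 (≤-trans (≤-reflexive (sym e)) (≤-trans (m∸n≤m h r) (≤-reflexive (sym (+-identityʳ h))))))
    inj : ∀ j j′ {r r′} → r ≤ suc (legs q₀ j) → r′ ≤ suc (legs q₀ j′) → f j r ≡ f j′ r′ → SamePlace j r j′ r′
    inj zero zero {r} {r′} le le′ e = inj₂ (refl , ∸-cancelˡ-≡ (≤h le) (≤h le′) (P-height i (h∸≤ r) (h∸≤ r′) e))
    inj zero (suc zero) {r} le le′ e = inj₁ (both-zero (≤h le) (P-height i (h∸≤ r) (h+≤ le′) e))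
    inj (suc zero) zero {r} {r′} le le′ e = let z , z′ = both-zero (≤h le′) (P-height i (h∸≤ r′) (h+≤ le) (sym e)) in inj₁ (z′ , z)
    inj (suc zero) (suc zero) {r} {r′} le le′ e = inj₂ (refl , +-cancelˡ-≡ h r r′ (P-height i (h+≤ le) (h+≤ le′) e))
    edge : ∀ j {r} → r ≤ legs q₀ j → Edge B.T (f j (suc r)) (f j r) ⊎ Edge B.T (f j r) (f j (suc r))
    edge zero {r} le = inj₂ (subst (λ x → Edge B.T (B.P i x) (B.P i (h ∸ suc r))) (sym (∸-step (≤h (s≤s le))))
      (B.P-edge i (≤-trans (m∸n≤m h (suc r)) h≤)))
    edge (suc zero) {zero} _ = inj₁ (subst₂ (λ x y → Edge B.T (B.P i x) (B.P i y)) (+-comm 1 h) (sym (+-identityʳ h)) (B.P-edge i h≤))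

  module Pat (σ : Shape S k′) where
    open Pattern (pattern-of σ) public
    module T = Legs q
    open Place T.js f f-root using (place; place-pos; place-injective)

    ι : Fin (suc (size T.js)) → Fin N
    ι = place

    ι-P : ∀ i {r} → r ≤ suc (q i) → ι (T.P i r) ≡ f i r
    ι-P i le = place-pos i (≤-trans le (≤-reflexive (sym (T.js-lookup i))))

    ι-inj : ∀ {p p′} → ι p ≡ ι p′ → p ≡ p′
    ι-inj = place-injective λ {i} {i′} le le′ → f-inj i i′ (≤-trans le (≤-reflexive (T.js-lookup i))) (≤-trans le′ (≤-reflexive (T.js-lookup i′)))

    size≤ : size T.js ≤ size B.js
    size≤ = ≤-pred (injective⇒≤ {f = ι} ι-inj)

    restrict-embedding : ∀ {h} → h ∈ B.Ω → restrict ι h ∈ T.Ω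
    restrict-embedding {h} h∈ = embeddings-complete T.T _ (λ {a} {b} → hom a b)
      λ {a} {b} e → ι-inj (embeddings-inj B.T h∈ (trans (sym (lookup∘tabulate (Vec.lookup h ∘ ι) a)) (trans e (lookup∘tabulate (Vec.lookup h ∘ ι) b))))
      where
      hom : ∀ a b → Edge T.T a b → Vec.lookup (restrict ι h) a ~ Vec.lookup (restrict ι h) b
      hom a b ed with T.P-edge-cover a b ed
      ... | i , r , le , refl , refl = subst₂ _~_
        (sym (trans (lookup∘tabulate (Vec.lookup h ∘ ι) (T.P i (suc r))) (cong (Vec.lookup h) (ι-P i (s≤s le)))))
        (sym (trans (lookup∘tabulate (Vec.lookup h ∘ ι) (T.P i r)) (cong (Vec.lookup h) (ι-P i (m≤n⇒m≤1+n le)))))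
        ([ embeddings-hom B.T h∈ , ~-sym ∘ embeddings-hom B.T h∈ ]′ (f-edge i le))

    -- the subtree is a component of U together with its boundary
    Component : List (Fin N) → Set
    Component U = (∀ i {r} → r ≤ q i → f i r ∈ U) × (∀ i → f i (suc (q i)) ∉ U)

    restrict-petal : ∀ {U} → Component U → ∀ x y → Petal U x y → Petal T.inner (restrict ι x) (restrict ι y)
    restrict-petal {U} (inU , outU) x y (agree , apart) = agree′ , apart′
      where
      at-ι : ∀ (z : Vec V N) p → Vec.lookup (restrict ι z) p ≡ Vec.lookup z (ι p)
      at-ι z p = lookup∘tabulate (Vec.lookup z ∘ ι) p
      agree′ : Agree T.inner (restrict ι x) (restrict ι y)
      agree′ p p∉ with T.∉inner-end p∉
      ... | i , refl = trans (at-ι x (T.end i)) (trans (agree (ι (T.end i)) (subst (_∉ U) (sym (ι-P i ≤-refl)) (outU i))) (sym (at-ι y (T.end i))))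
      ι∈U : ∀ {p} → p ∈ T.inner → ι p ∈ U
      ι∈U p∈ with T.inner-P p∈
      ... | i , r , le , refl = subst (_∈ U) (sym (ι-P i (m≤n⇒m≤1+n le))) (inU i le)
      apart′ : Apart T.inner (restrict ι x) (restrict ι y)
      apart′ p p′ p∈ p′∈ e = apart (ι p) (ι p′) (ι∈U p∈) (ι∈U p′∈) (trans (sym (at-ι x p)) (trans e (at-ι y p′)))

  HasComponent : List (Fin N) → Set
  HasComponent U = ∃ λ σ → σ ∈ shapes S k′ × Pat.Component σ U

  -- U consists of inner vertices, so every leg ends in the kernel and every climb stops. If the
  -- head is in U, the climbs cut out a spider around it. Otherwise the head itself bounds the
  -- descent from p₀, and the result is a link.
  find-component : ∀ U → (∀ {p} → p ∈ U → p ∈ B.inner) → ∀ {p₀} → p₀ ∈ U →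
    HasComponent U
  find-component U sub {p₀} p₀∈ = search (B.P zero 0 ∈F? U)
    where
    Q? : ∀ i r → Dec (B.P i r ∈ U)
    Q? i r = B.P i r ∈F? U
    end∉ : ∀ i → B.P i (suc k′) ∉ U
    end∉ i p∈ = B.end∉inner i (sub p∈)
    search : Dec (B.P zero 0 ∈ U) → HasComponent U
    search (yes root∈) = spid v , spid∈shapes S k′ v
        , (λ i {r} le → proj₁ (proj₂ (proj₂ (proj₂ (cl i)))) z≤n (≤-trans le (≤-reflexive (v≡ i))))
        , λ i → subst (λ r → B.P i (suc r) ∉ U) (sym (v≡ i)) (proj₂ (proj₂ (proj₂ (proj₂ (cl i)))))
      where
      cl : ∀ i → ∃ λ c → 0 ≤ c × c ≤ 0 + k′ × (∀ {x} → 0 ≤ x → x ≤ c → B.P i x ∈ U) × B.P i (suc c) ∉ U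
      cl i = climb (Q? i) k′ 0 (subst (_∈ U) (P-root zero i) root∈) (end∉ i)
      v = tabulate λ i → fromℕ< (s≤s (proj₁ (proj₂ (proj₂ (cl i)))))
      v≡ : ∀ i → toℕ (Vec.lookup v i) ≡ proj₁ (cl i)
      v≡ i = trans (cong toℕ (lookup∘tabulate (λ i → fromℕ< (s≤s (proj₁ (proj₂ (proj₂ (cl i)))))) i)) (toℕ-fromℕ< (s≤s (proj₁ (proj₂ (proj₂ (cl i))))))
    search (no root∉) = locate (B.inner-P (sub p₀∈))
      where
      locate : (∃₂ λ i r → r ≤ k′ × p₀ ≡ B.P i r) → HasComponent U
      locate (i , r , r≤ , refl) = finish (climb (Q? i) (k′ ∸ r) r p₀∈ (subst (λ x → B.P i x ∉ U) (trans (cong suc (sym (m+[n∸m]≡n r≤))) (sym (+-suc r (k′ ∸ r)))) (end∉ i)))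
          (descend (Q? i) r p₀∈ (subst (_∉ U) (P-root zero i) root∉))
        where
        finish : (∃ λ c → r ≤ c × c ≤ r + (k′ ∸ r) × (∀ {x} → r ≤ x → x ≤ c → B.P i x ∈ U) × B.P i (suc c) ∉ U) →
                 (∃ λ a → a < r × B.P i a ∉ U × (∀ {x} → a < x → x ≤ r → B.P i x ∈ U)) →
                 HasComponent U
        finish (c , r≤c , c≤ , above , c∉) (a , a<r , a∉ , below) = build (m≤n⇒∃[o]m+o≡n (≤-trans a<r r≤c))
          where
          between : ∀ {x} → a < x → x ≤ c → B.P i x ∈ U
          between {x} lt le = [ below lt , (λ r≤x → above r≤x le) ]′ (≤-total x r)
          c≤k′ : c ≤ k′
          c≤k′ = ≤-trans c≤ (≤-reflexive (m+[n∸m]≡n r≤))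
          build : (∃ λ o → suc a + o ≡ c) → HasComponent U
          build (o , e) = link i a o (proj₁ mem) , proj₂ mem , inU , outU
            where
            h≡ : a + suc o ≡ c
            h≡ = trans (+-suc a o) e
            mem = link∈shapes S k′ i a o (≤-trans (≤-reflexive h≡) c≤k′)
            inU : ∀ j {x} → x ≤ legs o j → Pattern.f (pattern-of (link i a o (proj₁ mem))) j x ∈ U
            inU zero {x} le = between (m+n≤o⇒m≤o∸n (suc a) (≤-trans (+-monoʳ-≤ (suc a) le) (≤-reflexive (sym (+-suc a o)))))
              (≤-trans (m∸n≤m (a + suc o) x) (≤-reflexive h≡))
            inU (suc zero) {zero} _ = subst (λ x → B.P i x ∈ U) (trans (sym h≡) (sym (+-identityʳ (a + suc o)))) (between (≤-trans a<r r≤c) ≤-refl)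
            outU : ∀ j → Pattern.f (pattern-of (link i a o (proj₁ mem))) j (suc (legs o j)) ∉ U
            outU zero = subst (λ x → B.P i x ∉ U) (sym (m+n∸n≡m a (suc o))) a∉
            outU (suc zero) = subst (λ x → B.P i x ∉ U) (trans (cong suc (sym h≡)) (+-comm 1 (a + suc o))) c∉

  module Counting {d D K′ : ℕ} {{_ : NonZero D}} (deg≥ : ∀ v → d + suc (size B.js) ≤ deg G v) (deg≤ : ∀ v → deg G v ≤ D)
    (D≤ : D ≤ K′ * d) (K′>0 : 0 < K′) (n>0 : 0 < n) (M₀ L₀ : ℕ) where

    block : ℕ
    block = suc M₀ * suc L₀

    packing : ∀ σ → Packing (Petal (Pat.T.inner σ)) block (Pat.T.Ω σ)
    -- The size argument of `pack` is `block` minus one.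
    packing σ = pack (VecP.≡-dec _≟_) (petal? (Pat.T.inner σ)) (L₀ + M₀ * suc L₀) (length (Pat.T.Ω σ)) (Pat.T.Ω σ) ≤-refl

    bad : ∀ σ → List (Vec V (suc (size (Pat.T.js σ))))
    bad σ = Packing.covered (packing σ)

    -- With p shapes that each spoil at most n D^E / C embeddings and D ≤ `K′` d, where E =
    -- `size B.js`, the spoiled ones number at most half of n d^E. The successor of p keeps the
    -- constant positive.
    C : ℕ
    C = 2 * (suc (length (shapes S k′)) * K′ ^ size B.js)

    embeddings-upper : ∀ {e} (T : Tree e) → length (embeddings T) ≤ n * D ^ e
    embeddings-upper {e} T = subst (λ l → length (embeddings T) ≤ l * D ^ e) (length-allFin n)
      (cover-bound (λ h v → Vec.lookup h zero ≟ v) (embeddings T) (allFin n) (D ^ e) (λ _ → _ , ∈-allFin _ , refl) λ {v} _ → small v)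
      where
      U = map suc (allFin e)
      small : ∀ v → #[ (λ h → Vec.lookup h zero ≟ v) ] (embeddings T) ≤ D ^ e
      small v = subst (λ u → #[ (λ h → Vec.lookup h zero ≟ v) ] (embeddings T) ≤ D ^ u) (trans (length-map suc (allFin e)) (length-allFin e))
        (extension-bound deg≤ T (length U) U ≤-refl (zero , λ z∈ → case ∈-map⁻ suc z∈ of λ { (_ , _ , ()) })
          (Unique-filter (λ h → Vec.lookup h zero ≟ v) (embeddings-unique T))
          (λ x∈ → embeddings-hom T (proj₁ (∈-filter⁻ (λ h → Vec.lookup h zero ≟ v) {xs = embeddings T} x∈)))
          λ { x∈ y∈ zero _ → trans (proj₂ (∈-filter⁻ (λ h → Vec.lookup h zero ≟ v) {xs = embeddings T} x∈))
                               (sym (proj₂ (∈-filter⁻ (λ h → Vec.lookup h zero ≟ v) {xs = embeddings T} y∈)))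
            ; x∈ y∈ (suc p) p∉ → ⊥-elim (p∉ (∈-map⁺ suc (∈-allFin p))) })

    hits? : ∀ h σ → Dec (Any (restrict (Pat.ι σ) h ≡_) (bad σ))
    hits? h σ = Any.any? (VecP.≡-dec _≟_ (restrict (Pat.ι σ) h)) (bad σ)

    spoiled? : ∀ h → Dec (Any (λ σ → Any (restrict (Pat.ι σ) h ≡_) (bad σ)) (shapes S k′))
    spoiled? h = Any.any? (hits? h) (shapes S k′)

    clean-homs : List (Vec V N)
    clean-homs = filter (¬? ∘ spoiled?) B.Ω

    module _ (sparse : ∀ {σ} → σ ∈ shapes S k′ → C * length (bad σ) < length (Pat.T.Ω σ)) where

      -- Sparsity bounds the packed embeddings of a shape with e′ edges by n D^e′ / C, and each of
      -- them has at most D^(E - e′) extensions. So the loss per shape is the same for all sizes.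
      spoiled-bound : C * #[ spoiled? ] B.Ω ≤ length (shapes S k′) * (n * D ^ size B.js)
      spoiled-bound = begin
        C * length X                          ≤⟨ *-monoʳ-≤ C (cover-∑ hits? X (shapes S k′) λ h∈ → find (proj₂ (∈-filter⁻ spoiled? {xs = B.Ω} h∈))) ⟩
        C * ∑ (shapes S k′) (λ σ → #[ (λ h → hits? h σ) ] X)  ≡⟨ scale (shapes S k′) ⟩
        ∑ (shapes S k′) (λ σ → C * #[ (λ h → hits? h σ) ] X)  ≤⟨ ∑-mono (shapes S k′) each ⟩
        ∑ (shapes S k′) (λ _ → n * D ^ size B.js)  ≡⟨ ∑-const (shapes S k′) _ ⟩
        length (shapes S k′) * (n * D ^ size B.js) ∎
        where
        open ≤-Reasoning
        X = filter spoiled? B.Ω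
        scale : ∀ zs {f : Shape S k′ → ℕ} → C * ∑ zs f ≡ ∑ zs (λ y → C * f y)
        scale [] = *-zeroʳ C
        scale (z ∷ zs) {f} = trans (*-distribˡ-+ C (f z) (∑ zs f)) (cong (C * f z +_) (scale zs))
        each : ∀ {σ} → σ ∈ shapes S k′ → C * #[ (λ h → hits? h σ) ] X ≤ n * D ^ size B.js
        each {σ} σ∈ = begin
          C * #[ (λ h → hits? h σ) ] X        ≤⟨ *-monoʳ-≤ C (⊆⇒length≤ (Unique-filter (λ h → hits? h σ) (Unique-filter spoiled? (embeddings-unique B.T)))
                                                   λ h∈ → let h∈X , b = ∈-filter⁻ (λ h → hits? h σ) {xs = X} h∈ in
                                                     ∈-filter⁺ (λ h → hits? h σ) (proj₁ (∈-filter⁻ spoiled? {xs = B.Ω} h∈X)) b) ⟩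
          C * #[ (λ h → hits? h σ) ] B.Ω      ≤⟨ *-monoʳ-≤ C (restriction-bound deg≤ B.T (Pat.ι σ) (Pat.ι-inj σ) (bad σ)) ⟩
          C * (length (bad σ) * D ^ (size B.js ∸ e′)) ≡⟨ sym (*-assoc C (length (bad σ)) _) ⟩
          C * length (bad σ) * D ^ (size B.js ∸ e′)   ≤⟨ *-monoˡ-≤ (D ^ (size B.js ∸ e′)) (≤-trans (<⇒≤ (sparse σ∈)) (embeddings-upper (Pat.T.T σ))) ⟩
          n * D ^ e′ * D ^ (size B.js ∸ e′)   ≡⟨ *-assoc n (D ^ e′) _ ⟩
          n * (D ^ e′ * D ^ (size B.js ∸ e′)) ≡⟨ cong (n *_) (trans (sym (^-distribˡ-+-* D e′ (size B.js ∸ e′))) (cong (D ^_) (m+[n∸m]≡n (Pat.size≤ σ)))) ⟩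
          n * D ^ size B.js                   ∎
          where
          e′ = size (Pat.T.js σ)

      mostly-clean : n * d ^ size B.js ≤ 2 * length clean-homs
      mostly-clean = clean-majority (length (shapes S k′)) K′ (size B.js) {n} K′>0 D≤ (embeddings-count deg≥ B.T ≤-refl)
        (#-split spoiled? B.Ω) spoiled-bound

      -- Pinning the ends makes the embeddings agree off `B.inner`, as `sunflower` requires. Clean
      -- embeddings restrict to none of the `bad` ones, so their petals restrict to one more block
      -- in an exhausted leftover.
      absurd-sparse : 2 * (n ^ S * sunBound block N) < n * d ^ size B.js → ⊥
      absurd-sparse big = pinned (pin ends (sunBound block N) (Unique-filter (¬? ∘ spoiled?) (embeddings-unique B.T))
          (subst (λ l → n ^ l * sunBound block N < length clean-homs) (sym (trans (length-map B.end (allFin S)) (length-allFin S)))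
            (*-cancelˡ-< 2 _ _ (<-≤-trans big mostly-clean))))
        where
        ends = map B.end (allFin S)
        Petals : List (Vec V N) → Set
        Petals X = ∃ λ U → (∀ {p} → p ∈ U → p ∈ B.inner) × (∃ λ p → p ∈ U) × Clique (Petal U) block X
        contradiction′ : ∀ {X} → (∀ {x} → x ∈ X → x ∈ clean-homs) → Petals X → ⊥
        contradiction′ {X} X⊆ (U , sub , (p , p∈) , b , len , b⊆ , ap) = use (find-component U sub p∈)
          where
          use : HasComponent U → ⊥
          use (σ , σ∈ , comp) = Packing.exhausted (packing σ)
              (map (restrict (Pat.ι σ)) b , trans (length-map (restrict (Pat.ι σ)) b) len , mem
              , APP.map⁺ (AP.map (λ {x} {y} → Pat.restrict-petal σ comp x y) ap))
            where
            mem : ∀ {y} → y ∈ map (restrict (Pat.ι σ)) b → y ∈ Packing.leftover (packing σ)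
            mem y∈ = go (∈-map⁻ (restrict (Pat.ι σ)) y∈)
              where
              go : ∀ {y} → (∃ λ x → x ∈ b × y ≡ restrict (Pat.ι σ) x) → y ∈ Packing.leftover (packing σ)
              go (x , x∈ , refl) = let x∈Ω , ok = ∈-filter⁻ (¬? ∘ spoiled?) {xs = B.Ω} (X⊆ (b⊆ x∈)) in
                Packing.covers (packing σ) (Pat.restrict-embedding σ x∈Ω) λ bad∈ → ok (lose σ∈ bad∈)
        pinned : (∃ λ X′ → (∀ {x} → x ∈ X′ → x ∈ clean-homs) × Unique X′ × sunBound block N < length X′ ×
                   (∀ {x y p} → x ∈ X′ → y ∈ X′ → p ∈ ends → Vec.lookup x p ≡ Vec.lookup y p)) → ⊥
        pinned (X′ , sub , u , many , same) = contradiction′ sub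
          (sunflower block N B.inner B.inner-length u
            (λ x∈ y∈ p p∉ → let i , e = B.∉inner-end p∉ in same x∈ y∈ (subst (_∈ ends) (sym e) (∈-map⁺ B.end (∈-allFin i)))) many)

    Dense : Shape S k′ → Set
    Dense σ = length (Pat.T.Ω σ) ≤ C * length (bad σ)

    some-dense : 2 * (n ^ S * sunBound block N) < n * d ^ size B.js → ∃ Dense
    some-dense big = decide (Any.any? (λ σ → length (Pat.T.Ω σ) ≤? C * length (bad σ)) (shapes S k′))
      where
      decide : Dec (Any Dense (shapes S k′)) → ∃ Dense
      decide (yes p) = let σ , _ , le = find p in σ , le
      decide (no ¬p) = ⊥-elim (absurd-sparse (λ σ∈ → ≰⇒> λ le → ¬p (lose σ∈ le)) big)

-- Subdivisions from a packed shape

%2-cases : ∀ r → r < 2 → r ≡ 0 ⊎ r ≡ 1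
%2-cases zero _ = inj₁ refl
%2-cases (suc zero) _ = inj₂ refl
%2-cases (suc (suc r)) (s≤s (s≤s ()))

halve : ∀ m → m ≡ m % 2 + 2 * (m / 2)
halve m = trans (m≡m%n+[m/n]*n m 2) (cong (m % 2 +_) (*-comm (m / 2) 2))

remainder₂ : ∀ m → m % 2 ≡ 0 ⊎ m % 2 ≡ 1
remainder₂ m = %2-cases (m % 2) (m%n<n m 2)

module Finish {n : ℕ} (G : Graph n) (s k′ : ℕ) (s≥1 : 1 ≤ s) {d D K′ β bound W M₀ L₀ : ℕ} (m : ℕ) {{_ : NonZero D}}
  (deg≤ : ∀ v → deg G v ≤ D) (D≤ : D ≤ K′ * (suc M₀ * K′) * β) (K′>0 : 0 < K′) (β>0 : 0 < β) (Mβ≤d : suc M₀ * K′ * β ≤ d)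
  (W<L : W < suc L₀) (MW<d : suc M₀ * K′ * W < d)
  (roomˢ : bound + suc s + suc s * (2 * (suc s * suc k′)) ≤ W) (roomˡ : suc bound + suc s * suc k′ + 3 + 2 * suc k′ ≤ W)
  (m>0 : 0 < m) (Mm≤d : suc M₀ * K′ * m ≤ d)
  (m≥ : 2 * (suc (suc bound) + suc (suc bound + suc s * suc k′)) * (K′ * (suc M₀ * K′)) ≤ m)
  (L≥ : suc s + K′ * (suc M₀ * K′) * suc (suc bound + suc s * suc k′) * (2 * 2 ^ m) ≤ suc L₀)
  (β≥ : 2 * (2 ^ m * suc s) ≤ β) (β≥′ : 2 * (2 ^ (m * m) * suc s) ≤ β) where

  open Links G

  M L k : ℕ
  M = suc M₀ * K′
  L = suc L₀
  k = suc k′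

  M>0 : 0 < M
  M>0 = *-mono-≤ {1} {suc M₀} (s≤s z≤n) K′>0

  module D {q₀ : ℕ} (fam : Family (legs q₀) L M d) =
    TwoLegs.Dense fam W W<L MW<d {D} {K′} {β} {suc s} {k} {bound} m deg≤ M>0 β>0 Mβ≤d D≤ roomˡ

  m≥₁ : 2 * suc bound * (K′ * M) ≤ m
  m≥₁ = ≤-trans (*-monoˡ-≤ (K′ * M) (*-monoʳ-≤ 2 (≤-trans (n≤1+n (suc bound)) (m≤m+n (suc (suc bound)) _)))) m≥

  m≥₂ : 2 * suc (suc bound) * (K′ * M) ≤ m
  m≥₂ = ≤-trans (*-monoˡ-≤ (K′ * M) (*-monoʳ-≤ 2 (m≤m+n (suc (suc bound)) _))) m≥

  m≥₃ : 2 * (suc bound + suc (suc bound + suc s * k)) * (K′ * M) ≤ m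
  m≥₃ = ≤-trans (*-monoˡ-≤ (K′ * M) (*-monoʳ-≤ 2 (+-monoˡ-≤ (suc (suc bound + suc s * k)) (n≤1+n (suc bound))))) m≥

  TailMove : ∀ {q₀} → Family (legs q₀) L M d → Set
  TailMove fam = ∀ {x} → x ∈ Family.objs fam → Abundant d M (TwoLegs.TailMoved fam W W<L MW<d x)

  finish-link : ∀ q₀ → suc q₀ ≤ k′ → (fam : Family (legs q₀) L M d) → (1 ≤ q₀ → TailMove fam) → Anchored (suc s) k bound
  finish-link q₀ q₀≤ fam tail = by-remainder (remainder₂ r)
    where
    r = k′ ∸ suc q₀
    e = r / 2
    k≡ : k ≡ suc (suc q₀) + (r % 2 + 2 * e)
    k≡ = cong suc (trans (sym (m+[n∸m]≡n q₀≤)) (cong (suc q₀ +_) (halve r)))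
    e≤k : e ≤ k
    e≤k = ≤-trans (m/n≤m r 2) (≤-trans (m∸n≤m k′ (suc q₀)) (n≤1+n k′))
    odd : r % 2 ≡ 1 → k ≡ 3 + q₀ + 2 * e
    odd p = trans k≡ (trans (cong (λ z → suc (suc q₀) + (z + 2 * e)) p) (cong (2 +_) (+-suc q₀ (2 * e))))
    by-q₀ : ∀ q → q ≡ q₀ → r % 2 ≡ 1 → Anchored (suc s) k bound
    by-q₀ zero eq p = D.odd-link₂ fam (sym eq) m>0 Mm≤d m≥₂ L≥ e e≤k (odd p)
    by-q₀ (suc q) eq p = D.odd-link₃ fam (tail q₀≥1) q₀≥1 m>0 Mm≤d m≥₃ β≥′ e e≤k (odd p)
      where
      q₀≥1 : 1 ≤ q₀
      q₀≥1 = subst (1 ≤_) eq (s≤s z≤n)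
    by-remainder : r % 2 ≡ 0 ⊎ r % 2 ≡ 1 → Anchored (suc s) k bound
    by-remainder (inj₁ p) = D.even-link fam m>0 Mm≤d m≥₁ β≥ e e≤k (trans k≡ (cong (λ z → suc (suc q₀) + (z + 2 * e)) p))
    by-remainder (inj₂ p) = by-q₀ q₀ refl p

  -- Forgetting legs preserves a family: petals stay disjoint, and a move of a remaining leg is a
  -- move as before. It turns two legs of length one into a path of length two.
  subfamily : ∀ {a b} {q : Fin a → ℕ} {q′ : Fin b → ℕ} (g : Fin b → Fin a) → (∀ {j j′} → g j ≡ g j′ → j ≡ j′) →
    (∀ j → q (g j) ≡ q′ j) → Family q L M d → Family q′ L M d
  subfamily {q = q} {q′} g g-inj q≡ fam = record
    { objs = objs ; at = λ x j → at x (g j) ; nonempty = nonempty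
    ; head = λ x∈ j j′ → head x∈ (g j) (g j′)
    ; adj = λ x∈ j le → adj x∈ (g j) (subst (_ ≤_) (sym (q≡ j)) le)
    ; inj = λ x∈ {j} {j′} le le′ e → pull (inj x∈ (subst (λ z → _ ≤ suc z) (sym (q≡ j)) le) (subst (λ z → _ ≤ suc z) (sym (q≡ j′)) le′) e)
    ; petals = λ {x} x∈ → let b , many , same , sep = petals x∈ in b , many
        , (λ {y} y∈ → proj₁ (same y∈) , λ j → subst (λ z → at y (g j) (suc z) ≡ at x (g j) (suc z)) (q≡ j) (proj₂ (same y∈) (g j)))
        , AP.map (λ {y} {z} sp {j} {j′} {r} {r′} le le′ → sp (subst (r ≤_) (sym (q≡ j)) le) (subst (r′ ≤_) (sym (q≡ j′)) le′)) sep
    ; move = λ {x} x∈ j → let vs , u , many , ext = move x∈ (g j) in vs , u , many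
        , λ {v} v∈ → let y , y∈ , e , keep = ext v∈ in y , y∈ , subst (λ z → at y (g j) (suc z) ≡ v) (q≡ j) e
            , λ j′ {r} le ne → keep (g j′) (subst (λ z → r ≤ suc z) (sym (q≡ j′)) le)
                λ { (e₁ , e₂) → ne (g-inj e₁ , trans e₂ (cong suc (q≡ j))) } }
    where
    open Family fam
    pull : ∀ {j j′ r r′} → SamePlace (g j) r (g j′) r′ → SamePlace j r j′ r′
    pull (inj₁ z) = inj₁ z
    pull (inj₂ (e , z)) = inj₂ (g-inj e , z)

  finish-spider : ∀ (q : Fin (suc s) → ℕ) → (∀ i → q i ≤ k′) → Family q L M d → Anchored (suc s) k bound
  finish-spider q q≤ fam = decide exceptional?
    where
    open Family fam
    Exceptional : Set
    Exceptional = ∃ λ i → ∃ λ i′ → i ≢ i′ × q i ≡ 0 × q i′ ≡ 0 × k′ % 2 ≡ 1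
    exceptional? : Dec Exceptional
    exceptional? = any? λ i → any? λ i′ → ¬? (i ≟ i′) ×-dec ((q i ℕ.≟ 0) ×-dec ((q i′ ℕ.≟ 0) ×-dec (k′ % 2 ℕ.≟ 1)))
    e : Fin (suc s) → ℕ
    e i = (k′ ∸ q i) / 2
    odd? : ∀ i → Dec ((k′ ∸ q i) % 2 ≡ 1)
    odd? i = (k′ ∸ q i) % 2 ℕ.≟ 1
    os : List (Fin (suc s))
    os = filter odd? (allFin (suc s))
    rem : ∀ i (m : Dec (i ∈ os)) → (k′ ∸ q i) % 2 ≡ indicator m
    rem i (yes i∈) = proj₂ (∈-filter⁻ odd? {xs = allFin (suc s)} i∈)
    rem i (no i∉) = [ id , (λ p → ⊥-elim (i∉ (∈-filter⁺ odd? (∈-allFin i) p))) ]′ (remainder₂ (k′ ∸ q i))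
    lens : ∀ i → k ≡ indicator (i ∈F? os) + (2 * e i + suc (q i))
    lens i = begin
      suc k′                                          ≡⟨ cong suc (sym (m+[n∸m]≡n (q≤ i))) ⟩
      suc (q i + (k′ ∸ q i))                          ≡⟨ cong (λ z → suc (q i + z)) (trans (halve (k′ ∸ q i)) (cong (_+ 2 * e i) (rem i (i ∈F? os)))) ⟩
      suc (q i + (indicator (i ∈F? os) + 2 * e i))    ≡⟨ solve 3 (λ a b c → con 1 :+ (a :+ (b :+ c)) := b :+ (c :+ (con 1 :+ a))) refl (q i) (indicator (i ∈F? os)) (2 * e i) ⟩
      indicator (i ∈F? os) + (2 * e i + suc (q i))    ∎
      where open ≡-Reasoning
    e≤k : ∀ i → e i ≤ k
    e≤k i = ≤-trans (m/n≤m (k′ ∸ q i) 2) (≤-trans (m∸n≤m k′ (q i)) (n≤1+n k′))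
    even-k : ∀ {i} → i ∈ os → q i ≡ 0 → k′ % 2 ≡ 1
    even-k {i} i∈ z = trans (cong (λ a → (k′ ∸ a) % 2) (sym z)) (proj₂ (∈-filter⁻ odd? {xs = allFin (suc s)} i∈))
    anchors-distinct : ¬ Exceptional → ∀ {x} → x ∈ objs → ∀ {i i′} → anchor fam os x i ≡ anchor fam os x i′ → i ≡ i′
    anchors-distinct ¬ex {x} x∈ {i} {i′} eq with i ∈F? os | i′ ∈F? os
    ... | yes i∈ | yes i′∈ = go (inj x∈ (n≤1+n (q i)) (n≤1+n (q i′)) eq)
      where
      go : SamePlace i (q i) i′ (q i′) → i ≡ i′
      go (inj₂ (e , _)) = e
      go (inj₁ (z , z′)) = decidable-stable (i ≟ i′) λ ne → ¬ex (i , i′ , ne , z , z′ , even-k i∈ z)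
    ... | yes _ | no _ = go (inj x∈ (n≤1+n (q i)) ≤-refl eq)
      where
      go : SamePlace i (q i) i′ (suc (q i′)) → i ≡ i′
      go (inj₂ (e , _)) = e
    ... | no _ | yes _ = go (inj x∈ ≤-refl (n≤1+n (q i′)) eq)
      where
      go : SamePlace i (suc (q i)) i′ (q i′) → i ≡ i′
      go (inj₂ (e , _)) = e
    ... | no _ | no _ = leaf-inj x∈ eq
    decide : Dec Exceptional → Anchored (suc s) k bound
    decide (no ¬ex) = anchor fam os (proj₁ nonempty) , (λ {i} {i′} → anchors-distinct ¬ex (proj₂ nonempty) {i} {i′})
      , spider-robust fam k W bound W<L MW<d os (Unique-filter odd? (UniqueP.allFin⁺ (suc s))) e e≤k lens roomˢ (proj₂ nonempty)
    decide (yes (i , i′ , ne , z , z′ , odd)) =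
      -- As k′ is odd, k = 2 + 2 * (k′ / 2), so a path of length two reaches length k by moves
      -- alone.
      D.even-link (subfamily g g-inj g-q fam) m>0 Mm≤d m≥₁ β≥ (k′ / 2) (≤-trans (m/n≤m k′ 2) (n≤1+n k′))
        (cong suc (trans (halve k′) (cong (_+ 2 * (k′ / 2)) odd)))
      where
      g : Fin 2 → Fin (suc s)
      g zero = i
      g (suc _) = i′
      g-inj : ∀ {j j′} → g j ≡ g j′ → j ≡ j′
      g-inj {zero} {zero} _ = refl
      g-inj {zero} {suc zero} e = ⊥-elim (ne e)
      g-inj {suc zero} {zero} e = ⊥-elim (ne (sym e))
      g-inj {suc zero} {suc zero} _ = refl
      g-q : ∀ j → q (g j) ≡ legs 0 j
      g-q zero = z
      g-q (suc zero) = z′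

  module Dich = Dichotomy G s k′

  module FromDense (D≤d : D ≤ K′ * d) (deg≥ : ∀ v → d + suc (size Dich.B.js) ≤ deg G v) (n>0 : 0 < n) (d>0 : 0 < d) where

    module Cnt = Dich.Counting {d} {D} {K′} deg≥ deg≤ D≤d K′>0 n>0 M₀ L₀

    module _ (M₀≥ : 1 + (suc s + suc s) * Cnt.C ≤ M₀) where

      covered-nonempty : ∀ σ → Cnt.Dense σ → 0 < length (Cnt.bad σ)
      covered-nonempty σ dense = positive (length (Cnt.bad σ)) dense
        where
        Ω>0 : 0 < length (Dich.Pat.T.Ω σ)
        Ω>0 = ≤-trans (*-mono-≤ n>0 (m^n>0 d {{>-nonZero d>0}} (size (Dich.Pat.T.js σ)))) (Dich.embeddings-count deg≥ (Dich.Pat.T.T σ) (Dich.Pat.size≤ σ))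
        positive : ∀ l → length (Dich.Pat.T.Ω σ) ≤ Cnt.C * l → 0 < l
        positive zero le = ⊥-elim (<⇒≱ Ω>0 (≤-trans le (≤-reflexive (*-zeroʳ Cnt.C))))
        positive (suc l) _ = s≤s z≤n

      -- A link has two legs, so this is where s ≥ 2 of the theorem is used. It gives one bound on
      -- the number of keys for all shapes.
      extra≤ : ∀ σ → Dich.Pattern.extra (Dich.pattern-of σ) ≤ s
      extra≤ (spid v) = ≤-refl
      extra≤ (link _ _ _ _) = s≥1

      stabilised : ∀ σ → Cnt.Dense σ →
        Stabilised (VecP.≡-dec _≟_) (Dich.Petal (Dich.Pat.T.inner σ)) (suc M₀) (suc L₀) (Dich.Pat.T.keys σ) (Dich.Pat.T.Ω σ)
      stabilised σ dense = stabilise (VecP.≡-dec _≟_) (Dich.Pat.T.petal-irr σ) M₀ (suc L₀) Cnt.C (Dich.Pat.T.keys σ) (Dich.Pat.T.Ω σ)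
        (Cnt.packing σ) (covered-nonempty σ dense) dense
        (≤-trans (+-monoʳ-≤ 1 (*-monoˡ-≤ Cnt.C (≤-trans (≤-reflexive (Dich.Pat.T.length-keys σ)) (+-mono-≤ (s≤s (extra≤ σ)) (s≤s (extra≤ σ)))))) M₀≥)

      anchored : ∀ σ → Cnt.Dense σ → Anchored (suc s) k bound
      anchored σ@(spid v) dense = finish-spider (λ i → toℕ (Vec.lookup v i)) (λ i → ≤-pred (toℕ<n (Vec.lookup v i)))
        (Dich.Pat.T.family σ deg≥ (Dich.Pat.size≤ σ) deg≤ K′>0 d>0 D≤d (stabilised σ dense))
      anchored σ@(link i a q₀ h≤) dense = finish-link q₀ (≤-trans (m≤n+m (suc q₀) a) h≤) fam tail
        where
        fam : Family (legs q₀) L M d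
        fam = Dich.Pat.T.family σ deg≥ (Dich.Pat.size≤ σ) deg≤ K′>0 d>0 D≤d (stabilised σ dense)
        tail : 1 ≤ q₀ → TailMove fam
        tail q₀≥1 {x} x∈ = from (Dich.Pat.T.tail-move σ deg≥ (Dich.Pat.size≤ σ) deg≤ K′>0 d>0 D≤d (stabilised σ dense) x∈ zero (sym (suc-pred q₀ {{>-nonZero q₀≥1}})))
          where
          open Family fam
          module T = Dich.Pat.T σ
          P≢ : ∀ {r} → r ≤ suc q₀ → 1 ≤ r → T.P (suc zero) 0 ≢ T.P zero r
          P≢ {r} le r≥1 eq = go (T.P-inj (suc zero) zero z≤n le eq)
            where
            go : SamePlace (Fin.suc {1} zero) 0 zero r → ⊥
            go (inj₁ (_ , z)) = <⇒≢ r≥1 (sym z)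
          from : Abundant d M (λ v → ∃ λ y → y ∈ objs × at y zero q₀ ≡ v × Agree (T.end zero ∷ T.P zero q₀ ∷ []) y x) →
                 Abundant d M (TwoLegs.TailMoved fam W W<L MW<d x)
          from (vs , u , many , ext) = vs , u , many , λ v∈ → let y , y∈ , e , agr = ext v∈ in
            y , y∈ , e , agr (T.P (suc zero) 0) λ { (here eq) → P≢ ≤-refl (s≤s z≤n) eq ; (there (here eq)) → P≢ (n≤1+n q₀) q₀≥1 eq }

      conclusion : 2 * (n ^ suc s * sunBound Cnt.block Dich.N) < n * d ^ size Dich.B.js → Anchored (suc s) k bound
      conclusion big = let σ , dense = Cnt.some-dense big in anchored σ dense

-- Choice of the constants

module Constants (s k′ t K : ℕ) where

  S k E bound K′ C M₀ M Q Wˢ Wˡ W m Lₑ L₀ β₀ Bs M∞ : ℕ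
  S = suc s
  k = suc k′
  E = S * k
  bound = S + t * suc (S * k)
  -- `K′` bounds D / d, as D is K δ and d is at least a quarter of δ.
  K′ = 4 * K
  C = 2 * (suc (length (shapes S k′)) * K′ ^ E)
  M₀ = 1 + (S + S) * C
  M = suc M₀ * K′
  Q = suc (suc bound + S * k)
  Wˢ = bound + S + S * (2 * (S * k))
  Wˡ = suc bound + S * k + 3 + 2 * k
  W = Wˢ + Wˡ
  m = 2 * (suc (suc bound) + Q) * (K′ * M)
  -- The number of petals for `odd-link₂`; adding W in `L₀` makes the petals outnumber the forbidden
  -- vertices too.
  Lₑ = S + K′ * M * Q * (2 * 2 ^ m)
  L₀ = W + Lₑ
  -- A sum in place of a maximum: β must exceed W, allow m moves, leave S columns after each of the
  -- two uses of Kővári-Sós-Turán, and cover the degree slack suc E.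
  β₀ = suc W + (m + (2 * (2 ^ m * S) + (2 * (2 ^ (m * m) * S) + suc E)))
  Bs = sunBound (suc M₀ * suc L₀) (suc E)
  -- The first summand forces δ ≥ 2 * M * β₀ after comparing E-th powers; the second gives the count
  -- `enough`, with 4 ^ E from δ ≤ 4 * d.
  M∞ = (2 * M * β₀) ^ E + 4 ^ E * suc (2 * Bs)

  module _ (K≥1 : 1 ≤ K) where

    K′>0 : 0 < K′
    K′>0 = ≤-trans K≥1 (m≤m+n K _)

    M>0 : 0 < M
    M>0 = *-mono-≤ {1} {suc M₀} (s≤s z≤n) K′>0

    m>0 : 0 < m
    m>0 = *-mono-≤ {1} {2 * (suc (suc bound) + Q)} (s≤s z≤n) (*-mono-≤ K′>0 M>0)

    module _ {n : ℕ} (n>0 : 0 < n) {δ : ℕ} (large : M∞ * n ^ s ≤ δ ^ E) where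

      n^>0 : ∀ a → 0 < n ^ a
      n^>0 a = m^n>0 n {{>-nonZero n>0}} a

      δ≥ : 2 * M * β₀ ≤ δ
      δ≥ = ≮⇒≥ λ lt → <⇒≱ (^-monoˡ-< E lt) (begin
        (2 * M * β₀) ^ E                         ≤⟨ m≤m+n _ (4 ^ E * suc (2 * Bs)) ⟩
        M∞                                       ≤⟨ m≤m*n M∞ (n ^ s) {{>-nonZero (n^>0 s)}} ⟩
        M∞ * n ^ s                               ≤⟨ large ⟩
        δ ^ E                                    ∎)
        where open ≤-Reasoning

      2M>0 : NonZero (2 * M)
      2M>0 = >-nonZero (*-mono-≤ {1} {2} (s≤s z≤n) M>0)

      -- d is a multiple of M, so that M * β ≤ d and D ≤ K′ * M * β hold without rounding. It is
      -- about half of δ; the other half provides the slack suc E.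
      β d : ℕ
      β = _/_ δ (2 * M) {{2M>0}}
      d = M * β

      β≥ : β₀ ≤ β
      β≥ = begin
        β₀                                       ≡⟨ sym (m*n/n≡m β₀ (2 * M) {{2M>0}}) ⟩
        _/_ (β₀ * (2 * M)) (2 * M) {{2M>0}}      ≤⟨ /-monoˡ-≤ (2 * M) {{2M>0}} (≤-trans (≤-reflexive (*-comm β₀ (2 * M))) δ≥) ⟩
        β                                        ∎
        where open ≤-Reasoning

      β*≤δ : β * (2 * M) ≤ δ
      β*≤δ = m/n*n≤m δ (2 * M) {{2M>0}}

      W<β : W < β
      W<β = ≤-trans (m≤m+n (suc W) _) β≥

      m≤β : m ≤ β
      m≤β = ≤-trans (≤-trans (m≤m+n m _) (m≤n+m _ (suc W))) β≥

      S₁≤β : 2 * (2 ^ m * S) ≤ β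
      S₁≤β = ≤-trans (≤-trans (m≤m+n (2 * (2 ^ m * S)) _) (≤-trans (m≤n+m _ m) (m≤n+m _ (suc W)))) β≥

      S₂≤β : 2 * (2 ^ (m * m) * S) ≤ β
      S₂≤β = ≤-trans (≤-trans (m≤m+n (2 * (2 ^ (m * m) * S)) _) (≤-trans (m≤n+m _ (2 * (2 ^ m * S))) (≤-trans (m≤n+m _ m) (m≤n+m _ (suc W))))) β≥

      E<β : suc E ≤ β
      E<β = ≤-trans (≤-trans (m≤n+m (suc E) (2 * (2 ^ (m * m) * S))) (≤-trans (m≤n+m _ (2 * (2 ^ m * S))) (≤-trans (m≤n+m _ m) (m≤n+m _ (suc W))))) β≥

      β>0 : 0 < β
      β>0 = ≤-trans (s≤s z≤n) E<β

      β≤d : β ≤ d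
      β≤d = m≤n*m β M {{>-nonZero M>0}}

      d+E≤δ : d + suc E ≤ δ
      d+E≤δ = begin
        d + suc E                                ≤⟨ +-monoʳ-≤ d (≤-trans E<β β≤d) ⟩
        M * β + M * β                            ≡⟨ solve 2 (λ M b → M :* b :+ M :* b := b :* (con 2 :* M)) refl M β ⟩
        β * (2 * M)                              ≤⟨ β*≤δ ⟩
        δ                                        ∎
        where open ≤-Reasoning

      δ≤4d : δ ≤ 4 * d
      δ≤4d = begin
        δ                                        ≡⟨ m≡m%n+[m/n]*n δ (2 * M) {{2M>0}} ⟩
        _%_ δ (2 * M) {{2M>0}} + β * (2 * M)     ≤⟨ +-monoˡ-≤ (β * (2 * M)) (<⇒≤ (m%n<n δ (2 * M) {{2M>0}})) ⟩
        2 * M + β * (2 * M)                      ≤⟨ +-monoˡ-≤ (β * (2 * M)) (m≤n*m (2 * M) β {{>-nonZero β>0}}) ⟩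
        β * (2 * M) + β * (2 * M)                ≡⟨ solve 2 (λ M b → b :* (con 2 :* M) :+ b :* (con 2 :* M) := con 4 :* (M :* b)) refl M β ⟩
        4 * d                                    ∎
        where open ≤-Reasoning

      Kδ≤K′d : K * δ ≤ K′ * d
      Kδ≤K′d = begin
        K * δ                                    ≤⟨ *-monoʳ-≤ K δ≤4d ⟩
        K * (4 * d)                              ≡⟨ solve 2 (λ K d → K :* (con 4 :* d) := con 4 :* K :* d) refl K d ⟩
        K′ * d                                   ∎
        where open ≤-Reasoning

      Kδ>0 : 0 < K * δ
      Kδ>0 = *-mono-≤ K≥1 (≤-trans (≤-trans β>0 β≤d) (≤-trans (m≤m+n d (suc E)) d+E≤δ))

      enough : 2 * (n ^ S * Bs) < n * d ^ E
      enough = begin-strict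
        2 * (n ^ S * Bs)                         ≡⟨ solve 2 (λ a b → con 2 :* (a :* b) := con 2 :* b :* a) refl (n ^ S) Bs ⟩
        2 * Bs * n ^ S                           <⟨ *-monoˡ-< (n ^ S) {{>-nonZero (n^>0 S)}} (n<1+n (2 * Bs)) ⟩
        suc (2 * Bs) * n ^ S                     ≡⟨ solve 3 (λ b n x → b :* (n :* x) := n :* (b :* x)) refl (suc (2 * Bs)) n (n ^ s) ⟩
        n * (suc (2 * Bs) * n ^ s)               ≤⟨ *-monoʳ-≤ n core ⟩
        n * d ^ E                                ∎
        where
        open ≤-Reasoning
        core : suc (2 * Bs) * n ^ s ≤ d ^ E
        core = *-cancelˡ-≤ (4 ^ E) {{>-nonZero (m^n>0 4 E)}} (begin
          4 ^ E * (suc (2 * Bs) * n ^ s)         ≡⟨ sym (*-assoc (4 ^ E) (suc (2 * Bs)) (n ^ s)) ⟩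
          4 ^ E * suc (2 * Bs) * n ^ s           ≤⟨ *-monoˡ-≤ (n ^ s) (m≤n+m _ ((2 * M * β₀) ^ E)) ⟩
          M∞ * n ^ s                             ≤⟨ large ⟩
          δ ^ E                                  ≤⟨ ^-monoˡ-≤ E δ≤4d ⟩
          (4 * d) ^ E                            ≡⟨ ^-distribʳ-* E 4 d ⟩
          4 ^ E * d ^ E                          ∎)

      subdivision : 1 ≤ s → (G : Graph n) → (∀ v → δ ≤ deg G v) → (∀ v → deg G v ≤ K * δ) → ContainsSubdivKst G S t k
      subdivision s≥1 G deg≥ deg≤ =
        let ys , ys-inj , rob = conclusion in Paths.assemble G ys ys-inj rob
        where
        module F = Finish G s k′ s≥1 {d} {K * δ} {K′} {β} {bound} {W} {M₀} {L₀} m {{>-nonZero Kδ>0}} deg≤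
          (≤-trans Kδ≤K′d (≤-reflexive (sym (*-assoc K′ M β)))) K′>0 β>0 ≤-refl
          (s≤s (m≤m+n W Lₑ)) (*-monoʳ-< M {{>-nonZero M>0}} W<β) (m≤m+n Wˢ Wˡ) (m≤n+m Wˡ Wˢ) m>0 (*-monoʳ-≤ M m≤β) ≤-refl
          (≤-trans (m≤n+m Lₑ W) (n≤1+n L₀)) S₁≤β S₂≤β
        size≡ : size F.Dich.B.js ≡ E
        size≡ = F.Dich.B-size
        module D = F.FromDense Kδ≤K′d (λ v → ≤-trans (subst (λ z → d + suc z ≤ δ) (sym size≡) d+E≤δ) (deg≥ v)) n>0 (≤-trans β>0 β≤d)
        C≡ : D.Cnt.C ≡ C
        C≡ = cong (λ z → 2 * (suc (length (shapes S k′)) * K′ ^ z)) size≡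
        conclusion : Links.Anchored G S k bound
        conclusion = D.conclusion (≤-reflexive (cong (λ c → 1 + (S + S) * c) C≡))
          (subst (λ z → 2 * (n ^ S * sunBound (suc M₀ * suc L₀) (suc z)) < n * d ^ z) (sym size≡) enough)

theorem2p2 : (s t k K : ℕ) → 2 ≤ s → 2 ≤ t → 2 ≤ k → 1 ≤ K →
    (G : (n : ℕ) → Graph n) (δ : ℕ → ℕ) →
    (∀ n → AlmostRegular K (G n)) →
    (∀ n → IsMinDegree (G n) (δ n)) →
    (∀ M → ∃ λ N → ∀ n → N ≤ n → M * n ^ (s ∸ 1) ≤ δ n ^ (s * k)) →
    ∃ λ N → ∀ n → N ≤ n → ContainsSubdivKst (G n) s t k
theorem2p2 (suc s) t (suc k′) K (s≤s s≥1) _ _ K≥1 G δ regular minimal growth =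
  let N , large = growth (Constants.M∞ s k′ t K)
  -- The successor makes n positive, so that a vertex attaining the minimum degree exists.
  in suc N , λ n N<n →
    let n>0 = ≤-trans (s≤s z≤n) N<n
        v , deg-v = proj₂ (minimal n) n>0
    in Constants.subdivision s k′ t K K≥1 n>0 (large n (<⇒≤ N<n)) s≥1 (G n) (proj₁ (minimal n))
         λ u → ≤-trans (regular n u v) (≤-reflexive (cong (K *_) deg-v))
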